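{- Let $q$ be a prime power, $\Delta$ an $n\times n$ diagonal matrix over $\mathbb{F}_q$ with distinct diagonal entries $\delta_1,\dots,\delta_n$, and $\mu=(\mu_1,\dots,\mu_k)$ a partition with positive parts. Let $C\subseteq[n]$ with $|C|=\mu_1$, and let $\Delta'$ be the $(n-\mu_1)\times(n-\mu_1)$ diagonal matrix whose diagonal entries are $\delta_t$ for $t\in[n]\setminus C$, in increasing order of $t$. Then $$\sigma^C_n(\mu)=(q-1)^{\mu_2}q^{\binom{\mu_2}{2}}\sum_D c_q(T(C,D))\,\sigma'^{D}_{n-\mu_1}((\mu_2,\dots,\mu_k)),$$ the sum over all $D\subseteq[n-\mu_1]$ with $|D|=\mu_2$ such that $T(C,D)$ is a multilinear tableau. Here $\sigma^C_n(\mu)$ is the number of subspaces of $\mathbb{F}_q^n$ with pivots $C$ and $\Delta$-profile $\mu$, and $\sigma'^D_{n-\mu_1}(\nu)$ is the number of subspaces of $\mathbb{F}_q^{n-\mu_1}$ with pivots $D$ and $\Delta'$-profile $\nu$ (with $\mu_2=0$ and $\nu$ empty if $k=1$).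
   Context: $W$ has $\Delta$-profile $\mu$ if $\dim(W+\Delta W+\dots+\Delta^{j-1}W)=\mu_1+\dots+\mu_j$ for $1\le j\le k$ and $\dim(W+\dots+\Delta^{k-1}W)=\dim(W+\dots+\Delta^kW)$. A subspace $W$ of dimension $m$ has pivots $C=(c_1<\dots<c_m)$ if its basis in reduced row echelon form has leading $1$ of row $i$ in column $c_i$. Let $\phi_C:[n-\mu_1]\to[n]\setminus C$ be the order-preserving bijection; $T(C,D)$ is the two-column array whose first column is $C$ and second column is $\phi_C(D)$, both in increasing order top to bottom. A multilinear tableau is an array of distinct positive integers with rows increasing left to right and columns increasing top to bottom. For a multilinear tableau $T$ of shape $(\lambda_1,\dots,\lambda_r)$ and $2\le j\le\lambda_i$, $c_{ij}(T)=\#\{i'\ge i:\text{cell }(i',j-1)\text{ exists and }T_{i',j-1}<T_{ij}\}$, $c_q(T)=\prod_i\prod_{j=2}^{\lambda_i}[c_{ij}(T)]_q$ with $[a]_q=1+q+\dots+q^{a-1}$. -}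

module Defs where

open import Data.Nat using (ℕ; zero; suc; _+_; _*_; _∸_; _^_; _⊔_; _<ᵇ_; _≤ᵇ_; _≡ᵇ_)
open import Data.Bool using (Bool; true; false; _∧_; _∨_; not; if_then_else_)
open import Data.Bool.ListAction using (all; any; and)
open import Data.Nat.ListAction using (sum; product)
open import Data.List using (List; []; _∷_; [_]; _++_; length; map; filterᵇ; concatMap; zipWith; replicate; applyUpTo; upTo; take; foldr; cartesianProductWith; zip)
open import Data.Maybe using (Maybe; just; nothing)
open import Data.Product using (∃; _×_; _,_)
open import Relation.Binary.PropositionalEquality using (_≡_; _≢_)
open import Relation.Binary.Definitions using (DecidableEquality)
open import Relation.Nullary.Decidable using (isYes)
open import Algebra.Core using (Op₁; Op₂)
open import Algebra.Structures using (IsCommutativeRing)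
open import Data.List.Membership.Propositional using (_∈_)
open import Data.List.Relation.Unary.Unique.Propositional using (Unique)

record FiniteField : Set₁ where
  field
    Carrier : Set
    _+F_ _*F_ : Op₂ Carrier
    -F_ : Op₁ Carrier
    0F 1F : Carrier
    isCommutativeRing : IsCommutativeRing _≡_ _+F_ _*F_ -F_ 0F 1F
    0≢1 : 0F ≢ 1F
    inverse : ∀ x → x ≢ 0F → ∃ λ y → x *F y ≡ 1F
    _≟F_ : DecidableEquality Carrier
    elements : List Carrier
    elements-complete : ∀ x → x ∈ elements
    elements-unique : Unique elements

  q : ℕ
  q = length elements

nthD : {A : Set} → A → List A → ℕ → A
nthD d []       _       = d
nthD d (x ∷ xs) zero    = x
nthD d (x ∷ xs) (suc i) = nthD d xs i

index : {A : Set} → List A → ℕ → Maybe A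
index []       _       = nothing
index (x ∷ xs) zero    = just x
index (x ∷ xs) (suc i) = index xs i

listsOver : {A : Set} → List A → ℕ → List (List A)
listsOver xs zero    = [ [] ]
listsOver xs (suc m) = cartesianProductWith _∷_ xs (listsOver xs m)

sublists : {A : Set} → List A → List (List A)
sublists []       = [ [] ]
sublists (x ∷ xs) = sublists xs ++ map (x ∷_) (sublists xs)

consecutive : {A : Set} → (A → A → Bool) → List A → Bool
consecutive r []           = true
consecutive r (x ∷ [])     = true
consecutive r (x ∷ y ∷ xs) = r x y ∧ consecutive r (y ∷ xs)

distinctᵇ : List ℕ → Bool
distinctᵇ []       = true
distinctᵇ (x ∷ xs) = not (any (x ≡ᵇ_) xs) ∧ distinctᵇ xs

iter : {A : Set} → ℕ → (A → A) → A → A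
iter zero    f x = x
iter (suc i) f x = f (iter i f x)

range : ℕ → ℕ → List ℕ
range a b = applyUpTo (a +_) (suc b ∸ a)

headOr0 : List ℕ → ℕ
headOr0 []      = 0
headOr0 (x ∷ _) = x

-- Subsets of [n] = {1..n} as strictly increasing lists

subsetsOfSize : ℕ → ℕ → List (List ℕ)
subsetsOfSize zero    zero    = [ [] ]
subsetsOfSize zero    (suc m) = []
subsetsOfSize (suc n) zero    = [ [] ]
subsetsOfSize (suc n) (suc m) =
  subsetsOfSize n (suc m) ++ map (_++ [ suc n ]) (subsetsOfSize n m)

complementIn : ℕ → List ℕ → List ℕ
complementIn n C = filterᵇ (λ t → not (any (t ≡ᵇ_) C)) (range 1 n)

-- φ_C : [n - |C|] → [n] \ C, order-preserving bijection
φ : ℕ → List ℕ → ℕ → ℕ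
φ n C d = nthD 0 (complementIn n C) (d ∸ 1)

-- Linear algebra over a finite field: vectors of F_q^n are lists of length n

module LinAlg (F : FiniteField) where
  open FiniteField F public

  isZero : Carrier → Bool
  isZero x = isYes (x ≟F 0F)

  isOne : Carrier → Bool
  isOne x = isYes (x ≟F 1F)

  isZeroVec : List Carrier → Bool
  isZeroVec = all isZero

  lincomb : ℕ → List Carrier → List (List Carrier) → List Carrier
  lincomb n cs vs = foldr (zipWith _+F_) (replicate n 0F) (zipWith (λ c v → map (c *F_) v) cs vs)

  independent : ℕ → List (List Carrier) → Bool
  independent n vs =
    all (λ cs → isZeroVec cs ∨ not (isZeroVec (lincomb n cs vs))) (listsOver elements (length vs))

  dimSpan : ℕ → List (List Carrier) → ℕ
  dimSpan n vs = foldr _⊔_ 0 (map length (filterᵇ (independent n) (sublists vs)))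

  applyDiag : List Carrier → List Carrier → List Carrier
  applyDiag δ v = zipWith _*F_ δ v

  krylovDim : ℕ → List Carrier → List (List Carrier) → ℕ → ℕ
  krylovDim n δ M j = dimSpan n (concatMap (λ i → map (iter i (applyDiag δ)) M) (upTo j))

  hasProfile : ℕ → List Carrier → List (List Carrier) → List ℕ → Bool
  hasProfile n δ M μ =
    all (λ j → krylovDim n δ M j ≡ᵇ sum (take j μ)) (range 1 (length μ))
    ∧ (krylovDim n δ M (length μ) ≡ᵇ krylovDim n δ M (suc (length μ)))

  entry : List Carrier → ℕ → Carrier
  entry row c = nthD 0F row (c ∸ 1)

  isRREFWithPivots : ℕ → List ℕ → List (List Carrier) → Bool
  isRREFWithPivots n C M =
    (length M ≡ᵇ length C)
    ∧ all (λ row → length row ≡ᵇ n) M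
    ∧ all (λ { (c , row) →
          isOne (entry row c)
          ∧ all (λ t → isZero (entry row t)) (range 1 (c ∸ 1))
          ∧ all (λ c' → (c' ≡ᵇ c) ∨ isZero (entry row c')) C })
        (zip C M)

  -- σ^C_n(μ) for Δ = diag(δ): number of subspaces of F_q^n with pivots C
  -- and Δ-profile μ, each subspace counted via its (unique) RREF basis
  sigma : ℕ → List Carrier → List ℕ → List ℕ → ℕ
  sigma n δ C μ =
    length (filterᵇ (λ M → isRREFWithPivots n C M ∧ hasProfile n δ M μ)
                    (listsOver (listsOver elements n) (length C)))

  restrictDiag : ℕ → List Carrier → List ℕ → List Carrier
  restrictDiag n δ C = map (λ t → nthD 0F δ (t ∸ 1)) (complementIn n C)

-- Tableaux: list of rows (row i = (T_{i1}, ..., T_{iλ_i})), entries in ℕ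

Tableau : Set
Tableau = List (List ℕ)

cell : Tableau → ℕ → ℕ → Maybe ℕ
cell T i j with index T (i ∸ 1)
... | nothing  = nothing
... | just row = index row (j ∸ 1)

isMultilinear : Tableau → Bool
isMultilinear T =
  all (λ row → 1 ≤ᵇ length row) T
  ∧ consecutive (λ r r' → length r' ≤ᵇ length r) T
  ∧ all (λ row → all (1 ≤ᵇ_) row) T
  ∧ distinctᵇ (foldr _++_ [] T)
  ∧ all (consecutive _<ᵇ_) T
  ∧ consecutive (λ r r' → and (zipWith _<ᵇ_ r r')) T

cij : Tableau → ℕ → ℕ → ℕ
cij T i j = length (filterᵇ test (range i (length T)))
  where
  test : ℕ → Bool
  test i' with cell T i' (j ∸ 1) | cell T i j
  ... | just a  | just b  = a <ᵇ b
  ... | _       | _       = false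

qint : ℕ → ℕ → ℕ
qint q a = sum (applyUpTo (q ^_) a)

cq : ℕ → Tableau → ℕ
cq q T =
  product (concatMap (λ { (i , row) → map (λ j → qint q (cij T i j)) (range 2 (length row)) })
                     (zip (range 1 (length T)) T))

twoColumns : List ℕ → List ℕ → Tableau
twoColumns []       _        = []
twoColumns (c ∷ cs) []       = [ c ] ∷ twoColumns cs []
twoColumns (c ∷ cs) (e ∷ es) = (c ∷ e ∷ []) ∷ twoColumns cs es

T[_,_]in : List ℕ → List ℕ → ℕ → Tableau
T[ C , D ]in n = twoColumns C (map (φ n C) D)

{-# OPTIONS --safe #-}

-- Write W as the row space of a reduced echelon matrix M with pivots C. Row i of MΔ − Δ_C M vanishes on
-- the columns of C; deleting those columns gives a matrix B with W + ΔW + ⋯ + Δ^j W = W ⊕ (row space of B,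
-- BΔ′, …, BΔ′^(j−1)). Hence W has Δ-profile (μ₁, ν) iff the row space U of B has Δ′-profile ν. Since the
-- δ_t are distinct, M ↦ B is a bijection onto the matrices with B_{i,t} = 0 for φ(t) < c_i.
-- Such a B factors uniquely as X N with N the echelon basis of U, D its pivot set, and X of full column rank
-- with X_{i,j} = 0 unless c_i < φ(d_j). Choosing the columns of X one after the other gives
-- ∏_j (q^{r_j} − q^{j−1}) matrices X, where r_j = #{i : c_i < φ(d_j)}; this is
-- (q−1)^ℓ q^{ℓ(ℓ−1)/2} ∏_j [r_j − j + 1]_q, and r_j − j + 1 = c_{j2}(T(C,D)).
module Submission where

open import Defs
open import Data.Nat hiding (_!)
open import Data.Nat.Properties
open import Data.Nat.ListAction using (sum; product)
open import Data.Bool using (Bool; true; false; _∧_; _∨_; not; if_then_else_; T; T?)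
open import Data.Bool.Properties using (T-∧; T-∨)
open import Data.Bool.ListAction using (all; any; and)
open import Data.List using (List; []; _∷_; [_]; _++_; length; map; filterᵇ; concatMap; zipWith; replicate; applyUpTo; upTo; take; foldr; cartesianProductWith; cartesianProduct; zip)
open import Data.List.Properties
open import Data.List.Membership.Propositional using (_∈_; _∉_)
open import Data.List.Membership.Propositional.Properties
open import Data.List.Relation.Binary.Subset.Propositional using (_⊆_)
open import Data.List.Relation.Unary.Any as Any using (here; there)
open import Data.List.Relation.Unary.All as All using (All; []; _∷_)
import Data.List.Relation.Unary.All.Properties as AllP
open import Data.List.Relation.Unary.AllPairs as AllPairs using (AllPairs; []; _∷_)
import Data.List.Relation.Unary.AllPairs.Properties as APP
open import Data.List.Relation.Unary.Unique.Propositional using (Unique)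
import Data.List.Relation.Unary.Unique.Propositional.Properties as UP
open import Data.List.Relation.Binary.Pointwise as PW using (Pointwise; []; _∷_)
open import Data.Product using (∃; ∃₂; _×_; _,_; proj₁; proj₂)
open import Data.Sum using (_⊎_; inj₁; inj₂; [_,_]′)
open import Data.Empty using (⊥; ⊥-elim)
open import Function using (_∘_; id; Equivalence; case_of_)
open import Relation.Nullary
open import Relation.Nullary.Decidable using (isYes)
open import Relation.Binary.Definitions using (tri<; tri≈; tri>)
open import Relation.Binary.PropositionalEquality using (_≡_; _≢_; refl; sym; trans; cong; cong₂; subst; subst₂; module ≡-Reasoning)
open import Algebra.Bundles using (CommutativeRing)
import Algebra.Properties.Ring as RingProps
import Algebra.Properties.CommutativeSemigroup as CommProps
open import Data.List.Membership.Propositional using (find; lose)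
open import Data.List.Membership.DecPropositional _≟_ using (_∈?_)
open import Data.List.Relation.Binary.Permutation.Propositional as Perm using (_↭_; ↭-sym)
import Data.List.Relation.Binary.Permutation.Propositional.Properties as PermP
open import Data.Maybe using (just)
open import Data.Nat.Combinatorics using (nC1≡n; nCk+nC[k+1]≡[n+1]C[k+1]) renaming (_C_ to _choose_)
open import Data.Nat.Solver using (module +-*-Solver)
open import Algebra.Structures using (module IsCommutativeRing)
open import Data.List.Relation.Unary.Linked using (Linked; [-]; _∷_)
open import Data.List.Relation.Unary.Linked.Properties using (Linked⇒AllPairs)

-- Row i of MΔ - Δ_C M has the entry (δ_t - δ_c) M_{i,t} in column t, where c is the i-th pivot.
-- This factor is zero at t = c and invertible elsewhere, so division recovers M from B, and the
-- leading zeros of M become the support condition on B. X is B restricted to the columns D, where N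
-- is the identity, so it inherits that condition; conversely the zeros of N to the left of its
-- pivots make X N supported when X is. The columns of X are chosen in increasing order of φ(d_j)
-- because their supports are then nested: the span of the columns already chosen lies inside the
-- next support, and exactly q^(j-1) of its q^(r_j) vectors are forbidden. The count is made for
-- every D of the right size. If T(C,D) is not multilinear, then at the first row where c_j < φ(d_j)
-- fails one has r_j ≤ j - 1, and the truncated factor is 0; this is what restricts the sum.
-- Dimension is defined as a maximum over sublists, so ranks are compared by counting the q^a
-- vectors in the span of a independent ones.

private variable
  α β γ : Set

-- Counting with duplicate-free lists

Unique-⊆⇒length≤ : {xs ys : List α} → Unique xs → xs ⊆ ys → length xs ≤ length ys
Unique-⊆⇒length≤ [] _ = z≤n
Unique-⊆⇒length≤ {xs = x ∷ xs} (x∉ ∷ u) sub with ∈-∃++ (sub (here refl))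
... | as , bs , refl = subst (suc (length xs) ≤_) eq (s≤s (Unique-⊆⇒length≤ u sub′))
  where
  eq : suc (length (as ++ bs)) ≡ length (as ++ x ∷ bs)
  eq = trans (cong suc (length-++ as)) (trans (sym (+-suc (length as) _)) (sym (length-++ as)))
  sub′ : xs ⊆ as ++ bs
  sub′ {z} z∈ with ∈-++⁻ as (sub (there z∈))
  ... | inj₁ p = ∈-++⁺ˡ p
  ... | inj₂ (here refl) = ⊥-elim (All.lookup x∉ z∈ refl)
  ... | inj₂ (there p) = ∈-++⁺ʳ as p

-- The form in which bijections are turned into equal cardinalities: one side is mapped injectively
-- and then compared with the other side as a set.
Unique-≈⇒length≡ : {xs ys : List α} → Unique xs → Unique ys → xs ⊆ ys → ys ⊆ xs → length xs ≡ length ys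
Unique-≈⇒length≡ u v s t = ≤-antisym (Unique-⊆⇒length≤ u s) (Unique-⊆⇒length≤ v t)

map-Unique : (f : α → β) {xs : List α} → Unique xs →
  (∀ {x y} → x ∈ xs → y ∈ xs → f x ≡ f y → x ≡ y) → Unique (map f xs)
map-Unique f [] inj = []
map-Unique f (x∉ ∷ u) inj =
  AllP.map⁺ (All.tabulate λ y∈ e → All.lookup x∉ y∈ (inj (here refl) (there y∈) e))
  ∷ map-Unique f u (λ p q → inj (there p) (there q))

concatMap-Unique : (g : α → List β) {xs : List α} → Unique xs → (∀ x → Unique (g x)) →
  (∀ {x y b} → b ∈ g x → b ∈ g y → x ≡ y) → Unique (concatMap g xs)
concatMap-Unique g [] ug dis = []
concatMap-Unique g {x ∷ xs} (x∉ ∷ u) ug dis =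
  UP.++⁺ (ug x) (concatMap-Unique g u ug dis) λ (p , q) → disj p q
  where
  disj : ∀ {b} → b ∈ g x → b ∈ concatMap g xs → ⊥
  disj p q with ∈-concat⁻′ (map g xs) q
  ... | ys , b∈ , ys∈ with ∈-map⁻ g ys∈
  ... | y , y∈ , refl = All.lookup x∉ y∈ (dis p b∈)

∈-concatMap⁺′ : (g : α → List β) {xs : List α} {x : α} {b : β} → x ∈ xs → b ∈ g x → b ∈ concatMap g xs
∈-concatMap⁺′ g x∈ b∈ = ∈-concat⁺′ b∈ (∈-map⁺ g x∈)

∈-concatMap⁻′ : (g : α → List β) (xs : List α) {b : β} → b ∈ concatMap g xs → ∃ λ x → x ∈ xs × b ∈ g x
∈-concatMap⁻′ g xs q with ∈-concat⁻′ (map g xs) q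
... | ys , b∈ , ys∈ with ∈-map⁻ g ys∈
... | y , y∈ , refl = y , y∈ , b∈

length-concatMap : (g : α → List β) (xs : List α) → length (concatMap g xs) ≡ sum (map (length ∘ g) xs)
length-concatMap g [] = refl
length-concatMap g (x ∷ xs) = trans (length-++ (g x)) (cong (length (g x) +_) (length-concatMap g xs))

length-concatMap-const : (g : α → List β) (k : ℕ) (xs : List α) → (∀ {x} → x ∈ xs → length (g x) ≡ k) →
  length (concatMap g xs) ≡ length xs * k
length-concatMap-const g k [] h = refl
length-concatMap-const g k (x ∷ xs) h =
  trans (length-++ (g x)) (cong₂ _+_ (h (here refl)) (length-concatMap-const g k xs (h ∘ there)))

length-cartesianProductWith : (f : α → β → γ) (xs : List α) (ys : List β) →
  length (cartesianProductWith f xs ys) ≡ length xs * length ys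
length-cartesianProductWith f [] ys = refl
length-cartesianProductWith f (x ∷ xs) ys =
  trans (length-++ (map (f x) ys)) (cong₂ _+_ (length-map (f x) ys) (length-cartesianProductWith f xs ys))

length-filterᵇ-not : (p : α → Bool) (xs : List α) →
  length (filterᵇ (not ∘ p) xs) ≡ length xs ∸ length (filterᵇ p xs)
length-filterᵇ-not p [] = refl
length-filterᵇ-not p (x ∷ xs) with p x
... | true = length-filterᵇ-not p xs
... | false = trans (cong suc (length-filterᵇ-not p xs))
                    (sym (+-∸-assoc 1 (length-filter (T? ∘ p) xs)))

∈-filterᵇ⁺ : (p : α → Bool) {xs : List α} {x : α} → x ∈ xs → T (p x) → x ∈ filterᵇ p xs
∈-filterᵇ⁺ p = ∈-filter⁺ (T? ∘ p)

∈-filterᵇ⁻ : (p : α → Bool) (xs : List α) {x : α} → x ∈ filterᵇ p xs → x ∈ xs × T (p x)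
∈-filterᵇ⁻ p xs = ∈-filter⁻ (T? ∘ p) {xs = xs}

filterᵇ-Unique : (p : α → Bool) {xs : List α} → Unique xs → Unique (filterᵇ p xs)
filterᵇ-Unique p = UP.filter⁺ (T? ∘ p)

T-∧⁻ : ∀ {a b} → T (a ∧ b) → T a × T b
T-∧⁻ = Equivalence.to T-∧

T-∧⁺ : ∀ {a b} → T a → T b → T (a ∧ b)
T-∧⁺ p q = Equivalence.from T-∧ (p , q)

T-not⁺ : ∀ {b} → ¬ T b → T (not b)
T-not⁺ {false} h = _
T-not⁺ {true} h = h _

T-not⁻ : ∀ {b} → T (not b) → ¬ T b
T-not⁻ {true} ()

T-not-any⁻ : (p : α → Bool) (xs : List α) → T (not (any p xs)) → All (¬_ ∘ T ∘ p) xs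
T-not-any⁻ p [] h = []
T-not-any⁻ p (x ∷ xs) h with p x in eq
... | false = subst (¬_ ∘ T) (sym eq) (λ ()) ∷ T-not-any⁻ p xs h

T-not-any⁺ : (p : α → Bool) {xs : List α} → All (¬_ ∘ T ∘ p) xs → T (not (any p xs))
T-not-any⁺ p [] = _
T-not-any⁺ p {x ∷ xs} (h ∷ hs) with p x
... | false = T-not-any⁺ p hs
... | true = h _

-- Enumerations of lists

∈-listsOver⁺ : {xs : List α} (m : ℕ) {v : List α} → length v ≡ m → All (_∈ xs) v → v ∈ listsOver xs m
∈-listsOver⁺ zero {[]} e h = here refl
∈-listsOver⁺ (suc m) {x ∷ v} e (h ∷ hs) = ∈-cartesianProductWith⁺ _∷_ h (∈-listsOver⁺ m (suc-injective e) hs)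

∈-listsOver⁻ : (xs : List α) (m : ℕ) {v : List α} → v ∈ listsOver xs m → length v ≡ m × All (_∈ xs) v
∈-listsOver⁻ xs zero (here refl) = refl , []
∈-listsOver⁻ xs (suc m) p with ∈-cartesianProductWith⁻ _∷_ xs (listsOver xs m) p
... | a , b , a∈ , b∈ , refl with ∈-listsOver⁻ xs m b∈
... | e , h = cong suc e , a∈ ∷ h

listsOver-Unique : {xs : List α} (m : ℕ) → Unique xs → Unique (listsOver xs m)
listsOver-Unique zero u = [] ∷ []
listsOver-Unique (suc m) u = UP.cartesianProductWith⁺ _∷_ (λ { refl → refl , refl }) u (listsOver-Unique m u)

length-listsOver : (xs : List α) (m : ℕ) → length (listsOver xs m) ≡ length xs ^ m
length-listsOver xs zero = refl
length-listsOver xs (suc m) =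
  trans (length-cartesianProductWith _∷_ xs (listsOver xs m)) (cong (length xs *_) (length-listsOver xs m))

∈-sublists⇒⊆ : (xs : List α) {ys : List α} → ys ∈ sublists xs → ys ⊆ xs
∈-sublists⇒⊆ [] (here refl) = id
∈-sublists⇒⊆ (x ∷ xs) p with ∈-++⁻ (sublists xs) p
... | inj₁ q = there ∘ ∈-sublists⇒⊆ xs q
... | inj₂ q with ∈-map⁻ (x ∷_) q
... | zs , zs∈ , refl = λ { (here e) → here e ; (there r) → there (∈-sublists⇒⊆ xs zs∈ r) }

foldr-⊔-≤ : {k : ℕ} {ns : List ℕ} → All (_≤ k) ns → foldr _⊔_ 0 ns ≤ k
foldr-⊔-≤ [] = z≤n
foldr-⊔-≤ (h ∷ hs) = ⊔-lub h (foldr-⊔-≤ hs)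

∈⇒≤foldr-⊔ : {k : ℕ} {ns : List ℕ} → k ∈ ns → k ≤ foldr _⊔_ 0 ns
∈⇒≤foldr-⊔ {ns = n ∷ ns} (here refl) = m≤m⊔n n _
∈⇒≤foldr-⊔ {ns = n ∷ ns} (there p) = ≤-trans (∈⇒≤foldr-⊔ p) (m≤n⊔m n _)

-- Lists by position

nthD-map : (f : α → β) (d : α) (e : β) → f d ≡ e → (xs : List α) (i : ℕ) → nthD e (map f xs) i ≡ f (nthD d xs i)
nthD-map f d e h [] i = sym h
nthD-map f d e h (x ∷ xs) zero = refl
nthD-map f d e h (x ∷ xs) (suc i) = nthD-map f d e h xs i

nthD-map< : (f : α → β) (d : α) (e : β) (xs : List α) {i : ℕ} → i < length xs → nthD e (map f xs) i ≡ f (nthD d xs i)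
nthD-map< f d e (x ∷ xs) {zero} h = refl
nthD-map< f d e (x ∷ xs) {suc i} (s≤s h) = nthD-map< f d e xs h

nthD-∈ : (d : α) (xs : List α) {i : ℕ} → i < length xs → nthD d xs i ∈ xs
nthD-∈ d (x ∷ xs) {zero} h = here refl
nthD-∈ d (x ∷ xs) {suc i} (s≤s h) = there (nthD-∈ d xs h)

∈-nthD : (d : α) {xs : List α} {x : α} → x ∈ xs → ∃ λ i → i < length xs × nthD d xs i ≡ x
∈-nthD d (here refl) = 0 , s≤s z≤n , refl
∈-nthD d (there p) with ∈-nthD d p
... | i , l , e = suc i , s≤s l , e

nthD-injective : (d : α) {xs : List α} → Unique xs → ∀ {i j} → i < length xs → j < length xs →
  nthD d xs i ≡ nthD d xs j → i ≡ j
nthD-injective d u {zero} {zero} p q e = refl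
nthD-injective d {x ∷ xs} (x∉ ∷ u) {zero} {suc j} p (s≤s q) e = ⊥-elim (All.lookup x∉ (nthD-∈ d xs q) e)
nthD-injective d {x ∷ xs} (x∉ ∷ u) {suc i} {zero} (s≤s p) q e = ⊥-elim (All.lookup x∉ (nthD-∈ d xs p) (sym e))
nthD-injective d (x∉ ∷ u) {suc i} {suc j} (s≤s p) (s≤s q) e = cong suc (nthD-injective d u p q e)

nthD-ext : (d : α) {xs ys : List α} → length xs ≡ length ys → (∀ i → i < length xs → nthD d xs i ≡ nthD d ys i) → xs ≡ ys
nthD-ext d {[]} {[]} e h = refl
nthD-ext d {x ∷ xs} {y ∷ ys} e h =
  cong₂ _∷_ (h 0 (s≤s z≤n)) (nthD-ext d (suc-injective e) λ i l → h (suc i) (s≤s l))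

nthD-applyUpTo : (d : α) (f : ℕ → α) {n i : ℕ} → i < n → nthD d (applyUpTo f n) i ≡ f i
nthD-applyUpTo d f {suc n} {zero} h = refl
nthD-applyUpTo d f {suc n} {suc i} (s≤s h) = nthD-applyUpTo d (f ∘ suc) h

applyUpTo-cong : {f g : ℕ → α} (n : ℕ) → (∀ i → i < n → f i ≡ g i) → applyUpTo f n ≡ applyUpTo g n
applyUpTo-cong zero h = refl
applyUpTo-cong (suc n) h = cong₂ _∷_ (h 0 (s≤s z≤n)) (applyUpTo-cong n λ i l → h (suc i) (s≤s l))

map-cong-∈ : {f g : α → β} (xs : List α) → (∀ {x} → x ∈ xs → f x ≡ g x) → map f xs ≡ map g xs
map-cong-∈ [] h = refl
map-cong-∈ (x ∷ xs) h = cong₂ _∷_ (h (here refl)) (map-cong-∈ xs (h ∘ there))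

map-≡⇒≡ : {f g : α → β} {xs : List α} {x : α} → map f xs ≡ map g xs → x ∈ xs → f x ≡ g x
map-≡⇒≡ e (here refl) = ∷-injectiveˡ e
map-≡⇒≡ e (there q) = map-≡⇒≡ (∷-injectiveʳ e) q

range-∈⁻ : (a b : ℕ) {t : ℕ} → t ∈ range a b → a ≤ t × t ≤ b
range-∈⁻ a b p with ∈-applyUpTo⁻ (a +_) p
... | i , l , refl = m≤m+n a i , s≤s⁻¹ (m<n∸o⇒o+m<n a l)
  where
  m<n∸o⇒o+m<n : ∀ o {m n} → m < n ∸ o → o + m < n
  m<n∸o⇒o+m<n zero h = h
  m<n∸o⇒o+m<n (suc o) {m} {suc n} h = s≤s (m<n∸o⇒o+m<n o h)

range-∈⁺ : (a b : ℕ) {t : ℕ} → a ≤ t → t ≤ b → t ∈ range a b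
range-∈⁺ a b {t} p q = subst (_∈ range a b) (m+[n∸m]≡n p) (∈-applyUpTo⁺ (a +_) (∸-monoˡ-< (s≤s q) p))

-- Increasing lists as finite sets

Increasing : List ℕ → Set
Increasing = AllPairs _<_

range-Increasing : (a b : ℕ) → Increasing (range a b)
range-Increasing a b = APP.applyUpTo⁺₁ (a +_) (suc b ∸ a) λ i<j _ → +-monoʳ-< a i<j

Increasing⇒Unique : {xs : List ℕ} → Increasing xs → Unique xs
Increasing⇒Unique = AllPairs.map <⇒≢

Increasing-ext : {xs ys : List ℕ} → Increasing xs → Increasing ys → xs ⊆ ys → ys ⊆ xs → xs ≡ ys
Increasing-ext {[]} {[]} _ _ _ _ = refl
Increasing-ext {[]} {y ∷ ys} _ _ _ t with () ← t (here refl)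
Increasing-ext {x ∷ xs} {[]} _ _ s _ with () ← s (here refl)
Increasing-ext {x ∷ xs} {y ∷ ys} (x< ∷ i) (y< ∷ j) s t = cong₂ _∷_ x≡y (Increasing-ext i j s′ t′)
  where
  x≡y : x ≡ y
  x≡y with s (here refl) | t (here refl)
  ... | here e | _ = e
  ... | there _ | here e = sym e
  ... | there p | there q = ⊥-elim (<-asym (All.lookup y< p) (All.lookup x< q))
  s′ : xs ⊆ ys
  s′ p with s (there p)
  ... | here refl = ⊥-elim (<-irrefl x≡y (All.lookup x< p))
  ... | there q = q
  t′ : ys ⊆ xs
  t′ p with t (there p)
  ... | here refl = ⊥-elim (<-irrefl (sym x≡y) (All.lookup y< p))
  ... | there q = q

nthD-< : {xs : List ℕ} → Increasing xs → ∀ {i j} → i < j → j < length xs → nthD 0 xs i < nthD 0 xs j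
nthD-< {x ∷ xs} (x< ∷ p) {zero} {suc j} _ (s≤s l) = All.lookup x< (nthD-∈ 0 xs l)
nthD-< {x ∷ xs} (x< ∷ p) {suc i} {suc j} (s≤s l) (s≤s m) = nthD-< p l m

-- Subsets of [n] as increasing lists

private
  ++-last-Increasing : ∀ {xs n} → Increasing xs → All (_≤ n) xs → Increasing (xs ++ [ suc n ])
  ++-last-Increasing [] [] = [] ∷ []
  ++-last-Increasing (p ∷ ps) (q ∷ qs) = AllP.++⁺ p (s≤s q ∷ []) ∷ ++-last-Increasing ps qs

Subset[_] : ℕ → List ℕ → Set
Subset[ n ] D = Increasing D × All (λ d → 1 ≤ d × d ≤ n) D

∈-subsetsOfSize⁻ : ∀ n m {D} → D ∈ subsetsOfSize n m → Subset[ n ] D × length D ≡ m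
∈-subsetsOfSize⁻ zero zero (here refl) = ([] , []) , refl
∈-subsetsOfSize⁻ (suc n) zero (here refl) = ([] , []) , refl
∈-subsetsOfSize⁻ (suc n) (suc m) p with ∈-++⁻ (subsetsOfSize n (suc m)) p
... | inj₁ q with ∈-subsetsOfSize⁻ n (suc m) q
... | (i , a) , e = (i , All.map (λ (x , y) → x , m≤n⇒m≤1+n y) a) , e
∈-subsetsOfSize⁻ (suc n) (suc m) p | inj₂ q with ∈-map⁻ (_++ [ suc n ]) q
... | D , D∈ , refl with ∈-subsetsOfSize⁻ n m D∈
... | (i , a) , e = (++-last-Increasing i (All.map proj₂ a) ,
                     AllP.++⁺ (All.map (λ (x , y) → x , m≤n⇒m≤1+n y) a) ((s≤s z≤n , ≤-refl) ∷ []))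
                  , trans (length-++ D) (trans (+-comm (length D) 1) (cong suc e))

private
  -- `subsetsOfSize` decides about the largest element first, at the far end of the list; this case
  -- split translates between that recursion and the one on `D`.
  split-last : ∀ n D → Subset[ suc n ] D → Subset[ n ] D ⊎ (∃ λ D′ → Subset[ n ] D′ × D ≡ D′ ++ [ suc n ])
  split-last n [] _ = inj₁ ([] , [])
  split-last n (d ∷ D) (p ∷ i , (l , u) ∷ a) with d ≟ suc n
  split-last n (d ∷ []) (p ∷ i , (l , u) ∷ a) | yes refl = inj₂ ([] , ([] , []) , refl)
  split-last n (d ∷ x ∷ D) ((q ∷ _) ∷ i , (l , u) ∷ (_ , v) ∷ a) | yes refl = ⊥-elim (<-irrefl refl (<-≤-trans q v))
  ... | no d≢ with split-last n D (i , a)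
  ... | inj₁ (i′ , a′) = inj₁ (p ∷ i′ , (l , s≤s⁻¹ (≤∧≢⇒< u d≢)) ∷ a′)
  ... | inj₂ (D′ , (i′ , a′) , refl) =
    inj₂ (d ∷ D′ , (AllP.++⁻ˡ D′ p ∷ i′ , (l , s≤s⁻¹ (≤∧≢⇒< u d≢)) ∷ a′) , refl)

∈-subsetsOfSize⁺ : ∀ n {D} → Subset[ n ] D → D ∈ subsetsOfSize n (length D)
∈-subsetsOfSize⁺ zero {[]} s = here refl
∈-subsetsOfSize⁺ zero {d ∷ D} (_ , (l , u) ∷ _) = ⊥-elim (<-irrefl refl (≤-trans l u))
∈-subsetsOfSize⁺ (suc n) {[]} s = here refl
∈-subsetsOfSize⁺ (suc n) {d ∷ D} s with split-last n (d ∷ D) s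
... | inj₁ s′ = ∈-++⁺ˡ (∈-subsetsOfSize⁺ n s′)
... | inj₂ (D′ , s′ , e) = subst (_∈ subsetsOfSize (suc n) (suc (length D))) (sym e)
    (∈-++⁺ʳ (subsetsOfSize n (suc (length D))) (∈-map⁺ (_++ [ suc n ])
      (subst (λ k → D′ ∈ subsetsOfSize n k) len (∈-subsetsOfSize⁺ n s′))))
  where
  len : length D′ ≡ length D
  len = suc-injective (trans (+-comm 1 (length D′)) (trans (sym (length-++ D′)) (cong length (sym e))))

subsetsOfSize-Unique : ∀ n m → Unique (subsetsOfSize n m)
subsetsOfSize-Unique zero zero = [] ∷ []
subsetsOfSize-Unique zero (suc m) = []
subsetsOfSize-Unique (suc n) zero = [] ∷ []
subsetsOfSize-Unique (suc n) (suc m) =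
  UP.++⁺ (subsetsOfSize-Unique n (suc m)) (UP.map⁺ (++-cancelʳ _ _ _) (subsetsOfSize-Unique n m)) λ (p , q) → disj p q
  where
  disj : ∀ {D} → D ∈ subsetsOfSize n (suc m) → D ∈ map (_++ [ suc n ]) (subsetsOfSize n m) → ⊥
  disj p q with ∈-map⁻ (_++ [ suc n ]) q
  ... | D′ , _ , refl with AllP.++⁻ʳ D′ (proj₂ (proj₁ (∈-subsetsOfSize⁻ n (suc m) p)))
  ... | (_ , u) ∷ [] = <-irrefl refl u

-- Zipped lists

∈-zip⇒∈ʳ : {xs : List α} {ys : List β} {x : α} {y : β} → (x , y) ∈ zip xs ys → y ∈ ys
∈-zip⇒∈ʳ {xs = _ ∷ _} {_ ∷ _} (here refl) = here refl
∈-zip⇒∈ʳ {xs = _ ∷ _} {_ ∷ _} (there q) = there (∈-zip⇒∈ʳ q)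

∈⇒∈-zip : {xs : List α} {ys : List β} {y : β} → length ys ≡ length xs → y ∈ ys → ∃ λ x → (x , y) ∈ zip xs ys
∈⇒∈-zip {xs = x ∷ xs} {_ ∷ _} l (here refl) = x , here refl
∈⇒∈-zip {xs = _ ∷ _} {_ ∷ _} l (there q) with ∈⇒∈-zip (suc-injective l) q
... | x , q′ = x , there q′

∈-zipWith⁺ : (f : α → β → γ) {xs : List α} {ys : List β} {x : α} {y : β} → (x , y) ∈ zip xs ys → f x y ∈ zipWith f xs ys
∈-zipWith⁺ f {_ ∷ _} {_ ∷ _} (here refl) = here refl
∈-zipWith⁺ f {_ ∷ _} {_ ∷ _} (there q) = there (∈-zipWith⁺ f q)

∈-zipWith⁻ : (f : α → β → γ) (xs : List α) (ys : List β) {z : γ} → z ∈ zipWith f xs ys →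
  ∃₂ λ x y → (x , y) ∈ zip xs ys × z ≡ f x y
∈-zipWith⁻ f (x ∷ xs) (y ∷ ys) (here e) = x , y , here refl , e
∈-zipWith⁻ f (x ∷ xs) (y ∷ ys) (there q) with ∈-zipWith⁻ f xs ys q
... | x′ , y′ , q′ , e = x′ , y′ , there q′ , e

-- Counting by columns: the arithmetic

below : List ℕ → ℕ → ℕ
below C e = length (filterᵇ (_<ᵇ e) C)

-- Here `k` is the number of columns chosen so far and `below C e` is r_j. Truncated subtraction
-- gives the right answer 0 when the support has no more than `k` dimensions.
columnCount : ℕ → List ℕ → ℕ → List ℕ → ℕ
columnCount q C k [] = 1
columnCount q C k (e ∷ es) = (q ^ below C e ∸ q ^ k) * columnCount q C (suc k) es

below-++ : ∀ C C′ e → below (C ++ C′) e ≡ below C e + below C′ e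
below-++ C C′ e = trans (cong length (filter-++ (T? ∘ (_<ᵇ e)) C C′)) (length-++ (filterᵇ (_<ᵇ e) C))

below-all : ∀ {C e} → All (_< e) C → below C e ≡ length C
below-all {e = e} h = cong length (filter-all (T? ∘ (_<ᵇ e)) (All.map <⇒<ᵇ h))

below-none : ∀ {C e} → All (e ≤_) C → below C e ≡ 0
below-none {e = e} h = cong length (filter-none (T? ∘ (_<ᵇ e)) (All.map (λ {c} e≤ t → <⇒≱ (<ᵇ⇒< c e t) e≤) h))

-- The row condition of the two-column tableau, isolated because the other conditions of
-- multilinearity hold automatically in the cases that arise.
data Dominated : List ℕ → List ℕ → Set where
  [] : ∀ {C} → Dominated C []
  _∷_ : ∀ {c e C es} → c < e → Dominated C es → Dominated (c ∷ C) (e ∷ es)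

dominated? : ∀ C es → Dec (Dominated C es)
dominated? C [] = yes []
dominated? [] (e ∷ es) = no λ ()
dominated? (c ∷ C) (e ∷ es) with c <? e | dominated? C es
... | yes p | yes d = yes (p ∷ d)
... | no ¬p | _ = no λ { (p ∷ _) → ¬p p }
... | _ | no ¬d = no λ { (_ ∷ d) → ¬d d }

snoc-++ : ∀ {A : Set} (pre : List A) {c C} → pre ++ c ∷ C ≡ (pre ++ [ c ]) ++ C
snoc-++ pre {c} {C} = sym (++-assoc pre [ c ] C)

length-snoc : ∀ {A : Set} (pre : List A) {c} → length (pre ++ [ c ]) ≡ suc (length pre)
length-snoc pre = trans (length-++ pre) (+-comm (length pre) 1)

-- `pre` collects the pivots of the rows already passed. At the first row with e ≤ c, no pivot from
-- `c` on is below `e`, so `below` is at most `length pre`, which is the number of columns chosen,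
-- and the factor truncates to 0.
columnCount-undominated : ∀ q .{{_ : NonZero q}} pre {C} es → Increasing C → length es ≤ length C → ¬ Dominated C es →
  columnCount q (pre ++ C) (length pre) es ≡ 0
columnCount-undominated q pre [] i l nd = ⊥-elim (nd [])
columnCount-undominated q pre {c ∷ C} (e ∷ es) (c< ∷ i) (s≤s l) nd with c <? e
... | yes c<e = trans (cong ((q ^ below (pre ++ c ∷ C) e ∸ q ^ length pre) *_)
      (trans (cong₂ (λ X k → columnCount q X k es) (snoc-++ pre) (sym (length-snoc pre)))
             (columnCount-undominated q (pre ++ [ c ]) es i l (nd ∘ (c<e ∷_)))))
      (*-zeroʳ (q ^ below (pre ++ c ∷ C) e ∸ q ^ length pre))
... | no c≮e = cong (_* columnCount q (pre ++ c ∷ C) (suc (length pre)) es) (m≤n⇒m∸n≡0 (^-monoʳ-≤ q (≤-trans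
      (≤-reflexive (trans (below-++ pre (c ∷ C) e) (trans (cong (below pre e +_) (below-none (e≤c ∷ All.map (λ c<x → ≤-trans e≤c (<⇒≤ c<x)) c<))) (+-identityʳ _))))
      (length-filter (T? ∘ (_<ᵇ e)) pre))))
  where
  e≤c : e ≤ c
  e≤c = ≮⇒≥ c≮e

-- Stated for every geometric sequence instead of the powers of q because `applyUpTo` peels off its
-- first term and leaves the shifted sequence, to which the induction has to apply.
geometric : ∀ b (f : ℕ → ℕ) → (∀ i → f (suc i) ≡ suc b * f i) → ∀ a → f a ≡ b * sum (applyUpTo f a) + f 0
geometric b f h zero = cong (_+ f 0) (sym (*-zeroʳ b))
geometric b f h (suc a) = begin
  f (suc a) ≡⟨ geometric b (f ∘ suc) (h ∘ suc) a ⟩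
  b * S + f 1 ≡⟨ cong (b * S +_) (trans (h 0) (+-comm (f 0) (b * f 0))) ⟩
  b * S + (b * f 0 + f 0) ≡⟨ sym (+-assoc (b * S) _ _) ⟩
  b * S + b * f 0 + f 0 ≡⟨ cong (_+ f 0) (trans (+-comm (b * S) _) (sym (*-distribˡ-+ b (f 0) S))) ⟩
  b * (f 0 + S) + f 0 ∎
  where
  open ≡-Reasoning
  S = sum (applyUpTo (f ∘ suc) a)

q^-difference : ∀ q .{{_ : NonZero q}} k r → q ^ (k + r) ∸ q ^ k ≡ q ^ k * ((q ∸ 1) * qint q r)
q^-difference q@(suc b) k r = begin
  q ^ (k + r) ∸ q ^ k ≡⟨ cong₂ _∸_ (^-distribˡ-+-* q k r) (sym (*-identityʳ (q ^ k))) ⟩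
  q ^ k * q ^ r ∸ q ^ k * 1 ≡⟨ sym (*-distribˡ-∸ (q ^ k) (q ^ r) 1) ⟩
  q ^ k * (q ^ r ∸ 1) ≡⟨ cong (λ x → q ^ k * (x ∸ 1)) (geometric b (q ^_) (λ _ → refl) r) ⟩
  q ^ k * (b * qint q r + 1 ∸ 1) ≡⟨ cong (q ^ k *_) (m+n∸n≡m (b * qint q r) 1) ⟩
  q ^ k * (b * qint q r) ∎
  where open ≡-Reasoning

-- The product of the q-integers [r_j - j + 1]: the j - 1 pivots above row j have been removed from
-- the list before `below` is taken. Surplus entries contribute 1, as `twoColumns` drops them.
qproduct : ℕ → List ℕ → List ℕ → ℕ
qproduct q C [] = 1
qproduct q [] (e ∷ es) = 1
qproduct q (c ∷ C) (e ∷ es) = qint q (below (c ∷ C) e) * qproduct q C es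

C2-suc : ∀ n → suc n choose 2 ≡ n + n choose 2
C2-suc n = trans (sym (nCk+nC[k+1]≡[n+1]C[k+1] n 1)) (cong (_+ n choose 2) (nC1≡n n))

-- All passed pivots lie below every remaining `e`, so r_j = k + r with r counted among the
-- remaining pivots, and the factor is q^k (q - 1) [r]. With ℓ columns left the powers of q have
-- exponents k, k + 1, ..., k + ℓ - 1, whose sum is kℓ + ℓ(ℓ - 1)/2.
columnCount-dominated : ∀ q .{{_ : NonZero q}} pre {C} es → Increasing es → All (λ e → All (_< e) pre) es → Dominated C es →
  columnCount q (pre ++ C) (length pre) es ≡ (q ∸ 1) ^ length es * q ^ (length pre * length es + length es choose 2) * qproduct q C es
columnCount-dominated q pre [] i a [] = sym (trans (*-identityʳ _) (trans (*-identityˡ _) (cong (q ^_) (trans (+-identityʳ _) (*-zeroʳ (length pre))))))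
columnCount-dominated q pre {c ∷ C} (e ∷ es) (e< ∷ i) (a ∷ as) (c<e ∷ d) = begin
  (q ^ below (pre ++ c ∷ C) e ∸ q ^ k) * columnCount q (pre ++ c ∷ C) (suc k) es
    ≡⟨ cong₂ _*_ (trans (cong (λ x → q ^ x ∸ q ^ k) (trans (below-++ pre (c ∷ C) e) (cong (_+ r) (below-all a)))) (q^-difference q k r))
                 (trans (cong₂ (λ X j → columnCount q X j es) (snoc-++ pre) (sym (length-snoc pre)))
                   (columnCount-dominated q (pre ++ [ c ]) es i
                     (All.zipWith (λ (e<x , a′) → AllP.++⁺ a′ (<-trans c<e e<x ∷ [])) (e< , as)) d)) ⟩
  q ^ k * (B * Q) * (B ^ ℓ * q ^ (length (pre ++ [ c ]) * ℓ + ℓ choose 2) * R)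
    ≡⟨ cong (λ x → q ^ k * (B * Q) * (B ^ ℓ * q ^ (x * ℓ + ℓ choose 2) * R)) (length-snoc pre) ⟩
  q ^ k * (B * Q) * (B ^ ℓ * q ^ (suc k * ℓ + ℓ choose 2) * R)
    ≡⟨ rearrange (q ^ k) B Q (B ^ ℓ) (q ^ (suc k * ℓ + ℓ choose 2)) R ⟩
  B * B ^ ℓ * (q ^ k * q ^ (suc k * ℓ + ℓ choose 2)) * (Q * R)
    ≡⟨ cong (λ x → B * B ^ ℓ * x * (Q * R)) (trans (sym (^-distribˡ-+-* q k _)) (cong (q ^_) exponent)) ⟩
  B * B ^ ℓ * q ^ (k * suc ℓ + suc ℓ choose 2) * (Q * R) ∎
  where
  open ≡-Reasoning
  k = length pre
  ℓ = length es
  B = q ∸ 1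
  r = below (c ∷ C) e
  Q = qint q r
  R = qproduct q C es
  rearrange : ∀ a b c d e f → a * (b * c) * (d * e * f) ≡ b * d * (a * e) * (c * f)
  rearrange = solve 6 (λ a b c d e f → a :* (b :* c) :* (d :* e :* f) := b :* d :* (a :* e) :* (c :* f)) refl
    where open +-*-Solver
  exponent : k + (suc k * ℓ + ℓ choose 2) ≡ k * suc ℓ + suc ℓ choose 2
  exponent = trans (solve 3 (λ k l b → k :+ ((con 1 :+ k) :* l :+ b) := k :* (con 1 :+ l) :+ (l :+ b)) refl k ℓ (ℓ choose 2))
                   (cong (k * suc ℓ +_) (sym (C2-suc ℓ)))
    where open +-*-Solver

-- The statistic c_q of a two-column tableau

index-++ : ∀ {A : Set} (pre : List A) suf t → index (pre ++ suf) (length pre + t) ≡ index suf t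
index-++ [] suf t = refl
index-++ (x ∷ pre) suf t = index-++ pre suf t

twoColumns-row : ∀ C es {t} → t < length C → ∃ λ row → index (twoColumns C es) t ≡ just row × index row 0 ≡ just (nthD 0 C t)
twoColumns-row (c ∷ C) [] {zero} _ = _ , refl , refl
twoColumns-row (c ∷ C) [] {suc t} (s≤s l) = twoColumns-row C [] l
twoColumns-row (c ∷ C) (e ∷ es) {zero} _ = _ , refl , refl
twoColumns-row (c ∷ C) (e ∷ es) {suc t} (s≤s l) = twoColumns-row C es l

length-twoColumns : ∀ C es → length (twoColumns C es) ≡ length C
length-twoColumns [] es = refl
length-twoColumns (c ∷ C) [] = cong suc (length-twoColumns C [])
length-twoColumns (c ∷ C) (e ∷ es) = cong suc (length-twoColumns C es)

cell-row : ∀ T i j {row} → index T (i ∸ 1) ≡ just row → cell T i j ≡ index row (j ∸ 1)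
cell-row T i j e with index T (i ∸ 1) | e
... | just row | refl = refl

count-below : ∀ (f : ℕ → Bool) (g : ℕ → ℕ) C e → (∀ t → t < length C → f (g t) ≡ (nthD 0 C t <ᵇ e)) →
  length (filterᵇ f (applyUpTo g (length C))) ≡ below C e
count-below f g [] e h = refl
count-below f g (c ∷ C) e h with f (g 0) | c <ᵇ e | h 0 (s≤s z≤n)
... | true | true | refl = cong suc (count-below f (g ∘ suc) C e λ t l → h (suc t) (s≤s l))
... | false | false | refl = count-below f (g ∘ suc) C e λ t l → h (suc t) (s≤s l)

-- Names the local function by which cij filters.
cij-test : ∀ T i j → ∃ λ f → cij T i j ≡ length (filterᵇ f (range i (length T)))
cij-test T i j = _ , refl

cij-test-just : ∀ T i j i′ {a b} → cell T i′ (j ∸ 1) ≡ just a → cell T i j ≡ just b → proj₁ (cij-test T i j) i′ ≡ (a <ᵇ b)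
cij-test-just T i j i′ e₁ e₂ rewrite e₁ | e₂ = refl

-- Every row from the current one on has a cell in the first column, whether or not it has a second,
-- so the count runs over all remaining pivots.
cij-suffix : ∀ pre c C e es → cij (pre ++ twoColumns (c ∷ C) (e ∷ es)) (suc (length pre)) 2 ≡ below (c ∷ C) e
cij-suffix pre c C e es = trans (cong (λ k → length (filterᵇ test (applyUpTo (suc (length pre) +_) k))) len)
   (count-below test (suc (length pre) +_) (c ∷ C) e λ t l → let row , i₁ , i₂ = twoColumns-row (c ∷ C) (e ∷ es) l in
     cij-test-just T′ (suc (length pre)) 2 (suc (length pre) + t)
       (trans (cell-row T′ (suc (length pre) + t) 1 (trans (index-++ pre _ t) i₁)) i₂) corner)
  where
  T′ : Tableau
  T′ = pre ++ twoColumns (c ∷ C) (e ∷ es)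
  test : ℕ → Bool
  test = proj₁ (cij-test T′ (suc (length pre)) 2)
  len : length T′ ∸ length pre ≡ length (c ∷ C)
  len = trans (cong (_∸ length pre) (length-++ pre)) (trans (m+n∸m≡n (length pre) _) (length-twoColumns (c ∷ C) (e ∷ es)))
  corner : cell T′ (suc (length pre)) 2 ≡ just e
  corner = cell-row T′ (suc (length pre)) 2 (trans (cong (index T′) (sym (+-identityʳ _))) (index-++ pre _ 0))

-- The statistic looks at the whole tableau while the product runs over its rows, so the induction
-- keeps the passed rows in `pre`. `g` stands for the pattern-matching function inside `cq` and `f`
-- for the shifted row numbers; both are given by their values, since the induction changes how they
-- are presented.
product-suffix : ∀ q pre C es (g : ℕ × List ℕ → List ℕ) →
  (∀ i row → g (i , row) ≡ map (λ j → qint q (cij (pre ++ twoColumns C es) i j)) (range 2 (length row))) →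
  (f : ℕ → ℕ) → (∀ i → f i ≡ suc (length pre + i)) →
  product (concatMap g (zip (applyUpTo f (length (twoColumns C es))) (twoColumns C es))) ≡ qproduct q C es
product-suffix q pre [] [] g hg f hf = refl
product-suffix q pre [] (e ∷ es) g hg f hf = refl
product-suffix q pre (c ∷ C) [] g hg f hf rewrite hg (f 0) [ c ] =
  product-suffix q (pre ++ [ [ c ] ]) C [] g
    (λ i row → trans (hg i row) (cong (λ X → map (λ j → qint q (cij X i j)) (range 2 (length row))) (snoc-++ pre)))
    (f ∘ suc) (λ i → trans (hf (suc i)) (cong suc (trans (+-suc (length pre) i) (cong (_+ i) (sym (length-snoc pre))))))
product-suffix q pre (c ∷ C) (e ∷ es) g hg f hf rewrite hg (f 0) (c ∷ e ∷ []) =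
  cong₂ _*_ (cong (qint q) (trans (cong (λ i → cij (pre ++ twoColumns (c ∷ C) (e ∷ es)) i 2) (trans (hf 0) (cong suc (+-identityʳ (length pre)))))
                                  (cij-suffix pre c C e es)))
    (product-suffix q (pre ++ [ c ∷ e ∷ [] ]) C es g
    (λ i row → trans (hg i row) (cong (λ X → map (λ j → qint q (cij X i j)) (range 2 (length row))) (snoc-++ pre)))
    (f ∘ suc) (λ i → trans (hf (suc i)) (cong suc (trans (+-suc (length pre) i) (cong (_+ i) (sym (length-snoc pre)))))))

cq-twoColumns : ∀ q C es → cq q (twoColumns C es) ≡ qproduct q C es
cq-twoColumns q C es = product-suffix q [] C es _ (λ _ _ → refl) suc (λ _ → refl)

multilinear⇒dominated : ∀ C es → length es ≤ length C → T (isMultilinear (twoColumns C es)) → Dominated C es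
multilinear⇒dominated C es l t with T-∧⁻ {all (λ row → 1 ≤ᵇ length row) (twoColumns C es)} t
... | _ , t₁ with T-∧⁻ {consecutive (λ r r′ → length r′ ≤ᵇ length r) (twoColumns C es)} t₁
... | _ , t₂ with T-∧⁻ {all (λ row → all (1 ≤ᵇ_) row) (twoColumns C es)} t₂
... | _ , t₃ with T-∧⁻ {distinctᵇ (foldr _++_ [] (twoColumns C es))} t₃
... | _ , t₄ = go C es l (proj₁ (T-∧⁻ {all (consecutive _<ᵇ_) (twoColumns C es)} t₄))
  where
  go : ∀ C es → length es ≤ length C → T (all (consecutive _<ᵇ_) (twoColumns C es)) → Dominated C es
  go C [] _ _ = []
  go (c ∷ C) (e ∷ es) (s≤s l) t with T-∧⁻ {(c <ᵇ e) ∧ true} t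
  ... | t₁ , t₂ = <ᵇ⇒< c e (proj₁ (T-∧⁻ {c <ᵇ e} t₁)) ∷ go C es l t₂

T-distinct : ∀ {xs} → Unique xs → T (distinctᵇ xs)
T-distinct [] = _
T-distinct {x ∷ xs} (x∉ ∷ u) = T-∧⁺ (T-not-any⁺ (x ≡ᵇ_) (All.map (λ ne t → ne (≡ᵇ⇒≡ _ _ t)) x∉)) (T-distinct u)

-- Domination is used for the rows only. The columns come from monotonicity, distinctness from
-- disjointness, and the shape from the fact that `twoColumns` puts its two-cell rows first.
dominated⇒multilinear : ∀ {C es} → Increasing C → Increasing es → All (1 ≤_) C → All (1 ≤_) es → (∀ {x} → x ∈ C → x ∉ es) →
  Dominated C es → T (isMultilinear (twoColumns C es))
dominated⇒multilinear {C} {es} iC ie pC pe disj d =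
  T-∧⁺ {all (λ row → 1 ≤ᵇ length row) T′} (nonempty C es) (T-∧⁺ {consecutive (λ r r′ → length r′ ≤ᵇ length r) T′} (shape C es)
  (T-∧⁺ {all (λ row → all (1 ≤ᵇ_) row) T′} (positive pC pe) (T-∧⁺ {distinctᵇ (foldr _++_ [] T′)}
    (T-distinct (unique (Increasing⇒Unique iC) (Increasing⇒Unique ie) disj))
  (T-∧⁺ {all (consecutive _<ᵇ_) T′} (rows d) (cols iC ie)))))
  where
  T′ : Tableau
  T′ = twoColumns C es
  nonempty : ∀ C es → T (all (λ row → 1 ≤ᵇ length row) (twoColumns C es))
  nonempty [] es = _
  nonempty (c ∷ C) [] = nonempty C []
  nonempty (c ∷ C) (e ∷ es) = nonempty C es
  shape : ∀ C es → T (consecutive (λ r r′ → length r′ ≤ᵇ length r) (twoColumns C es))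
  shape [] es = _
  shape (c ∷ []) [] = _
  shape (c ∷ c′ ∷ C) [] = shape (c′ ∷ C) []
  shape (c ∷ []) (e ∷ es) = _
  shape (c ∷ c′ ∷ C) (e ∷ []) = shape (c′ ∷ C) []
  shape (c ∷ c′ ∷ C) (e ∷ e′ ∷ es) = shape (c′ ∷ C) (e′ ∷ es)
  positive : ∀ {C es} → All (1 ≤_) C → All (1 ≤_) es → T (all (λ row → all (1 ≤ᵇ_) row) (twoColumns C es))
  positive [] _ = _
  positive (p ∷ ps) [] = T-∧⁺ (T-∧⁺ (≤⇒≤ᵇ p) _) (positive ps [])
  positive (p ∷ ps) (r ∷ rs) = T-∧⁺ (T-∧⁺ (≤⇒≤ᵇ p) (T-∧⁺ (≤⇒≤ᵇ r) _)) (positive ps rs)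
  ∈-entries : ∀ C es {x} → x ∈ foldr _++_ [] (twoColumns C es) → x ∈ C ⊎ x ∈ es
  ∈-entries (c ∷ C) [] (here e) = inj₁ (here e)
  ∈-entries (c ∷ C) [] (there q) = [ inj₁ ∘ there , inj₂ ]′ (∈-entries C [] q)
  ∈-entries (c ∷ C) (e ∷ es) (here x) = inj₁ (here x)
  ∈-entries (c ∷ C) (e ∷ es) (there (here x)) = inj₂ (here x)
  ∈-entries (c ∷ C) (e ∷ es) (there (there q)) = [ inj₁ ∘ there , inj₂ ∘ there ]′ (∈-entries C es q)
  unique : ∀ {C es} → Unique C → Unique es → (∀ {x} → x ∈ C → x ∉ es) → Unique (foldr _++_ [] (twoColumns C es))
  unique [] _ _ = []
  unique {c ∷ C} {[]} (c∉ ∷ u) v dj =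
    All.tabulate (λ x∈ e → case ∈-entries C [] x∈ of λ { (inj₁ p) → All.lookup c∉ p e ; (inj₂ ()) })
    ∷ unique u [] λ _ ()
  unique {c ∷ C} {e ∷ es} (c∉ ∷ u) (e∉ ∷ v) dj =
    ((λ c≡e → dj (here refl) (here c≡e)) ∷ All.tabulate λ x∈ c≡x → case ∈-entries C es x∈ of λ
       { (inj₁ p) → All.lookup c∉ p c≡x ; (inj₂ p) → dj (here refl) (there (subst (_∈ es) (sym c≡x) p)) })
    ∷ All.tabulate (λ x∈ e≡x → case ∈-entries C es x∈ of λ
       { (inj₁ p) → dj (there p) (here (sym e≡x)) ; (inj₂ p) → All.lookup e∉ p e≡x })
    ∷ unique u v λ p r → dj (there p) (there r)
  rows : ∀ {C es} → Dominated C es → T (all (consecutive _<ᵇ_) (twoColumns C es))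
  rows {[]} [] = _
  rows {c ∷ C} [] = rows {C} []
  rows (p ∷ d) = T-∧⁺ (T-∧⁺ (<⇒<ᵇ p) _) (rows d)
  cols : ∀ {C es} → Increasing C → Increasing es → T (consecutive (λ r r′ → and (zipWith _<ᵇ_ r r′)) (twoColumns C es))
  cols [] _ = _
  cols (_ ∷ []) [] = _
  cols ((l ∷ _) ∷ i@(_ ∷ _)) [] = T-∧⁺ (T-∧⁺ (<⇒<ᵇ l) _) (cols i [])
  cols (_ ∷ []) (_ ∷ _) = _
  cols ((l ∷ _) ∷ i@(_ ∷ _)) (_ ∷ []) = T-∧⁺ (T-∧⁺ (<⇒<ᵇ l) _) (cols i [])
  cols ((l ∷ _) ∷ i@(_ ∷ _)) ((m ∷ _) ∷ j@(_ ∷ _)) = T-∧⁺ (T-∧⁺ (<⇒<ᵇ l) (T-∧⁺ (<⇒<ᵇ m) _)) (cols i j)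

columnCount-weight : ∀ q .{{_ : NonZero q}} {C es} → Increasing C → Increasing es → All (1 ≤_) C → All (1 ≤_) es →
  (∀ {x} → x ∈ C → x ∉ es) → length es ≤ length C →
  columnCount q C 0 es ≡ (if isMultilinear (twoColumns C es) then (q ∸ 1) ^ length es * q ^ (length es choose 2) * cq q (twoColumns C es) else 0)
columnCount-weight q {C} {es} iC ie pC pe dj l with dominated? C es | isMultilinear (twoColumns C es) in eq
... | yes d | true = trans (columnCount-dominated q [] es ie (All.tabulate λ _ → []) d) (cong ((q ∸ 1) ^ length es * q ^ (length es choose 2) *_) (sym (cq-twoColumns q C es)))
... | yes d | false = ⊥-elim (subst T eq (dominated⇒multilinear iC ie pC pe dj d))
... | no nd | false = columnCount-undominated q [] es iC l nd
... | no nd | true = ⊥-elim (nd (multilinear⇒dominated C es l (subst T (sym eq) _)))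

-- Vectors and linear combinations over a finite field

module Theory (F : FiniteField) where

  open LinAlg F renaming (_+F_ to infixl 6 _+F_; _*F_ to infixl 7 _*F_; -F_ to infix 8 -F_)

  private module R = IsCommutativeRing isCommutativeRing

  commutativeRing : CommutativeRing _ _
  commutativeRing = record { isCommutativeRing = isCommutativeRing }

  open RingProps (CommutativeRing.ring commutativeRing) using (-‿distribˡ-*)

  Vec : Set
  Vec = List Carrier

  infixl 6 _⊕_
  infixr 7 _·_
  infix 9 _!_

  -- 0-based, whereas entry is 1-based; out of range both give 0F.
  _!_ : Vec → ℕ → Carrier
  v ! i = nthD 0F v i

  _⊕_ : Vec → Vec → Vec
  _⊕_ = zipWith _+F_

  _·_ : Carrier → Vec → Vec
  c · v = map (c *F_) v

  𝟎 : ℕ → Vec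
  𝟎 n = replicate n 0F

  length-⊕ : ∀ {n} v w → length v ≡ n → length w ≡ n → length (v ⊕ w) ≡ n
  length-⊕ v w p q = trans (length-zipWith _+F_ v w) (trans (cong₂ _⊓_ p q) (⊓-idem _))

  !-⊕ : ∀ v w i → length v ≡ length w → (v ⊕ w) ! i ≡ v ! i +F w ! i
  !-⊕ [] [] i e = sym (R.+-identityˡ 0F)
  !-⊕ (x ∷ v) (y ∷ w) zero e = refl
  !-⊕ (x ∷ v) (y ∷ w) (suc i) e = !-⊕ v w i (suc-injective e)

  !-· : ∀ c v i → (c · v) ! i ≡ c *F v ! i
  !-· c v i = nthD-map (c *F_) 0F 0F (R.zeroʳ c) v i

  !-𝟎 : ∀ n i → 𝟎 n ! i ≡ 0F
  !-𝟎 zero i = refl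
  !-𝟎 (suc n) zero = refl
  !-𝟎 (suc n) (suc i) = !-𝟎 n i

  vec-ext : ∀ {v w} → length v ≡ length w → (∀ i → v ! i ≡ w ! i) → v ≡ w
  vec-ext e h = nthD-ext 0F e (λ i _ → h i)

  AllZero⇒𝟎 : ∀ {v} → All (_≡ 0F) v → v ≡ 𝟎 (length v)
  AllZero⇒𝟎 [] = refl
  AllZero⇒𝟎 (refl ∷ h) = cong (0F ∷_) (AllZero⇒𝟎 h)

  All-𝟎 : ∀ n → All (_≡ 0F) (𝟎 n)
  All-𝟎 zero = []
  All-𝟎 (suc n) = refl ∷ All-𝟎 n

  ⊕-𝟎ˡ : ∀ {n} v → length v ≡ n → 𝟎 n ⊕ v ≡ v
  ⊕-𝟎ˡ {n} v e = vec-ext (trans (length-⊕ (𝟎 n) v (length-replicate n) e) (sym e)) λ i →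
    trans (!-⊕ (𝟎 n) v i (trans (length-replicate n) (sym e))) (trans (cong (_+F v ! i) (!-𝟎 n i)) (R.+-identityˡ _))

  ⊕-𝟎ʳ : ∀ {n} v → length v ≡ n → v ⊕ 𝟎 n ≡ v
  ⊕-𝟎ʳ {n} v e = vec-ext (trans (length-⊕ v (𝟎 n) e (length-replicate n)) (sym e)) λ i →
    trans (!-⊕ v (𝟎 n) i (trans e (sym (length-replicate n)))) (trans (cong (v ! i +F_) (!-𝟎 n i)) (R.+-identityʳ _))

  0·v≡𝟎 : ∀ {n} v → length v ≡ n → 0F · v ≡ 𝟎 n
  0·v≡𝟎 {n} v e = vec-ext (trans (length-map _ v) (trans e (sym (length-replicate n)))) λ i →
    trans (!-· 0F v i) (trans (R.zeroˡ _) (sym (!-𝟎 n i)))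

  1·v≡v : ∀ v → 1F · v ≡ v
  1·v≡v v = trans (map-cong R.*-identityˡ v) (map-id v)

  x+-1x : ∀ x → x +F (-F 1F) *F x ≡ 0F
  x+-1x x = trans (cong (x +F_) (trans (sym (-‿distribˡ-* 1F x)) (cong -F_ (R.*-identityˡ x)))) (R.-‿inverseʳ x)

  v-v≡𝟎 : ∀ {n} v → length v ≡ n → v ⊕ (-F 1F) · v ≡ 𝟎 n
  v-v≡𝟎 {n} v e = vec-ext (trans (length-⊕ v _ e (trans (length-map _ v) e)) (sym (length-replicate n))) λ i →
    trans (!-⊕ v _ i (sym (length-map _ v))) (trans (cong (v ! i +F_) (!-· _ v i)) (trans (x+-1x _) (sym (!-𝟎 n i))))

  V : ℕ → List Vec → Set
  V n = All (λ v → length v ≡ n)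

  -- Truncates to the shorter list, as `lincomb` does, so that `lincomb-!` holds for coefficient
  -- lists of any length.
  dot : Vec → Vec → Carrier
  dot [] _ = 0F
  dot (c ∷ cs) [] = 0F
  dot (c ∷ cs) (x ∷ xs) = c *F x +F dot cs xs

  length-lincomb : ∀ {n} cs {vs} → V n vs → length (lincomb n cs vs) ≡ n
  length-lincomb {n} [] _ = length-replicate n
  length-lincomb {n} (c ∷ cs) [] = length-replicate n
  length-lincomb (c ∷ cs) {v ∷ vs} (e ∷ h) =
    length-⊕ (c · v) _ (trans (length-map (c *F_) v) e) (length-lincomb cs h)

  lincomb-! : ∀ {n} cs {vs} → V n vs → ∀ i → lincomb n cs vs ! i ≡ dot cs (map (_! i) vs)
  lincomb-! {n} [] h i = !-𝟎 n i
  lincomb-! {n} (c ∷ cs) [] i = !-𝟎 n i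
  lincomb-! (c ∷ cs) {v ∷ vs} (e ∷ h) i =
    trans (!-⊕ (c · v) _ i (trans (trans (length-map (c *F_) v) e) (sym (length-lincomb cs h))))
          (cong₂ _+F_ (!-· c v i) (lincomb-! cs h i))

  +-interchange : ∀ a b c d → (a +F b) +F (c +F d) ≡ (a +F c) +F (b +F d)
  +-interchange = CommProps.interchange (CommutativeRing.+-commutativeSemigroup commutativeRing)

  dot-⊕ : ∀ cs ds xs → length cs ≡ length ds → dot (cs ⊕ ds) xs ≡ dot cs xs +F dot ds xs
  dot-⊕ [] [] xs e = sym (R.+-identityˡ 0F)
  dot-⊕ (c ∷ cs) (d ∷ ds) [] e = sym (R.+-identityˡ 0F)
  dot-⊕ (c ∷ cs) (d ∷ ds) (x ∷ xs) e =
    trans (cong₂ _+F_ (R.distribʳ x c d) (dot-⊕ cs ds xs (suc-injective e)))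
          (+-interchange (c *F x) (d *F x) _ _)

  dot-· : ∀ a cs xs → dot (a · cs) xs ≡ a *F dot cs xs
  dot-· a [] xs = sym (R.zeroʳ a)
  dot-· a (c ∷ cs) [] = sym (R.zeroʳ a)
  dot-· a (c ∷ cs) (x ∷ xs) = trans (cong₂ _+F_ (R.*-assoc a c x) (dot-· a cs xs)) (sym (R.distribˡ a _ _))

  dot-𝟎ˡ : ∀ n xs → dot (𝟎 n) xs ≡ 0F
  dot-𝟎ˡ zero xs = refl
  dot-𝟎ˡ (suc n) [] = refl
  dot-𝟎ˡ (suc n) (x ∷ xs) = trans (cong₂ _+F_ (R.zeroˡ x) (dot-𝟎ˡ n xs)) (R.+-identityˡ 0F)

  dot-𝟎ʳ : ∀ cs {xs} → All (_≡ 0F) xs → dot cs xs ≡ 0F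
  dot-𝟎ʳ [] h = refl
  dot-𝟎ʳ (c ∷ cs) [] = refl
  dot-𝟎ʳ (c ∷ cs) (refl ∷ h) = trans (cong₂ _+F_ (R.zeroʳ c) (dot-𝟎ʳ cs h)) (R.+-identityˡ 0F)

  lincomb-⊕ : ∀ {n vs} cs ds → V n vs → length cs ≡ length ds →
    lincomb n (cs ⊕ ds) vs ≡ lincomb n cs vs ⊕ lincomb n ds vs
  lincomb-⊕ {n} cs ds h e =
    vec-ext (trans (length-lincomb (cs ⊕ ds) h) (sym (length-⊕ (lincomb n cs _) _ (length-lincomb cs h) (length-lincomb ds h)))) λ i →
    trans (lincomb-! (cs ⊕ ds) h i) (trans (dot-⊕ cs ds _ e)
    (trans (cong₂ _+F_ (sym (lincomb-! cs h i)) (sym (lincomb-! ds h i)))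
    (sym (!-⊕ (lincomb n cs _) _ i (trans (length-lincomb cs h) (sym (length-lincomb ds h)))))))

  lincomb-· : ∀ {n vs} a cs → V n vs → lincomb n (a · cs) vs ≡ a · lincomb n cs vs
  lincomb-· {n} {vs} a cs h =
    vec-ext (trans (length-lincomb (a · cs) h) (sym (trans (length-map _ (lincomb n cs vs)) (length-lincomb cs h)))) λ i →
    trans (lincomb-! (a · cs) h i) (trans (dot-· a cs _)
    (trans (cong (a *F_) (sym (lincomb-! cs h i))) (sym (!-· a (lincomb n cs vs) i))))

  lincomb-𝟎 : ∀ {n vs} k → V n vs → lincomb n (𝟎 k) vs ≡ 𝟎 n
  lincomb-𝟎 {n} k h = vec-ext (trans (length-lincomb (𝟎 k) h) (sym (length-replicate n))) λ i →
    trans (lincomb-! (𝟎 k) h i) (trans (dot-𝟎ˡ k _) (sym (!-𝟎 n i)))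

  -- Spans

  Span : ℕ → List Vec → Vec → Set
  Span n vs v = ∃ λ cs → length cs ≡ length vs × lincomb n cs vs ≡ v

  -- Closure is asked for vectors of length `n` only, because `zipWith` truncates on unequal
  -- lengths. Together with `span-min` this replaces computations with coefficients: a property of a
  -- span is checked on generators.
  record IsSubspace (n : ℕ) (P : Vec → Set) : Set where
    field
      𝟎-closed : P (𝟎 n)
      ⊕-closed : ∀ {v w} → length v ≡ n → length w ≡ n → P v → P w → P (v ⊕ w)
      ·-closed : ∀ c {v} → length v ≡ n → P v → P (c · v)

  open IsSubspace

  lincomb-closed : ∀ {n vs} {P : Vec → Set} → V n vs → IsSubspace n P → All P vs → ∀ cs → P (lincomb n cs vs)
  lincomb-closed h S ps [] = 𝟎-closed S
  lincomb-closed [] S [] (c ∷ cs) = 𝟎-closed S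
  lincomb-closed {vs = v ∷ vs} (e ∷ h) S (p ∷ ps) (c ∷ cs) =
    ⊕-closed S (trans (length-map _ v) e) (length-lincomb cs h) (·-closed S c e p) (lincomb-closed h S ps cs)

  span-min : ∀ {n vs v} {P : Vec → Set} → V n vs → IsSubspace n P → All P vs → Span n vs v → P v
  span-min h S ps (cs , _ , refl) = lincomb-closed h S ps cs

  Span-IsSubspace : ∀ {n vs} → V n vs → IsSubspace n (Span n vs)
  Span-IsSubspace {n} {vs} h .𝟎-closed = 𝟎 (length vs) , length-replicate _ , lincomb-𝟎 (length vs) h
  Span-IsSubspace h .⊕-closed _ _ (cs , e , refl) (ds , e′ , refl) =
    cs ⊕ ds , length-⊕ cs ds e e′ , lincomb-⊕ cs ds h (trans e (sym e′))
  Span-IsSubspace h .·-closed c _ (cs , e , refl) = c · cs , trans (length-map _ cs) e , lincomb-· c cs h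

  Span-length : ∀ {n vs v} → V n vs → Span n vs v → length v ≡ n
  Span-length h (cs , _ , refl) = length-lincomb cs h

  span-∈ : ∀ {n vs v} → V n vs → v ∈ vs → Span n vs v
  span-∈ {n} {w ∷ vs} (e ∷ h) (here refl) = 1F ∷ 𝟎 (length vs) , cong suc (length-replicate _) ,
    trans (cong₂ _⊕_ (1·v≡v w) (lincomb-𝟎 (length vs) h)) (⊕-𝟎ʳ w e)
  span-∈ {n} {w ∷ vs} (e ∷ h) (there p) with span-∈ h p
  ... | cs , l , refl = 0F ∷ cs , cong suc l , trans (cong (_⊕ lincomb n cs vs) (0·v≡𝟎 w e)) (⊕-𝟎ˡ _ (length-lincomb cs h))

  span-there : ∀ {n vs w v} → V n (w ∷ vs) → Span n vs v → Span n (w ∷ vs) v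
  span-there {n} {vs} {w} (e ∷ h) (cs , l , refl) =
    0F ∷ cs , cong suc l , trans (cong (_⊕ lincomb n cs vs) (0·v≡𝟎 w e)) (⊕-𝟎ˡ _ (length-lincomb cs h))

  All-span : ∀ {n vs} → V n vs → All (Span n vs) vs
  All-span h = All.tabulate (span-∈ h)

  span-trans : ∀ {n vs ws v} → V n vs → All (Span n vs) ws → Span n ws v → Span n vs v
  span-trans h s = span-min (All.map (Span-length h) s) (Span-IsSubspace h) s

  ∈-allVecs : ∀ {m} cs → length cs ≡ m → cs ∈ listsOver elements m
  ∈-allVecs cs l = ∈-listsOver⁺ _ l (All.tabulate λ {x} _ → elements-complete x)

  _≟V_ : (v w : Vec) → Dec (v ≡ w)
  _≟V_ = ≡-dec _≟F_

  span? : ∀ n vs v → Dec (Span n vs v)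
  span? n vs v with Any.any? (λ cs → lincomb n cs vs ≟V v) (listsOver elements (length vs))
  ... | yes p = yes (let cs , cs∈ , e = find p in cs , proj₁ (∈-listsOver⁻ elements _ cs∈) , e)
  ... | no ¬p = no λ (cs , l , e) → ¬p (lose {x = cs} (∈-allVecs cs l) e)

  -- The length condition matters: `lincomb` ignores surplus coefficients, and these would be
  -- unconstrained.
  Indep : ℕ → List Vec → Set
  Indep n vs = ∀ cs → length cs ≡ length vs → lincomb n cs vs ≡ 𝟎 n → All (_≡ 0F) cs

  isZero⁺ : ∀ {x} → x ≡ 0F → T (isZero x)
  isZero⁺ {x} e with x ≟F 0F
  ... | yes _ = _
  ... | no ¬e = ¬e e

  isZero⁻ : ∀ {x} → T (isZero x) → x ≡ 0F
  isZero⁻ {x} h with x ≟F 0F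
  ... | yes e = e

  isOne⁺ : ∀ {x} → x ≡ 1F → T (isOne x)
  isOne⁺ {x} e with x ≟F 1F
  ... | yes _ = _
  ... | no ¬e = ¬e e

  isOne⁻ : ∀ {x} → T (isOne x) → x ≡ 1F
  isOne⁻ {x} h with x ≟F 1F
  ... | yes e = e

  isZeroVec⁺ : ∀ {v} → All (_≡ 0F) v → T (isZeroVec v)
  isZeroVec⁺ h = AllP.all⁻ isZero (All.map isZero⁺ h)

  isZeroVec⁻ : ∀ {v} → T (isZeroVec v) → All (_≡ 0F) v
  isZeroVec⁻ {v} h = All.map isZero⁻ (AllP.all⁺ isZero v h)

  independent⁺ : ∀ {n vs} → Indep n vs → V n vs → T (independent n vs)
  independent⁺ {n} {vs} ind h = AllP.all⁻ _ (All.tabulate λ {cs} cs∈ → go cs (proj₁ (∈-listsOver⁻ elements _ cs∈)))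
    where
    go : ∀ cs → length cs ≡ length vs → T (isZeroVec cs ∨ not (isZeroVec (lincomb n cs vs)))
    go cs l with isZeroVec (lincomb n cs vs) in eq
    ... | false = Equivalence.from (T-∨ {isZeroVec cs} {true}) (inj₂ _)
    ... | true = Equivalence.from (T-∨ {isZeroVec cs} {false}) (inj₁ (isZeroVec⁺ (ind cs l
         (trans (AllZero⇒𝟎 (isZeroVec⁻ (subst T (sym eq) _))) (cong 𝟎 (length-lincomb cs h))))))

  independent⁻ : ∀ {n vs} → T (independent n vs) → Indep n vs
  independent⁻ {n} {vs} t cs l e with Equivalence.to (T-∨ {isZeroVec cs} {not (isZeroVec (lincomb n cs vs))})
      (All.lookup (AllP.all⁺ _ _ t) (∈-allVecs cs l))
  ... | inj₁ z = isZeroVec⁻ z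
  ... | inj₂ nz = ⊥-elim (T-not⁻ nz (isZeroVec⁺ (subst (All (_≡ 0F)) (sym e) (All-𝟎 n))))

  indep-[] : ∀ {n} → Indep n []
  indep-[] [] _ _ = []

  solve-head : ∀ {n c v u} → c ≢ 0F → length v ≡ n → length u ≡ n → c · v ⊕ u ≡ 𝟎 n →
    ∃ λ a → a · u ≡ v
  solve-head {n} {c} {v} {u} c≢0 lv lu e with inverse c c≢0
  ... | y , cy = -F y , vec-ext (trans (length-map _ u) (trans lu (sym lv))) λ i → trans (!-· (-F y) u i) (pt i)
    where
    pt : ∀ i → (-F y) *F u ! i ≡ v ! i
    pt i = begin
      (-F y) *F ui ≡⟨ sym (R.+-identityʳ _) ⟩
      (-F y) *F ui +F 0F ≡⟨ cong ((-F y) *F ui +F_) (sym (trans (cong (y *F_) s) (R.zeroʳ y))) ⟩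
      (-F y) *F ui +F y *F (c *F vi +F ui) ≡⟨ cong ((-F y) *F ui +F_) (R.distribˡ y _ _) ⟩
      (-F y) *F ui +F (y *F (c *F vi) +F y *F ui) ≡⟨ cong ((-F y) *F ui +F_) (R.+-comm _ _) ⟩
      (-F y) *F ui +F (y *F ui +F y *F (c *F vi)) ≡⟨ sym (R.+-assoc _ _ _) ⟩
      ((-F y) *F ui +F y *F ui) +F y *F (c *F vi) ≡⟨ cong₂ _+F_ (trans (sym (R.distribʳ ui (-F y) y)) (trans (cong (_*F ui) (R.-‿inverseˡ y)) (R.zeroˡ ui))) (sym (R.*-assoc y c vi)) ⟩
      0F +F (y *F c) *F vi ≡⟨ R.+-identityˡ _ ⟩
      (y *F c) *F vi ≡⟨ cong (_*F vi) (trans (R.*-comm y c) cy) ⟩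
      1F *F vi ≡⟨ R.*-identityˡ vi ⟩
      vi ∎
      where
      open ≡-Reasoning
      ui = u ! i
      vi = v ! i
      s : c *F vi +F ui ≡ 0F
      s = trans (trans (cong (_+F ui) (sym (!-· c v i))) (sym (!-⊕ (c · v) u i (trans (trans (length-map _ v) lv) (sym lu)))))
                (trans (cong (_! i) e) (!-𝟎 n i))

  indep-∷ : ∀ {n v vs} → length v ≡ n → V n vs → Indep n vs → ¬ Span n vs v → Indep n (v ∷ vs)
  indep-∷ {n} {v} {vs} lv h ind v∉ (c ∷ cs) l e with c ≟F 0F
  ... | yes refl = refl ∷ ind cs (suc-injective l)
        (trans (sym (⊕-𝟎ˡ _ (length-lincomb cs h))) (trans (cong (_⊕ lincomb n cs vs) (sym (0·v≡𝟎 v lv))) e))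
  ... | no c≢0 with solve-head c≢0 lv (length-lincomb cs h) e
  ... | a , eq = ⊥-elim (v∉ (subst (Span n vs) eq (·-closed (Span-IsSubspace h) a (length-lincomb cs h) (cs , suc-injective l , refl))))

  indep-tail : ∀ {n v vs} → length v ≡ n → V n vs → Indep n (v ∷ vs) → Indep n vs
  indep-tail {n} {v} {vs} lv h ind cs l e = All.tail (ind (0F ∷ cs) (cong suc l)
    (trans (cong (_⊕ lincomb n cs vs) (0·v≡𝟎 v lv)) (trans (⊕-𝟎ˡ _ (length-lincomb cs h)) e)))

  1F≢0F : 1F ≢ 0F
  1F≢0F e = 0≢1 (sym e)

  v⊕-v≡𝟎′ : ∀ {n} v → length v ≡ n → (-F 1F) · v ⊕ v ≡ 𝟎 n
  v⊕-v≡𝟎′ v e = trans (zipWith-comm _+F_ (R.+-comm) _ v) (v-v≡𝟎 v e)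

  -1≢0 : (-F 1F) ≢ 0F
  -1≢0 e = 1F≢0F (trans (sym (R.+-identityʳ 1F)) (trans (cong (1F +F_) (sym e)) (R.-‿inverseʳ 1F)))

  indep-head : ∀ {n v vs} → length v ≡ n → Indep n (v ∷ vs) → ¬ Span n vs v
  indep-head {v = v} lv ind (cs , l , refl) = -1≢0 (All.head (ind ((-F 1F) ∷ cs) (cong suc l) (v⊕-v≡𝟎′ v lv)))

  -- Dimension

  q≥2 : 2 ≤ q
  q≥2 = Unique-⊆⇒length≤ {xs = 0F ∷ 1F ∷ []} ((0≢1 ∷ []) ∷ [] ∷ []) (λ {x} _ → elements-complete x)

  q^-cancel-≤ : ∀ {a b} → q ^ a ≤ q ^ b → a ≤ b
  q^-cancel-≤ {a} {b} h with a ≤? b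
  ... | yes p = p
  ... | no ¬p = ⊥-elim (<⇒≱ (^-monoʳ-< q q≥2 (≰⇒> ¬p)) h)

  indep-lincomb-injective : ∀ {n vs} → V n vs → Indep n vs → ∀ {cs ds} → length cs ≡ length vs → length ds ≡ length vs →
    lincomb n cs vs ≡ lincomb n ds vs → cs ≡ ds
  indep-lincomb-injective {n} {vs} h ind {cs} {ds} l l′ e = vec-ext (trans l (sym l′)) λ i →
    cancel (trans (trans (cong (cs ! i +F_) (sym (!-· _ ds i))) (sym (!-⊕ cs _ i (trans l (sym l″))))) (zero-! i))
    where
    l″ : length ((-F 1F) · ds) ≡ length vs
    l″ = trans (length-map _ ds) l′
    z : All (_≡ 0F) (cs ⊕ (-F 1F) · ds)
    z = ind _ (length-⊕ cs _ l l″) (trans (lincomb-⊕ cs _ h (trans l (sym l″)))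
        (trans (cong₂ _⊕_ e (lincomb-· _ ds h)) (v-v≡𝟎 _ (length-lincomb ds h))))
    zero-! : ∀ i → (cs ⊕ (-F 1F) · ds) ! i ≡ 0F
    zero-! i = trans (cong (_! i) (AllZero⇒𝟎 z)) (!-𝟎 (length (cs ⊕ (-F 1F) · ds)) i)
    cancel : ∀ {x y} → x +F (-F 1F) *F y ≡ 0F → x ≡ y
    cancel {x} {y} e = trans (sym (R.+-identityʳ x)) (trans (cong (x +F_) (sym (trans (R.+-comm _ y) (x+-1x y))))
       (trans (sym (R.+-assoc x _ y)) (trans (cong (_+F y) e) (R.+-identityˡ y))))

  lincombs : ℕ → List Vec → List Vec
  lincombs n vs = map (λ cs → lincomb n cs vs) (listsOver elements (length vs))

  length-lincombs : ∀ n vs → length (lincombs n vs) ≡ q ^ length vs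
  length-lincombs n vs = trans (length-map _ (listsOver elements (length vs))) (length-listsOver elements (length vs))

  ∈-lincombs⁺ : ∀ {n vs v} → Span n vs v → v ∈ lincombs n vs
  ∈-lincombs⁺ (cs , l , refl) = ∈-map⁺ _ (∈-allVecs cs l)

  ∈-lincombs⁻ : ∀ {n} vs {v} → v ∈ lincombs n vs → Span n vs v
  ∈-lincombs⁻ vs p with ∈-map⁻ (λ cs → lincomb _ cs vs) p
  ... | cs , cs∈ , refl = cs , proj₁ (∈-listsOver⁻ elements _ cs∈) , refl

  lincombs-Unique : ∀ {n vs} → V n vs → Indep n vs → Unique (lincombs n vs)
  lincombs-Unique {n} {vs} h ind = map-Unique _ (listsOver-Unique (length vs) elements-unique) λ p q e →
    indep-lincomb-injective h ind (proj₁ (∈-listsOver⁻ elements _ p)) (proj₁ (∈-listsOver⁻ elements _ q)) e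

  -- Counting proof: an independent family of size a spans q^a vectors.
  indep-length≤ : ∀ {n bs vs} → V n vs → Indep n bs → All (Span n vs) bs → length bs ≤ length vs
  indep-length≤ {n} {bs} {vs} h ind s = q^-cancel-≤ (subst₂ _≤_ (length-lincombs n bs) (length-lincombs n vs)
    (Unique-⊆⇒length≤ (lincombs-Unique (All.map (Span-length h) s) ind)
       (λ p → ∈-lincombs⁺ (span-trans h s (∈-lincombs⁻ bs p)))))

  record Basis (n : ℕ) (vs bs : List Vec) : Set where
    field
      indep : Indep n bs
      spans : All (Span n bs) vs
      spanned : All (Span n vs) bs

  -- Each vector is kept exactly when it is outside the span of those kept to its right. The basis
  -- must be a sublist because `dimSpan` searches through sublists.
  subbasis : ∀ {n vs} → V n vs → ∃ λ bs → bs ∈ sublists vs × V n bs × Basis n vs bs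
  subbasis [] = [] , here refl , [] , record { indep = indep-[] ; spans = [] ; spanned = [] }
  subbasis {n} {v ∷ vs} (e ∷ h) with subbasis h
  ... | bs , bs∈ , hb , B with span? n bs v
  ... | yes p = bs , ∈-++⁺ˡ bs∈ , hb , record
          { indep = Basis.indep B ; spans = p ∷ Basis.spans B
          ; spanned = All.map (span-there (e ∷ h)) (Basis.spanned B) }
  ... | no ¬p = v ∷ bs , ∈-++⁺ʳ (sublists vs) (∈-map⁺ (v ∷_) bs∈) , e ∷ hb , record
          { indep = indep-∷ e hb (Basis.indep B) ¬p
          ; spans = span-∈ (e ∷ hb) (here refl) ∷ All.map (span-there (e ∷ hb)) (Basis.spans B)
          ; spanned = span-∈ (e ∷ h) (here refl) ∷ All.map (span-there (e ∷ h)) (Basis.spanned B) }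

  -- `bs` itself need not be a sublist of `vs`. For the lower bound it is therefore compared with a
  -- basis that is one, which is at least as long because it spans `bs`.
  dimSpan-basis : ∀ {n vs bs} → V n vs → Basis n vs bs → dimSpan n vs ≡ length bs
  dimSpan-basis {n} {vs} {bs} h B = ≤-antisym
    (foldr-⊔-≤ (AllP.map⁺ (All.tabulate λ {S} S∈ → let S∈′ , t = ∈-filterᵇ⁻ (independent n) (sublists vs) S∈ in
       indep-length≤ hb (independent⁻ t) (All.tabulate λ p → All.lookup (Basis.spans B) (∈-sublists⇒⊆ vs S∈′ p)))))
    lower
    where
    hb : V n bs
    hb = All.map (Span-length h) (Basis.spanned B)
    lower : length bs ≤ dimSpan n vs
    lower with subbasis h
    ... | S , S∈ , hS , BS = ≤-trans
      (indep-length≤ hS (Basis.indep B) (All.map (span-trans hS (Basis.spans BS)) (Basis.spanned B)))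
      (∈⇒≤foldr-⊔ (∈-map⁺ length (∈-filterᵇ⁺ (independent n) S∈ (independent⁺ (Basis.indep BS) hS))))

  dimSpan-cong : ∀ {n vs ws} → V n vs → V n ws → All (Span n vs) ws → All (Span n ws) vs → dimSpan n vs ≡ dimSpan n ws
  dimSpan-cong h h′ s t with subbasis h
  ... | bs , _ , hb , B = trans (dimSpan-basis h B) (sym (dimSpan-basis h′ record
    { indep = Basis.indep B
    ; spans = All.map (span-trans hb (Basis.spans B)) s
    ; spanned = All.map (span-trans h′ t) (Basis.spanned B) }))

  -- Reduced row echelon forms

  -- A form suited to peeling off the first row: each constructor clears the new row at the later
  -- pivots and the later rows at the new pivot. That pivots increase is stated separately, by
  -- `Subset[_]`.
  data RREF (n : ℕ) : List ℕ → List Vec → Set where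
    [] : RREF n [] []
    pivot : ∀ {d row D N} → length row ≡ n → entry row d ≡ 1F →
      (∀ t → 1 ≤ t → t < d → entry row t ≡ 0F) →
      All (λ d′ → entry row d′ ≡ 0F) D → All (λ r → entry r d ≡ 0F) N →
      RREF n D N → RREF n (d ∷ D) (row ∷ N)

  RREF-V : ∀ {n D N} → RREF n D N → V n N
  RREF-V [] = []
  RREF-V (pivot l _ _ _ _ r) = l ∷ RREF-V r

  RREF-length : ∀ {n D N} → RREF n D N → length N ≡ length D
  RREF-length [] = refl
  RREF-length (pivot _ _ _ _ _ r) = cong suc (RREF-length r)

  lincomb-entry : ∀ {n vs} cs → V n vs → ∀ d → entry (lincomb n cs vs) d ≡ dot cs (map (λ r → entry r d) vs)
  lincomb-entry cs h d = lincomb-! cs h (d ∸ 1)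

  entry-⊕ : ∀ {n} v w d → length v ≡ n → length w ≡ n → entry (v ⊕ w) d ≡ entry v d +F entry w d
  entry-⊕ v w d p q = !-⊕ v w (d ∸ 1) (trans p (sym q))

  -- On its pivot columns the matrix is the identity, so coordinates can be read off there.
  -- Independence, uniqueness of echelon forms and the recovery of X from X N all rest on this.
  rref-coefficients : ∀ {n D N} → RREF n D N → ∀ cs → length cs ≡ length D → map (entry (lincomb n cs N)) D ≡ cs
  rref-coefficients [] [] l = refl
  rref-coefficients {n} {d ∷ D} {row ∷ N} (pivot lr one lead zr zc r) (c ∷ cs) l = cong₂ _∷_
    (trans (split d) (trans (cong₂ _+F_ (trans (cong (c *F_) one) (R.*-identityʳ c))
       (trans (lincomb-entry cs (RREF-V r) d) (dot-𝟎ʳ cs (AllP.map⁺ zc)))) (R.+-identityʳ c)))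
    (trans (map-cong-∈ D λ {d′} d′∈ → trans (split d′)
              (trans (cong (_+F entry (lincomb n cs N) d′) (trans (cong (c *F_) (All.lookup zr d′∈)) (R.zeroʳ c))) (R.+-identityˡ _)))
           (rref-coefficients r cs (suc-injective l)))
    where
    split : ∀ e → entry (c · row ⊕ lincomb n cs N) e ≡ c *F entry row e +F entry (lincomb n cs N) e
    split e = trans (entry-⊕ (c · row) _ e (trans (length-map _ row) lr) (length-lincomb cs (RREF-V r)))
                    (cong (_+F entry (lincomb n cs N) e) (!-· c row (e ∸ 1)))

  rref-indep : ∀ {n D N} → RREF n D N → Indep n N
  rref-indep {n} {D} {N} r cs l e = subst (All (_≡ 0F))
    (trans (cong (λ u → map (entry u) D) (sym e)) (rref-coefficients r cs (trans l (RREF-length r))))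
    (AllP.map⁺ (All.tabulate λ {d} _ → !-𝟎 n (d ∸ 1)))

  rref-span : ∀ {n D N v} → RREF n D N → Span n N v → lincomb n (map (entry v) D) N ≡ v
  rref-span {n} {N = N} r (cs , l , refl) =
    cong (λ u → lincomb n u N) (rref-coefficients r cs (trans l (RREF-length r)))

  idMat : ℕ → List Vec
  idMat zero = []
  idMat (suc k) = (1F ∷ 𝟎 k) ∷ map (0F ∷_) (idMat k)

  rref-idMat : ∀ {n D N} → RREF n D N → map (λ r → map (entry r) D) N ≡ idMat (length D)
  rref-idMat [] = refl
  rref-idMat {D = d ∷ D} {row ∷ N} (pivot lr one lead zr zc r) = cong₂ _∷_
    (cong₂ _∷_ one (trans (AllZero⇒𝟎 (AllP.map⁺ zr)) (cong 𝟎 (length-map _ D))))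
    (trans (map-cong-∈ N λ {s} s∈ → cong (_∷ map (entry s) D) (All.lookup zc s∈))
           (trans (map-∘ N) (cong (map (0F ∷_)) (rref-idMat r))))

  Lead : Vec → ℕ → Set
  Lead v d = entry v d ≡ 1F × (∀ t → 1 ≤ t → t < d → entry v t ≡ 0F)

  rref-lead : ∀ {n D N d} → RREF n D N → d ∈ D → ∃ λ r → r ∈ N × Lead r d
  rref-lead (pivot _ one lead _ _ _) (here refl) = _ , here refl , one , lead
  rref-lead (pivot _ _ _ _ _ r) (there p) with rref-lead r p
  ... | s , s∈ , l = s , there s∈ , l

  -- Write v as the combination of the rows with its own pivot entries as coefficients, and look at
  -- column d. A row with pivot e > d is still zero at d, and a row with pivot e < d has coefficient
  -- v_e = 0. If d were not a pivot, v would be 0 at d instead of 1.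
  lead-pivot : ∀ {n D N v d} → RREF n D N → All (1 ≤_) D → Span n N v → 1 ≤ d → Lead v d → d ∈ D
  lead-pivot {n} {D} {N} {v} {d} r pos s 1≤d (one , lead) with d ∈? D
  ... | yes p = p
  ... | no d∉ = ⊥-elim (1F≢0F (trans (sym one) (trans (cong (λ u → entry u d) (sym (rref-span r s)))
      (trans (lincomb-entry (map (entry v) D) (RREF-V r) d) (vanish r pos d∉)))))
    where
    vanish : ∀ {D N} → RREF n D N → All (1 ≤_) D → d ∉ D → dot (map (entry v) D) (map (λ r → entry r d) N) ≡ 0F
    vanish [] _ _ = refl
    vanish {e ∷ D} {row ∷ N} (pivot _ _ lead′ _ _ r) (p ∷ pos) d∉ =
      trans (cong₂ _+F_ head-zero (vanish r pos (d∉ ∘ there))) (R.+-identityˡ 0F)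
      where
      head-zero : entry v e *F entry row d ≡ 0F
      head-zero with <-cmp d e
      ... | tri< d<e _ _ = trans (cong (entry v e *F_) (lead′ d 1≤d d<e)) (R.zeroʳ _)
      ... | tri≈ _ d≡e _ = ⊥-elim (d∉ (here d≡e))
      ... | tri> _ _ e<d = trans (cong (_*F entry row d) (lead e p e<d)) (R.zeroˡ _)

  -- The pivot set is the set of leading positions in the common row space. Once it is shared, both
  -- matrices are obtained from `N′` by applying the rows of the identity matrix as coefficients.
  rref-unique : ∀ {n D D′ N N′} → RREF n D N → RREF n D′ N′ → Subset[ n ] D → Subset[ n ] D′ →
    All (Span n N′) N → All (Span n N) N′ → D ≡ D′ × N ≡ N′
  rref-unique {n} {D} {D′} {N} {N′} r r′ (i , a) (i′ , a′) s s′ = D≡ , N≡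
    where
    sub : ∀ {D D′ N N′} → RREF n D N → RREF n D′ N′ → All (λ d → 1 ≤ d × d ≤ n) D → All (λ d → 1 ≤ d × d ≤ n) D′ →
      All (Span n N′) N → D ⊆ D′
    sub r r′ a a′ s d∈ with rref-lead r d∈
    ... | row , row∈ , l = lead-pivot r′ (All.map proj₁ a′) (All.lookup s row∈) (proj₁ (All.lookup a d∈)) l
    D≡ : D ≡ D′
    D≡ = Increasing-ext i i′ (sub r r′ a a′ s) (sub r′ r a′ a s′)
    recover : ∀ {D N N′} → RREF n D N → RREF n D N′ → All (Span n N′) N →
      N ≡ map (λ cs → lincomb n cs N′) (idMat (length D))
    recover {D} {N} {N′} r r′ s = trans (sym (map-id N)) (trans (map-cong-∈ N λ v∈ → sym (rref-span r′ (All.lookup s v∈)))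
      (trans (map-∘ N) (cong (map (λ cs → lincomb n cs N′)) (rref-idMat r))))
    N≡ : N ≡ N′
    N≡ with D≡
    ... | refl = trans (recover r r′ s) (sym (recover r′ r′ (All-span (RREF-V r′))))

  -- Gaussian elimination

  cons-0F-IsSubspace : ∀ {p} {S : Vec → Set} → IsSubspace (suc p) S → IsSubspace p (S ∘ (0F ∷_))
  cons-0F-IsSubspace S .IsSubspace.𝟎-closed = IsSubspace.𝟎-closed S
  cons-0F-IsSubspace {S = P} S .IsSubspace.⊕-closed {v} {w} l l′ p q =
    subst P (cong (_∷ v ⊕ w) (R.+-identityˡ 0F)) (IsSubspace.⊕-closed S (cong suc l) (cong suc l′) p q)
  cons-0F-IsSubspace {S = P} S .IsSubspace.·-closed c {v} l p =
    subst P (cong (_∷ c · v) (R.zeroʳ c)) (IsSubspace.·-closed S c (cong suc l) p)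

  span-cons-0F : ∀ {p vs ws v} → V p vs → V (suc p) ws → All (λ u → Span (suc p) ws (0F ∷ u)) vs → Span p vs v → Span (suc p) ws (0F ∷ v)
  span-cons-0F h h′ s = span-min h (cons-0F-IsSubspace (Span-IsSubspace h′)) s

  -- Pivots are 1-based and `entry` truncates, so positions 0 and 1 read the same entry; positivity
  -- of the pivots makes the shift by one column correct.
  rref-shift : ∀ {n D N} → RREF n D N → All (1 ≤_) D → RREF (suc n) (map suc D) (map (0F ∷_) N)
  rref-shift [] _ = []
  rref-shift {D = suc d ∷ D} {row ∷ N} (pivot l one lead zr zc r) (s≤s _ ∷ pos) =
    pivot (cong suc l) one lead′ (AllP.map⁺ (All.zipWith (λ { {suc _} (z , s≤s _) → z }) (zr , pos)))
      (AllP.map⁺ zc) (rref-shift r pos)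
    where
    lead′ : ∀ t → 1 ≤ t → t < suc (suc d) → entry (0F ∷ row) t ≡ 0F
    lead′ (suc zero) _ _ = refl
    lead′ (suc (suc t)) _ (s≤s t<) = lead (suc t) (s≤s z≤n) t<

  shift-Subset : ∀ {n D} → Subset[ n ] D → Subset[ suc n ] (map suc D)
  shift-Subset (i , a) = APP.map⁺ (AllPairs.map s≤s i) , AllP.map⁺ (All.map (λ (l , u) → s≤s z≤n , s≤s u) a)

  V-cons : ∀ {n} {vs : List Vec} x → V n vs → V (suc n) (map (x ∷_) vs)
  V-cons x h = AllP.map⁺ (All.map (cong suc) h)

  hd : Vec → Carrier
  hd v = v ! 0

  tl : Vec → Vec
  tl [] = []
  tl (x ∷ v) = v

  hd-tl : ∀ {p} v → length v ≡ suc p → v ≡ hd v ∷ tl v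
  hd-tl (x ∷ v) _ = refl

  length-tl : ∀ {p} v → length v ≡ suc p → length (tl v) ≡ p
  length-tl (x ∷ v) = suc-injective

  x+[-h]x : ∀ h x → h *F x +F (-F h) *F x ≡ 0F
  x+[-h]x h x = trans (sym (R.distribʳ x h (-F h))) (trans (cong (_*F x) (R.-‿inverseʳ h)) (R.zeroˡ x))

  ·⊕-cancel : ∀ {p} h w t → length w ≡ p → length t ≡ p → h · w ⊕ (t ⊕ (-F h) · w) ≡ t
  ·⊕-cancel {p} h w t lw lt = vec-ext (trans (length-⊕ (h · w) _ lhw ltw) (sym lt)) λ i →
    trans (!-⊕ (h · w) (t ⊕ (-F h) · w) i (trans lhw (sym ltw)))
    (trans (cong₂ _+F_ (!-· h w i) (trans (!-⊕ t _ i (trans lt (sym l-hw))) (cong (t ! i +F_) (!-· (-F h) w i))))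
    (arith (t ! i) (w ! i)))
    where
    lhw : length (h · w) ≡ p
    lhw = trans (length-map _ w) lw
    l-hw : length ((-F h) · w) ≡ p
    l-hw = trans (length-map _ w) lw
    ltw : length (t ⊕ (-F h) · w) ≡ p
    ltw = length-⊕ t _ lt l-hw
    arith : ∀ a b → h *F b +F (a +F (-F h) *F b) ≡ a
    arith a b = trans (cong (h *F b +F_) (R.+-comm a _)) (trans (sym (R.+-assoc _ _ a))
                (trans (cong (_+F a) (x+[-h]x h b)) (R.+-identityˡ a)))

  ⊕-comm : ∀ v w → v ⊕ w ≡ w ⊕ v
  ⊕-comm = zipWith-comm _+F_ R.+-comm

  Echelon : ℕ → List Vec → Set
  Echelon p B = ∃₂ λ D N → Subset[ p ] D × RREF p D N × All (Span p N) B × All (Span p B) N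

  module _ {p : ℕ} {B : List Vec} (h : V (suc p) B) where

    echelon-zero-column : All (λ b → hd b ≡ 0F) B → Echelon p (map tl B) → Echelon (suc p) B
    echelon-zero-column z (D , N , sub , r , s , t) =
      map suc D , map (0F ∷_) N , shift-Subset sub , rref-shift r (All.map proj₁ (proj₂ sub)) ,
      All.tabulate (λ {b} b∈ → subst (Span (suc p) (map (0F ∷_) N)) (sym (eq b∈))
         (span-cons-0F (RREF-V r) hN (All.tabulate λ v∈ → span-∈ hN (∈-map⁺ (0F ∷_) v∈)) (All.lookup s (∈-map⁺ tl b∈)))) ,
      AllP.map⁺ (All.map (span-cons-0F hB h (AllP.map⁺ (All.tabulate λ b∈ → subst (Span (suc p) B) (eq b∈) (span-∈ h b∈)))) t)
      where
      hN : V (suc p) (map (0F ∷_) N)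
      hN = V-cons 0F (RREF-V r)
      hB : V p (map tl B)
      hB = AllP.map⁺ (All.map (λ {b} → length-tl b) h)
      eq : ∀ {b} → b ∈ B → b ≡ 0F ∷ tl b
      eq {b} b∈ = trans (hd-tl b (All.lookup h b∈)) (cong (_∷ tl b) (All.lookup z b∈))

    module _ (w : Vec) (lw : length w ≡ p) (w∈ : Span (suc p) B (1F ∷ w)) where

      eliminate : Vec → Vec
      eliminate b = tl b ⊕ (-F hd b) · w

      length-eliminate : ∀ b → length b ≡ suc p → length (eliminate b) ≡ p
      length-eliminate b l = length-⊕ (tl b) _ (length-tl b l) (trans (length-map _ w) lw)

      eliminate-eq : ∀ {b} → length b ≡ suc p → hd b · (1F ∷ w) ⊕ (0F ∷ eliminate b) ≡ b
      eliminate-eq {x ∷ b} l = cong₂ _∷_ (trans (R.+-identityʳ _) (R.*-identityʳ x)) (·⊕-cancel x w b lw (suc-injective l))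

      eliminate-eq′ : ∀ {b} → length b ≡ suc p → b ⊕ (-F hd b) · (1F ∷ w) ≡ 0F ∷ eliminate b
      eliminate-eq′ {x ∷ b} l = cong (_∷ eliminate (x ∷ b)) (trans (cong (x +F_) (R.*-identityʳ _)) (R.-‿inverseʳ x))

      -- The remaining rows are cleared in the first column before the recursion; the pivot row must
      -- then be cleared at the pivots `D` found by it. Subtracting `L`, the combination of `N`
      -- whose coefficients are the entries of `w` at `D`, does this and keeps the row space.
      echelon-pivot-column : Echelon p (map eliminate B) → Echelon (suc p) B
      echelon-pivot-column (D , N , sub , r , s , t) =
        1 ∷ map suc D , row ∷ map (0F ∷_) N ,
        (AllP.map⁺ (All.map (s≤s ∘ proj₁) (proj₂ sub)) ∷ proj₁ (shift-Subset sub) , (s≤s z≤n , s≤s z≤n) ∷ proj₂ (shift-Subset sub)) ,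
        pivot (cong suc lw′) refl (λ { (suc t) _ (s≤s ()) })
          (AllP.map⁺ (All.tabulate λ {d} d∈ → zero-at d∈)) (AllP.map⁺ (All.tabulate λ _ → refl))
          (rref-shift r (All.map proj₁ (proj₂ sub))) ,
        All.tabulate (λ {b} b∈ → subst (Span (suc p) N₀) (eliminate-eq (All.lookup h b∈))
          (⊕-cl (cong suc (trans (length-map _ w) lw)) (cong suc (length-eliminate b (All.lookup h b∈)))
             (IsSubspace.·-closed (Span-IsSubspace hN₀) (hd b) (cong suc lw) 1w∈)
             (up (All.lookup s (∈-map⁺ eliminate b∈))))) ,
        subst (Span (suc p) B) row-eq (IsSubspace.⊕-closed SB (cong suc lw) (trans (length-map _ (0F ∷ L)) (cong suc lL)) w∈
             (IsSubspace.·-closed SB (-F 1F) (cong suc lL) (down (lincomb-span (map (entry w) D)))))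
        ∷ AllP.map⁺ (All.map (span-cons-0F hE h (AllP.map⁺ (All.tabulate el∈))) t)
        where
        L w′ row : Vec
        L = lincomb p (map (entry w) D) N
        w′ = w ⊕ (-F 1F) · L
        row = 1F ∷ w′
        hN : V p N
        hN = RREF-V r
        hE : V p (map eliminate B)
        hE = AllP.map⁺ (All.map (λ {b} → length-eliminate b) h)
        lL : length L ≡ p
        lL = length-lincomb (map (entry w) D) hN
        lw′ : length w′ ≡ p
        lw′ = length-⊕ w _ lw (trans (length-map _ L) lL)
        N₀ : List Vec
        N₀ = row ∷ map (0F ∷_) N
        hN₀ : V (suc p) N₀
        hN₀ = cong suc lw′ ∷ V-cons 0F hN
        SB : IsSubspace (suc p) (Span (suc p) B)
        SB = Span-IsSubspace h
        ⊕-cl : ∀ {v w} → length v ≡ suc p → length w ≡ suc p → Span (suc p) N₀ v → Span (suc p) N₀ w → Span (suc p) N₀ (v ⊕ w)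
        ⊕-cl = IsSubspace.⊕-closed (Span-IsSubspace hN₀)
        lincomb-span : ∀ cs → Span p N (lincomb p cs N)
        lincomb-span = lincomb-closed hN (Span-IsSubspace hN) (All-span hN)
        up : ∀ {v} → Span p N v → Span (suc p) N₀ (0F ∷ v)
        up = span-cons-0F hN hN₀ (All.tabulate λ v∈ → span-∈ hN₀ (there (∈-map⁺ (0F ∷_) v∈)))
        el∈ : ∀ {b} → b ∈ B → Span (suc p) B (0F ∷ eliminate b)
        el∈ {b} b∈ = subst (Span (suc p) B) (eliminate-eq′ (All.lookup h b∈))
          (IsSubspace.⊕-closed SB (All.lookup h b∈) (cong suc (trans (length-map _ w) lw)) (span-∈ h b∈)
            (IsSubspace.·-closed SB _ (cong suc lw) w∈))
        down : ∀ {v} → Span p N v → Span (suc p) B (0F ∷ v)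
        down s′ = span-cons-0F hE h (AllP.map⁺ (All.tabulate el∈)) (span-trans hE t s′)
        zero-at : ∀ {d} → d ∈ D → entry row (suc d) ≡ 0F
        zero-at {zero} d∈ with () ← proj₁ (All.lookup (proj₂ sub) d∈)
        zero-at {suc d} d∈ = trans (!-⊕ w _ d (trans lw (sym (trans (length-map _ L) lL))))
          (trans (cong (w ! d +F_) (trans (!-· (-F 1F) L d) (cong ((-F 1F) *F_) coef))) (x+-1x (w ! d)))
          where
          coef : L ! d ≡ w ! d
          coef = map-≡⇒≡ (rref-coefficients r (map (entry w) D) (length-map _ D)) d∈
        1w-eq : row ⊕ (0F ∷ L) ≡ 1F ∷ w
        1w-eq = cong₂ _∷_ (R.+-identityʳ 1F) (trans (⊕-comm w′ L) (trans (cong (_⊕ w′) (sym (1·v≡v L))) (·⊕-cancel 1F L w lL lw)))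
        row-eq : (1F ∷ w) ⊕ (-F 1F) · (0F ∷ L) ≡ row
        row-eq = cong (_∷ w′) (trans (cong (1F +F_) (R.zeroʳ _)) (R.+-identityʳ 1F))
        1w∈ : Span (suc p) N₀ (1F ∷ w)
        1w∈ = subst (Span (suc p) N₀) 1w-eq (⊕-cl (cong suc lw′) (cong suc lL) (span-∈ hN₀ (here refl)) (up (lincomb-span (map (entry w) D))))

  echelon : ∀ p B → V p B → Echelon p B
  echelon zero B h = [] , [] , ([] , []) , [] , All.map (λ { {[]} _ → [] , refl , refl }) h , []
  echelon (suc p) B h with All.all? (λ b → hd b ≟F 0F) B
  ... | yes z = echelon-zero-column h z (echelon p (map tl B) (AllP.map⁺ (All.map (λ {b} → length-tl b) h)))
  ... | no ¬z with find (AllP.¬All⇒Any¬ (λ b → hd b ≟F 0F) B ¬z)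
  ... | b , b∈ , b≢ with inverse (hd b) b≢
  ... | y , xy = echelon-pivot-column h w lw w∈ (echelon p (map (eliminate h w lw w∈) B) (AllP.map⁺ (All.map (λ {b} → length-eliminate h w lw w∈ b) h)))
    where
    w : Vec
    w = y · tl b
    lb : length b ≡ suc p
    lb = All.lookup h b∈
    lw : length w ≡ p
    lw = trans (length-map _ (tl b)) (length-tl b lb)
    w∈ : Span (suc p) B (1F ∷ w)
    w∈ = subst (Span (suc p) B) (trans (cong (y ·_) (hd-tl b lb)) (cong (_∷ w) (trans (R.*-comm y _) xy)))
           (IsSubspace.·-closed (Span-IsSubspace h) y lb (span-∈ h b∈))

  -- Matrices given by their columns: row rank and column rank

  rowsOf : ℕ → List Vec → List Vec
  rowsOf m X = applyUpTo (λ i → map (_! i) X) m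

  dot-comm : ∀ cs ds → length cs ≡ length ds → dot cs ds ≡ dot ds cs
  dot-comm [] [] l = refl
  dot-comm (c ∷ cs) (d ∷ ds) l = cong₂ _+F_ (R.*-comm c d) (dot-comm cs ds (suc-injective l))

  V-rowsOf : ∀ m X → V (length X) (rowsOf m X)
  V-rowsOf m X = AllP.applyUpTo⁺₂ _ m λ i → length-map (_! i) X

  full-⊆ : ∀ {xs ys : List ℕ} → Unique xs → xs ⊆ ys → length ys ≤ length xs → ys ⊆ xs
  full-⊆ {xs} {ys} u s l {y} y∈ with y ∈? xs
  ... | yes p = p
  ... | no y∉ = ⊥-elim (<⇒≱ (Unique-⊆⇒length≤ {ys = ys} (All.tabulate (λ x∈ e → y∉ (subst (_∈ xs) (sym e) x∈)) ∷ u)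
     λ { (here refl) → y∈ ; (there p) → s p }) l)

  map-! : (X : List Vec) (i k : ℕ) → map (_! i) X ! k ≡ nthD [] X k ! i
  map-! X i k = nthD-map (_! i) [] 0F refl X k

  -- Row rank equals column rank: the pivot columns of X span its column space, so there are length X of them.
  rows-span : ∀ {m X} → V m X → Indep m X → ∀ {y} → length y ≡ length X → Span (length X) (rowsOf m X) y
  rows-span {m} {X} h ind {y} ly with echelon (length X) (rowsOf m X) (V-rowsOf m X)
  ... | D , N , (i , a) , r , s , t = span-trans (V-rowsOf m X) t (map (entry y) D , trans (length-map _ D) (sym (RREF-length r)) , eq)
    where
    ℓ = length X
    Y : List Vec
    Y = map (λ d → nthD [] X (d ∸ 1)) D
    pred< : ∀ {d} → 1 ≤ d → d ≤ ℓ → d ∸ 1 < ℓ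
    pred< {suc d} _ u = u
    hY : V m Y
    hY = AllP.map⁺ (All.map (λ (l , u) → All.lookup h (nthD-∈ [] X (pred< l u))) a)
    -- Row i of `X` is the combination of `N` with coefficients X_{i,d}, d in `D`. Read at position
    -- k, this says that column k is a combination of the pivot columns `Y`, with coefficients from
    -- column k of `N`.
    column : ∀ {k} → k < ℓ → lincomb m (map (_! k) N) Y ≡ nthD [] X k
    column {k} k< = nthD-ext 0F (trans (length-lincomb (map (_! k) N) hY) (sym (All.lookup h (nthD-∈ [] X k<)))) λ i i< →
      trans (lincomb-! (map (_! k) N) hY i) (trans (cong (dot (map (_! k) N)) (trans (sym (map-∘ D)) (map-cong (λ d → sym (map-! X i (d ∸ 1))) D)))
      (trans (dot-comm (map (_! k) N) _ (trans (length-map _ N) (trans (RREF-length r) (sym (length-map _ D)))))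
      (trans (sym (lincomb-! (map (entry (map (_! i) X)) D) (RREF-V r) k)) (trans (cong (_! k) (rref-span r (All.lookup s (∈-applyUpTo⁺ (λ i → map (_! i) X) (subst (i <_) (length-lincomb (map (_! k) N) hY) i<)))))
      (map-! X i k)))))
    ℓ≤ : ℓ ≤ length D
    ℓ≤ = ≤-trans (indep-length≤ hY ind (All.tabulate λ {x} x∈ → let k , k< , e = ∈-nthD [] x∈ in
        map (_! k) N , trans (length-map _ N) (trans (RREF-length r) (sym (length-map _ D))) , trans (column k<) e))
        (≤-reflexive (length-map _ D))
    all-pivots : range 1 ℓ ⊆ D
    all-pivots = full-⊆ (Increasing⇒Unique i) (λ d∈ → let l , u = All.lookup a d∈ in range-∈⁺ 1 ℓ l u)
      (≤-trans (≤-reflexive (length-applyUpTo (1 +_) ℓ)) ℓ≤)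
    eq : lincomb ℓ (map (entry y) D) N ≡ y
    eq = nthD-ext 0F (trans (length-lincomb (map (entry y) D) (RREF-V r)) (sym ly)) λ k k< →
      map-≡⇒≡ (rref-coefficients r (map (entry y) D) (length-map _ D))
        (all-pivots (∈-applyUpTo⁺ (1 +_) (subst (k <_) (length-lincomb (map (entry y) D) (RREF-V r)) k<)))

  -- The boolean test for echelon form

  PivotRow : ℕ → List ℕ → ℕ × Vec → Set
  PivotRow n C (c , row) = length row ≡ n × entry row c ≡ 1F × (∀ t → 1 ≤ t → t < c → entry row t ≡ 0F) ×
    (∀ {c′} → c′ ∈ C → c′ ≢ c → entry row c′ ≡ 0F)

  -- The test compares each row with all pivots at once, `RREF` only with the rows after it. The
  -- induction keeps the full set `C` fixed and shrinks a part `C′` of it; distinctness of the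
  -- pivots makes the conditions on other pivots applicable.
  PivotRows⇒RREF : ∀ {n C M} → Unique C → length M ≡ length C → All (PivotRow n C) (zip C M) → RREF n C M
  PivotRows⇒RREF {n} {C} {M} u l a = go u id l a
    where
    column-zero : ∀ {c} C′ M → c ∈ C → All (λ c′ → c ≢ c′) C′ → length M ≡ length C′ →
      All (PivotRow n C) (zip C′ M) → All (λ r → entry r c ≡ 0F) M
    column-zero [] [] c∈ _ _ _ = []
    column-zero (c′ ∷ C′) (row ∷ M) c∈ (c≢ ∷ cs) l ((_ , _ , _ , z) ∷ qs) = z c∈ c≢ ∷ column-zero C′ M c∈ cs (suc-injective l) qs
    go : ∀ {C′ M} → Unique C′ → C′ ⊆ C → length M ≡ length C′ → All (PivotRow n C) (zip C′ M) → RREF n C′ M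
    go {[]} {[]} _ _ _ _ = []
    go {c ∷ C′} {row ∷ M} (c∉ ∷ u) sub l ((lr , one , lead , z) ∷ qs) =
      pivot lr one lead (All.tabulate λ c′∈ → z (sub (there c′∈)) (λ e → All.lookup c∉ c′∈ (sym e)))
        (column-zero C′ M (sub (here refl)) c∉ (suc-injective l) qs)
        (go u (sub ∘ there) (suc-injective l) qs)

  RREF⇒PivotRows : ∀ {n C M} → RREF n C M → All (PivotRow n C) (zip C M)
  RREF⇒PivotRows [] = []
  RREF⇒PivotRows {n} {c ∷ C} (pivot lr one lead zr zc r) =
    (lr , one , lead , λ { (here refl) ne → ⊥-elim (ne refl) ; (there p) _ → All.lookup zr p }) ∷ add zc (RREF⇒PivotRows r)
    where
    add : ∀ {d C C′ M} → All (λ r → entry r d ≡ 0F) M → All (PivotRow n C) (zip C′ M) → All (PivotRow n (d ∷ C)) (zip C′ M)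
    add {C′ = []} _ _ = []
    add {C′ = _ ∷ _} [] _ = []
    add {C′ = _ ∷ _} (z ∷ zs) ((k , a , b , c) ∷ q) = (k , a , b , λ { (here refl) _ → z ; (there p) → c p }) ∷ add zs q

  isRREF⇒ : ∀ {n} C M → Unique C → T (isRREFWithPivots n C M) → RREF n C M
  isRREF⇒ {n} C M u t with T-∧⁻ {length M ≡ᵇ length C} t
  ... | tl , t′ with T-∧⁻ {all (λ row → length row ≡ᵇ n) M} t′
  ... | tr , tz = PivotRows⇒RREF u (≡ᵇ⇒≡ _ _ tl)
        (pair C (All.map (≡ᵇ⇒≡ _ _) (AllP.all⁺ _ M tr)) (All.map (λ {x} → conv {x}) (AllP.all⁺ _ (zip C M) tz)))
    where
    Q : ℕ × Vec → Set
    Q (c , row) = entry row c ≡ 1F × (∀ t → 1 ≤ t → t < c → entry row t ≡ 0F) × (∀ {c′} → c′ ∈ C → c′ ≢ c → entry row c′ ≡ 0F)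
    conv : ∀ {x} → _ → Q x
    conv {c , row} t with T-∧⁻ {isOne (entry row c)} t
    ... | t1 , t2 with T-∧⁻ {all (λ t → isZero (entry row t)) (range 1 (c ∸ 1))} t2
    ... | t3 , t4 = isOne⁻ t1 ,
       (λ t 1≤t t<c → isZero⁻ (All.lookup (AllP.all⁺ _ _ t3) (range-∈⁺ 1 (c ∸ 1) 1≤t (∸-monoˡ-≤ 1 t<c)))) ,
       λ {c′} c′∈ c′≢ → case Equivalence.to (T-∨ {c′ ≡ᵇ c}) (All.lookup (AllP.all⁺ _ C t4) c′∈) of λ
         { (inj₁ e) → ⊥-elim (c′≢ (≡ᵇ⇒≡ _ _ e)) ; (inj₂ z) → isZero⁻ z }
    pair : ∀ C′ {M} → V n M → All Q (zip C′ M) → All (PivotRow n C) (zip C′ M)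
    pair [] _ _ = []
    pair (_ ∷ _) [] _ = []
    pair (c ∷ C′) (l ∷ h) (q ∷ qs) = (l , q) ∷ pair C′ h qs

  isRREF⇐ : ∀ {n C M} → RREF n C M → T (isRREFWithPivots n C M)
  isRREF⇐ {n} {C} {M} r = T-∧⁺ {length M ≡ᵇ length C} (≡⇒≡ᵇ _ _ (RREF-length r)) (T-∧⁺ {all (λ row → length row ≡ᵇ n) M}
     (AllP.all⁻ _ (All.map (≡⇒≡ᵇ _ _) (RREF-V r))) (AllP.all⁻ _ (All.map (λ {x} → conv {x}) (RREF⇒PivotRows r))))
    where
    conv : ∀ {x} → PivotRow n C x → T _
    conv {c , row} (_ , one , lead , z) = T-∧⁺ {isOne (entry row c)} (isOne⁺ one)
      (T-∧⁺ {all (λ t → isZero (entry row t)) (range 1 (c ∸ 1))}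
        (AllP.all⁻ _ (All.tabulate λ {t} t∈ → let l , u = range-∈⁻ 1 (c ∸ 1) t∈ in isZero⁺ (lead t l (pred-lt u l))))
        (AllP.all⁻ _ (All.tabulate λ {c′} c′∈ → other c′ c′∈ (c′ ≟ c))))
      where
      pred-lt : ∀ {t c} → t ≤ c ∸ 1 → 1 ≤ t → t < c
      pred-lt {c = zero} z≤n ()
      pred-lt {c = suc c} u _ = s≤s u
      other : ∀ c′ → c′ ∈ C → Dec (c′ ≡ c) → T ((c′ ≡ᵇ c) ∨ isZero (entry row c′))
      other c′ c′∈ (yes e) = Equivalence.from (T-∨ {c′ ≡ᵇ c}) (inj₁ (≡⇒≡ᵇ _ _ e))
      other c′ c′∈ (no ne) = Equivalence.from (T-∨ {c′ ≡ᵇ c}) (inj₂ (isZero⁺ (z c′∈ ne)))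

  -- Restriction to a set of columns; families in a different order

  entries-⊕ : ∀ {p} v w D → length v ≡ p → length w ≡ p → map (entry (v ⊕ w)) D ≡ map (entry v) D ⊕ map (entry w) D
  entries-⊕ v w [] _ _ = refl
  entries-⊕ v w (d ∷ D) lv lw = cong₂ _∷_ (entry-⊕ v w d lv lw) (entries-⊕ v w D lv lw)

  entries-· : ∀ c v D → map (entry (c · v)) D ≡ c · map (entry v) D
  entries-· c v D = trans (map-cong (λ d → !-· c v (d ∸ 1)) D) (map-∘ {g = c *F_} {f = entry v} D)

  entries-𝟎 : ∀ p D → map (entry (𝟎 p)) D ≡ 𝟎 (length D)
  entries-𝟎 p [] = refl
  entries-𝟎 p (d ∷ D) = cong₂ _∷_ (!-𝟎 p (d ∸ 1)) (entries-𝟎 p D)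

  ⊕-assoc : ∀ u v w → (u ⊕ v) ⊕ w ≡ u ⊕ (v ⊕ w)
  ⊕-assoc [] _ _ = refl
  ⊕-assoc (_ ∷ _) [] _ = refl
  ⊕-assoc (_ ∷ _) (_ ∷ _) [] = refl
  ⊕-assoc (x ∷ u) (y ∷ v) (z ∷ w) = cong₂ _∷_ (R.+-assoc x y z) (⊕-assoc u v w)

  lincomb-↭ : ∀ {n vs ws} → V n vs → vs ↭ ws → ∀ cs → length cs ≡ length vs →
    ∃ λ ds → cs ↭ ds × lincomb n cs vs ≡ lincomb n ds ws
  lincomb-↭ h Perm.refl cs l = cs , Perm.refl , refl
  lincomb-↭ (_ ∷ h) (Perm.prep x p) (c ∷ cs) l with lincomb-↭ h p cs (suc-injective l)
  ... | ds , q , e = c ∷ ds , Perm.prep c q , cong (c · x ⊕_) e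
  lincomb-↭ (_ ∷ _ ∷ h) (Perm.swap x y p) (c ∷ d ∷ cs) l with lincomb-↭ h p cs (suc-injective (suc-injective l))
  ... | ds , q , e = d ∷ c ∷ ds , Perm.swap c d q ,
        trans (cong (λ u → c · x ⊕ (d · y ⊕ u)) e) (trans (sym (⊕-assoc (c · x) (d · y) _)) (trans (cong (_⊕ _) (⊕-comm (c · x) (d · y))) (⊕-assoc (d · y) (c · x) _)))
  lincomb-↭ h (Perm.trans p p′) cs l with lincomb-↭ h p cs l
  ... | ds , q , e with lincomb-↭ (PermP.All-resp-↭ p h) p′ ds (trans (sym (PermP.↭-length q)) (trans l (PermP.↭-length p)))
  ... | fs , q′ , e′ = fs , Perm.trans q q′ , trans e e′

  -- For the enumeration of the columns of X: a newly chosen column goes to the front of the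
  -- accumulator, whereas in the finished matrix it stands before the columns chosen after it.
  indep-↭ : ∀ {n vs ws} → V n vs → vs ↭ ws → Indep n vs → Indep n ws
  indep-↭ h p ind cs l e with lincomb-↭ (PermP.All-resp-↭ p h) (↭-sym p) cs l
  ... | ds , q , e′ = PermP.All-resp-↭ (↭-sym q) (ind ds (trans (sym (PermP.↭-length q)) (trans l (sym (PermP.↭-length p)))) (trans (sym e′) e))

  indep-++ʳ : ∀ {n} vs {ws} → V n (vs ++ ws) → Indep n (vs ++ ws) → Indep n ws
  indep-++ʳ [] h ind = ind
  indep-++ʳ (v ∷ vs) (l ∷ h) ind = indep-++ʳ vs h (indep-tail l h ind)

  -- Full-rank matrices with prescribed support

  Supported : List ℕ → ℕ → Vec → Set
  Supported C e = Pointwise (λ c a → c < e ⊎ a ≡ 0F) C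

  supported : List ℕ → ℕ → List Vec
  supported [] e = [ [] ]
  supported (c ∷ C) e =
    if c <ᵇ e then cartesianProductWith _∷_ elements (supported C e) else map (0F ∷_) (supported C e)

  supported⁺ : ∀ {C e x} → Supported C e x → x ∈ supported C e
  supported⁺ [] = here refl
  supported⁺ {c ∷ C} {e} {a ∷ x} (s ∷ ss) with c <ᵇ e in eq | s
  ... | true | _ = ∈-cartesianProductWith⁺ _∷_ (elements-complete a) (supported⁺ ss)
  ... | false | inj₂ refl = ∈-map⁺ (0F ∷_) (supported⁺ ss)
  ... | false | inj₁ l = ⊥-elim (subst T eq (<⇒<ᵇ l))

  supported⁻ : ∀ C e {x} → x ∈ supported C e → Supported C e x
  supported⁻ [] e (here refl) = []
  supported⁻ (c ∷ C) e p with c <ᵇ e in eq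
  ... | true with ∈-cartesianProductWith⁻ _∷_ elements (supported C e) p
  ... | a , x , _ , x∈ , refl = inj₁ (<ᵇ⇒< c e (subst T (sym eq) _)) ∷ supported⁻ C e x∈
  supported⁻ (c ∷ C) e p | false with ∈-map⁻ (0F ∷_) p
  ... | x , x∈ , refl = inj₂ refl ∷ supported⁻ C e x∈

  supported-Unique : ∀ C e → Unique (supported C e)
  supported-Unique [] e = [] ∷ []
  supported-Unique (c ∷ C) e with c <ᵇ e
  ... | true = UP.cartesianProductWith⁺ _∷_ (λ { refl → refl , refl }) elements-unique (supported-Unique C e)
  ... | false = UP.map⁺ ∷-injectiveʳ (supported-Unique C e)

  length-supported : ∀ C e → length (supported C e) ≡ q ^ below C e
  length-supported [] e = refl
  length-supported (c ∷ C) e with c <ᵇ e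
  ... | true = trans (length-cartesianProductWith _∷_ elements (supported C e)) (cong (q *_) (length-supported C e))
  ... | false = trans (length-map _ (supported C e)) (length-supported C e)

  Supported-IsSubspace : ∀ C e → IsSubspace (length C) (Supported C e)
  Supported-IsSubspace C e = record { 𝟎-closed = z C ; ⊕-closed = λ _ _ → a ; ·-closed = λ c _ → m c }
    where
    z : ∀ C → Supported C e (𝟎 (length C))
    z [] = []
    z (c ∷ C) = inj₂ refl ∷ z C
    a : ∀ {C v w} → Supported C e v → Supported C e w → Supported C e (v ⊕ w)
    a [] [] = []
    a (inj₁ l ∷ s) (_ ∷ s′) = inj₁ l ∷ a s s′
    a (inj₂ _ ∷ s) (inj₁ l ∷ s′) = inj₁ l ∷ a s s′
    a (inj₂ refl ∷ s) (inj₂ refl ∷ s′) = inj₂ (R.+-identityˡ 0F) ∷ a s s′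
    m : ∀ {C v} c → Supported C e v → Supported C e (c · v)
    m c [] = []
    m c (inj₁ l ∷ s) = inj₁ l ∷ m c s
    m c (inj₂ refl ∷ s) = inj₂ (R.zeroʳ c) ∷ m c s

  Supported-mono : ∀ {C e e′ x} → e < e′ → Supported C e x → Supported C e′ x
  Supported-mono l = PW.map λ { (inj₁ p) → inj₁ (<-trans p l) ; (inj₂ z) → inj₂ z }

  Supported-length : ∀ {C e x} → Supported C e x → length x ≡ length C
  Supported-length s = sym (PW.Pointwise-length s)

  -- acc holds the columns already chosen.
  outside : List ℕ → List Vec → ℕ → List Vec
  outside C acc e = filterᵇ (λ x → not (isYes (span? (length C) acc x))) (supported C e)

  columns : List ℕ → List Vec → List ℕ → List (List Vec)
  columns C acc [] = [ [] ]
  columns C acc (e ∷ es) = concatMap (λ x → map (x ∷_) (columns C (x ∷ acc) es)) (outside C acc e)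

  columns-Unique : ∀ C acc es → Unique (columns C acc es)
  columns-Unique C acc [] = [] ∷ []
  columns-Unique C acc (e ∷ es) = concatMap-Unique _ (filterᵇ-Unique _ (supported-Unique C e))
    (λ x → UP.map⁺ ∷-injectiveʳ (columns-Unique C (x ∷ acc) es))
    λ {x} {y} p p′ → ∷-injectiveˡ (trans (sym (proj₂ (proj₂ (∈-map⁻ (x ∷_) p)))) (proj₂ (proj₂ (∈-map⁻ (y ∷_) p′))))

  T-isYes⁺ : ∀ {P : Set} (d : Dec P) → P → T (isYes d)
  T-isYes⁺ (yes _) p = _
  T-isYes⁺ (no ¬p) p = ¬p p

  T-isYes⁻ : ∀ {P : Set} (d : Dec P) → T (isYes d) → P
  T-isYes⁻ (yes p) _ = p

  Supported-V : ∀ {C es X} → Pointwise (Supported C) es X → V (length C) X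
  Supported-V [] = []
  Supported-V (s ∷ ss) = Supported-length s ∷ Supported-V ss

  columns⁺ : ∀ {C acc es X} → V (length C) acc → Pointwise (Supported C) es X → Indep (length C) (X ++ acc) → X ∈ columns C acc es
  columns⁺ h [] ind = here refl
  columns⁺ {C} {acc} {e ∷ es} {x ∷ X} h (s ∷ ss) ind =
    ∈-concatMap⁺′ (λ x → map (x ∷_) (columns C (x ∷ acc) es))
      (∈-filterᵇ⁺ _ (supported⁺ s) (T-not⁺ λ y → indep-head lx (indep-++ʳ X hXx ind′) (T-isYes⁻ (span? _ acc x) y)))
      (∈-map⁺ (x ∷_) (columns⁺ (lx ∷ h) ss ind′))
    where
    lx : length x ≡ length C
    lx = Supported-length s
    hXx : V (length C) (X ++ x ∷ acc)
    hXx = AllP.++⁺ (Supported-V ss) (lx ∷ h)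
    ind′ : Indep (length C) (X ++ x ∷ acc)
    ind′ = indep-↭ (lx ∷ AllP.++⁺ (Supported-V ss) h) (↭-sym (PermP.shift x X acc)) ind

  columns⁻ : ∀ C acc es {X} → V (length C) acc → Indep (length C) acc → X ∈ columns C acc es →
    Pointwise (Supported C) es X × Indep (length C) (X ++ acc)
  columns⁻ C acc [] h ind (here refl) = [] , ind
  columns⁻ C acc (e ∷ es) h ind p with ∈-concatMap⁻′ (λ x → map (x ∷_) (columns C (x ∷ acc) es)) (outside C acc e) p
  ... | x , x∈ , p′ with ∈-map⁻ (x ∷_) p′ | ∈-filterᵇ⁻ (λ x → not (isYes (span? (length C) acc x))) (supported C e) x∈
  ... | X , X∈ , refl | x∈s , t with supported⁻ C e x∈s
  ... | s with columns⁻ C (x ∷ acc) es (Supported-length s ∷ h)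
                 (indep-∷ (Supported-length s) h ind (λ y → T-not⁻ t (T-isYes⁺ (span? (length C) acc x) y))) X∈
  ... | ss , ind′ = s ∷ ss , indep-↭ (AllP.++⁺ (Supported-V ss) (Supported-length s ∷ h)) (PermP.shift x X acc) ind′

  -- The support is a subspace containing the chosen columns, hence their whole span. All q^k
  -- vectors of that span are thus among the candidates, and exactly these are removed.
  length-outside : ∀ {C acc e} → V (length C) acc → Indep (length C) acc → All (Supported C e) acc →
    length (outside C acc e) ≡ q ^ below C e ∸ q ^ length acc
  length-outside {C} {acc} {e} h ind s =
    trans (length-filterᵇ-not inside (supported C e)) (cong₂ _∸_ (length-supported C e)
      (trans (Unique-≈⇒length≡ (filterᵇ-Unique inside (supported-Unique C e)) (lincombs-Unique h ind)
         (λ p → ∈-lincombs⁺ (T-isYes⁻ (span? _ acc _) (proj₂ (∈-filterᵇ⁻ inside (supported C e) p))))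
         (λ {v} p → let sp = ∈-lincombs⁻ acc p in
            ∈-filterᵇ⁺ inside (supported⁺ (span-min h (Supported-IsSubspace C e) s sp)) (T-isYes⁺ (span? _ acc v) sp)))
        (length-lincombs (length C) acc)))
    where
    inside : Vec → Bool
    inside x = isYes (span? (length C) acc x)

  -- The invariant is that the chosen columns satisfy every later support condition. A new column
  -- keeps it because the thresholds increase, which only enlarges the supports.
  length-columns : ∀ {C} acc es → V (length C) acc → Indep (length C) acc → Increasing es →
    All (λ e → All (Supported C e) acc) es → length (columns C acc es) ≡ columnCount q C (length acc) es
  length-columns acc [] h ind i s = refl
  length-columns {C} acc (e ∷ es) h ind (e< ∷ i) (s ∷ ss) =
    trans (length-concatMap-const _ (columnCount q C (suc (length acc)) es) (outside C acc e) each)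
          (cong (_* columnCount q C (suc (length acc)) es) (length-outside h ind s))
    where
    each : ∀ {x} → x ∈ outside C acc e → length (map (x ∷_) (columns C (x ∷ acc) es)) ≡ columnCount q C (suc (length acc)) es
    each {x} x∈ with ∈-filterᵇ⁻ (λ x → not (isYes (span? (length C) acc x))) (supported C e) x∈
    ... | x∈s , t with supported⁻ C e x∈s
    ... | sx = trans (length-map (x ∷_) (columns C (x ∷ acc) es)) (length-columns (x ∷ acc) es (Supported-length sx ∷ h)
          (indep-∷ (Supported-length sx) h ind (λ y → T-not⁻ t (T-isYes⁺ (span? (length C) acc x) y))) i
          (All.zipWith (λ (l , a) → Supported-mono l sx ∷ a) (e< , ss)))

  -- Products of a full-rank matrix with an echelon basis

  SupportedRows : List ℕ → List ℕ → List Vec → Set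
  SupportedRows C E = Pointwise (λ c → Pointwise (λ t a → c < t ⊎ a ≡ 0F) E) C

  -- The matrix X N as a list of rows. The number `m` of rows is a parameter, since a matrix without
  -- columns does not determine it; this is the case U = 0.
  product-rows : ℕ → ℕ → List Vec → List Vec → List Vec
  product-rows m p X N = map (λ a → lincomb p a N) (rowsOf m X)

  pointwise-nthD⁺ : ∀ {A B : Set} {_~_ : A → B → Set} (d : A) (e : B) {xs ys} → length xs ≡ length ys →
    (∀ i → i < length xs → nthD d xs i ~ nthD e ys i) → Pointwise _~_ xs ys
  pointwise-nthD⁺ d e {[]} {[]} l h = []
  pointwise-nthD⁺ d e {x ∷ xs} {y ∷ ys} l h = h 0 (s≤s z≤n) ∷ pointwise-nthD⁺ d e (suc-injective l) λ i p → h (suc i) (s≤s p)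

  pointwise-nthD⁻ : ∀ {A B : Set} {_~_ : A → B → Set} (d : A) (e : B) {xs ys} → Pointwise _~_ xs ys →
    ∀ i → i < length xs → nthD d xs i ~ nthD e ys i
  pointwise-nthD⁻ d e (h ∷ hs) zero l = h
  pointwise-nthD⁻ d e (h ∷ hs) (suc i) (s≤s l) = pointwise-nthD⁻ d e hs i l

  pivotColumns : List ℕ → List Vec → List Vec
  pivotColumns D B = map (λ d → map (λ b → entry b d) B) D

  select : List ℕ → List ℕ → List ℕ
  select E D = map (λ d → nthD 0 E (d ∸ 1)) D

  supported-pivotColumns : ∀ {C E B} → SupportedRows C E B → ∀ {D} → All (λ d → 1 ≤ d × d ≤ length E) D →
    Pointwise (Supported C) (select E D) (pivotColumns D B)
  supported-pivotColumns s [] = []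
  supported-pivotColumns {C} {E} {B} s {suc d ∷ D} ((_ , l) ∷ a) = column s ∷ supported-pivotColumns s a
    where
    column : ∀ {C B} → SupportedRows C E B → Supported C (nthD 0 E d) (map (_! d) B)
    column [] = []
    column (r ∷ rs) = pointwise-nthD⁻ 0 0F r d l ∷ column rs

  -- A nonzero term would need c < φ(d) from the support of X and d at most the current column from
  -- the leading zeros of N. Since φ is increasing, c would lie below φ of the current column, which
  -- is excluded.
  product-entry-zero : ∀ {n D N E a c t} → RREF n D N → Increasing E → length E ≡ n → All (λ d → 1 ≤ d × d ≤ n) D →
    Pointwise (λ e x → c < e ⊎ x ≡ 0F) (select E D) a → t < n → ¬ c < nthD 0 E t → dot a (map (_! t) N) ≡ 0F
  product-entry-zero [] i l [] [] t< c≮ = refl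
  product-entry-zero {n} {suc d ∷ D} {row ∷ N} {E} {x ∷ a} {c} {t} (pivot _ _ lead _ _ r) i l ((_ , d<n) ∷ sub) (s ∷ ss) t< c≮ =
    trans (cong₂ _+F_ (head s) (product-entry-zero r i l sub ss t< c≮)) (R.+-identityˡ 0F)
    where
    head : c < nthD 0 E d ⊎ x ≡ 0F → x *F row ! t ≡ 0F
    head (inj₂ refl) = R.zeroˡ _
    head (inj₁ c<) with <-cmp t d
    ... | tri< t<d _ _ = trans (cong (x *F_) (lead (suc t) (s≤s z≤n) (s≤s t<d))) (R.zeroʳ x)
    ... | tri≈ _ refl _ = ⊥-elim (c≮ c<)
    ... | tri> _ _ d<t = ⊥-elim (c≮ (<-trans c< (nthD-< i d<t (subst (t <_) (sym l) t<))))

  supported-row : ∀ {C es X} → Pointwise (Supported C) es X → ∀ i → i < length C →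
    Pointwise (λ e x → nthD 0 C i < e ⊎ x ≡ 0F) es (map (_! i) X)
  supported-row [] i l = []
  supported-row (s ∷ ss) i l = pointwise-nthD⁻ 0 0F s i l ∷ supported-row ss i l

  nthD-rowsOf : ∀ m X i → i < m → nthD [] (rowsOf m X) i ≡ map (_! i) X
  nthD-rowsOf m X i l = nthD-applyUpTo [] (λ i → map (_! i) X) l

  nthD-product-rows : ∀ m p X N i → i < m → nthD [] (product-rows m p X N) i ≡ lincomb p (map (_! i) X) N
  nthD-product-rows m p X N i l =
    trans (nthD-map< (λ a → lincomb p a N) [] [] (rowsOf m X) (subst (i <_) (sym (length-applyUpTo (λ i → map (_! i) X) m)) l))
          (cong (λ a → lincomb p a N) (nthD-rowsOf m X i l))

  length-product-rows : ∀ m p X N → length (product-rows m p X N) ≡ m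
  length-product-rows m p X N = trans (length-map _ (rowsOf m X)) (length-applyUpTo _ m)

  V-product-rows : ∀ m {p} X {N} → V p N → V p (product-rows m p X N)
  V-product-rows m X h = AllP.map⁺ (All.tabulate λ {a} _ → length-lincomb a h)

  supported-product : ∀ {C E p D N X} → RREF p D N → Increasing E → length E ≡ p → All (λ d → 1 ≤ d × d ≤ p) D →
    Pointwise (Supported C) (select E D) X → SupportedRows C E (product-rows (length C) p X N)
  supported-product {C} {E} {p} {D} {N} {X} r i lE a s =
    pointwise-nthD⁺ 0 [] (sym (length-product-rows (length C) p X N)) λ k k< →
      subst (Pointwise _ E) (sym (nthD-product-rows (length C) p X N k k<)) (row k k<)
    where
    row : ∀ k → k < length C → Pointwise (λ t x → nthD 0 C k < t ⊎ x ≡ 0F) E (lincomb p (map (_! k) X) N)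
    row k k< = pointwise-nthD⁺ 0 0F (trans lE (sym (length-lincomb (map (_! k) X) (RREF-V r)))) λ t t< → at t t<
      where
      at : ∀ t → t < length E → nthD 0 C k < nthD 0 E t ⊎ lincomb p (map (_! k) X) N ! t ≡ 0F
      at t t< with nthD 0 C k <? nthD 0 E t
      ... | yes c< = inj₁ c<
      ... | no c≮ = inj₂ (trans (lincomb-! (map (_! k) X) (RREF-V r) t)
              (product-entry-zero r i lE a (supported-row s k k<) (subst (t <_) lE t<) c≮))

  -- The factorisation B = X N into pivot columns and echelon basis

  product-pivotColumns : ∀ {p D N B} → RREF p D N → All (Span p N) B →
    product-rows (length B) p (pivotColumns D B) N ≡ B
  product-pivotColumns {p} {D} {N} {B} r s = nthD-ext [] (length-product-rows (length B) p _ N) λ i i< →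
    let i<′ = subst (i <_) (length-product-rows (length B) p _ N) i< in
    trans (nthD-product-rows (length B) p (pivotColumns D B) N i i<′)
    (trans (cong (λ u → lincomb p u N) (trans (sym (map-∘ D)) (map-cong (λ d → nthD-map< (λ b → entry b d) [] 0F B i<′) D)))
           (rref-span r (All.lookup s (nthD-∈ [] B i<′))))

  pivotColumns-product : ∀ {m p D N X} → RREF p D N → V m X → length X ≡ length D →
    pivotColumns D (product-rows m p X N) ≡ X
  pivotColumns-product {m} {p} {D} {N} {X} r h l = columns-ext (AllP.map⁺ (All.tabulate λ {d} _ →
       trans (length-map _ B) (length-product-rows m p X N))) h (trans (length-map _ D) (sym l)) λ i i< →
    trans (sym (map-∘ D)) (trans (map-cong (λ d → trans (nthD-map< (λ b → entry b d) [] 0F B (subst (i <_) (sym (length-product-rows m p X N)) i<))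
        (cong (λ u → entry u d) (nthD-product-rows m p X N i i<))) D)
      (rref-coefficients r (map (_! i) X) (trans (length-map _ X) l)))
    where
    B = product-rows m p X N
    columns-ext : ∀ {X Y} → V m X → V m Y → length X ≡ length Y → (∀ i → i < m → map (_! i) X ≡ map (_! i) Y) → X ≡ Y
    columns-ext [] [] _ _ = refl
    columns-ext (lx ∷ hX) (ly ∷ hY) e f =
      cong₂ _∷_ (nthD-ext 0F (trans lx (sym ly)) λ i i< → ∷-injectiveˡ (f i (subst (i <_) lx i<)))
                (columns-ext hX hY (suc-injective e) λ i i< → ∷-injectiveʳ (f i i<))

  product-rows-span : ∀ {p N} m X → V p N → length X ≡ length N → All (Span p N) (product-rows m p X N)
  product-rows-span m X h l = AllP.map⁺ (AllP.applyUpTo⁺₂ _ m λ i → map (_! i) X , trans (length-map _ X) l , refl)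

  -- By full column rank the rows of X span all coefficient vectors, and a ↦ a N is linear. So every
  -- combination of the rows of N is one of the rows of X N.
  span-product-rows : ∀ {m p X N} → V m X → Indep m X → V p N → length X ≡ length N →
    All (Span p (product-rows m p X N)) N
  span-product-rows {m} {p} {X} {N} hX ind hN l = All.tabulate λ v∈ → go (span-∈ hN v∈)
    where
    hB : V p (product-rows m p X N)
    hB = V-product-rows m X hN
    S : IsSubspace (length X) (λ a → length a ≡ length X × Span p (product-rows m p X N) (lincomb p a N))
    S .IsSubspace.𝟎-closed = length-replicate _ ,
      subst (Span p _) (sym (lincomb-𝟎 (length X) hN)) (IsSubspace.𝟎-closed (Span-IsSubspace hB))
    S .IsSubspace.⊕-closed {v} {w} lv lw (_ , s) (_ , t) = length-⊕ v w lv lw ,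
      subst (Span p _) (sym (lincomb-⊕ v w hN (trans lv (sym lw))))
        (IsSubspace.⊕-closed (Span-IsSubspace hB) (length-lincomb v hN) (length-lincomb w hN) s t)
    S .IsSubspace.·-closed c {v} lv (_ , s) = trans (length-map _ v) lv ,
      subst (Span p _) (sym (lincomb-· c v hN)) (IsSubspace.·-closed (Span-IsSubspace hB) c (length-lincomb v hN) s)
    go : ∀ {v} → Span p N v → Span p (product-rows m p X N) v
    go (a , la , refl) = proj₂ (span-min {v = a} (V-rowsOf m X) S
       (All.tabulate λ {b} b∈ → All.lookup (V-rowsOf m X) b∈ , span-∈ hB (∈-map⁺ (λ a → lincomb p a N) b∈))
       (rows-span hX ind (trans la (sym l))))

  -- X has a left inverse because the rows of N lie in the row space of B = X N.
  indep-pivotColumns : ∀ {p D N B} → RREF p D N → V p B → All (Span p B) N → Indep (length B) (pivotColumns D B)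
  -- Let X y = 0. Then y is orthogonal to the pivot entries of each row of B, hence to those of
  -- every vector in its row space. That space contains the combinations of N, whose pivot entries
  -- are arbitrary, so y = 0.
  indep-pivotColumns {p} {D} {N} {B} r hB t y ly e = dot-nondegenerate y λ cs lcs →
    trans (dot-comm y cs (sym lcs)) (trans (cong (λ u → dot u y) (sym (rref-coefficients r cs (trans lcs ly′))))
      (span-min hB S (All.tabulate λ b∈ → let i , i< , e′ = ∈-nthD [] b∈ in subst (λ b → dot (map (entry b) D) y ≡ 0F) e′ (at i i<))
        (span-trans hB t (lincomb-closed (RREF-V r) (Span-IsSubspace (RREF-V r)) (All-span (RREF-V r)) cs))))
    where
    ly′ : length y ≡ length D
    ly′ = trans ly (length-map _ D)
    hX : V (length B) (pivotColumns D B)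
    hX = AllP.map⁺ (All.tabulate λ _ → length-map _ B)
    dot-nondegenerate : ∀ y → (∀ cs → length cs ≡ length y → dot y cs ≡ 0F) → All (_≡ 0F) y
    dot-nondegenerate [] h = []
    dot-nondegenerate (a ∷ y) h =
      trans (sym (trans (cong₂ _+F_ (R.*-identityʳ a) (dot-𝟎ʳ y (All-𝟎 (length y)))) (R.+-identityʳ a)))
            (h (1F ∷ 𝟎 (length y)) (cong suc (length-replicate _)))
      ∷ dot-nondegenerate y λ cs l → trans (sym (trans (cong (_+F dot y cs) (R.zeroʳ a)) (R.+-identityˡ _))) (h (0F ∷ cs) (cong suc l))
    S : IsSubspace p (λ v → dot (map (entry v) D) y ≡ 0F)
    S .IsSubspace.𝟎-closed = trans (cong (λ u → dot u y) (entries-𝟎 p D)) (dot-𝟎ˡ (length D) y)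
    S .IsSubspace.⊕-closed {v} {w} lv lw s s′ = trans (cong (λ u → dot u y) (entries-⊕ v w D lv lw))
       (trans (dot-⊕ (map (entry v) D) (map (entry w) D) y (trans (length-map _ D) (sym (length-map _ D)))) (trans (cong₂ _+F_ s s′) (R.+-identityˡ 0F)))
    S .IsSubspace.·-closed c {v} lv s = trans (cong (λ u → dot u y) (entries-· c v D))
       (trans (dot-· c (map (entry v) D) y) (trans (cong (c *F_) s) (R.zeroʳ c)))
    at : ∀ i → i < length B → dot (map (entry (nthD [] B i)) D) y ≡ 0F
    at i i< = trans (dot-comm _ y (trans (length-map _ D) (sym ly′)))
      (trans (cong (dot y) (trans (map-cong (λ d → sym (nthD-map< (λ b → entry b d) [] 0F B i<)) D) (map-∘ D)))
      (trans (sym (lincomb-! y hX i)) (trans (cong (_! i) e) (!-𝟎 (length B) i))))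

  -- The complement of the pivot set

  module _ (n : ℕ) {C : List ℕ} (sub : Subset[ n ] C) where

    private
      E = complementIn n C
      keep : ℕ → Bool
      keep t = not (any (t ≡ᵇ_) C)

    ∈-complement⁻ : ∀ {t} → t ∈ E → (1 ≤ t × t ≤ n) × t ∉ C
    ∈-complement⁻ {t} t∈ with ∈-filterᵇ⁻ keep (range 1 n) t∈
    ... | t∈r , k = range-∈⁻ 1 n t∈r , λ t∈C → All.lookup (T-not-any⁻ (t ≡ᵇ_) C k) t∈C (≡⇒≡ᵇ t t refl)

    ∈-complement⁺ : ∀ {t} → 1 ≤ t → t ≤ n → t ∉ C → t ∈ E
    ∈-complement⁺ {t} l u t∉ = ∈-filterᵇ⁺ keep (range-∈⁺ 1 n l u)
      (T-not-any⁺ (t ≡ᵇ_) (All.tabulate λ {c} c∈ e → t∉ (subst (_∈ C) (sym (≡ᵇ⇒≡ t c e)) c∈)))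

    complement-Increasing : Increasing E
    complement-Increasing = APP.filter⁺ (T? ∘ keep) (range-Increasing 1 n)

    length-complement : length E ≡ n ∸ length C
    length-complement = sym (trans (cong (_∸ length C) (trans (sym (length-applyUpTo (1 +_) n)) (sym total))) (m+n∸m≡n (length C) (length E)))
      where
      total : length C + length E ≡ length (range 1 n)
      total = trans (sym (length-++ C)) (Unique-≈⇒length≡
        (UP.++⁺ (Increasing⇒Unique (proj₁ sub)) (Increasing⇒Unique complement-Increasing) λ (p , q) → proj₂ (∈-complement⁻ q) p)
        (Increasing⇒Unique (range-Increasing 1 n))
        (λ p → [ (λ c∈ → let l , u = All.lookup (proj₂ sub) c∈ in range-∈⁺ 1 n l u)
               , (λ t∈ → let l , u = proj₁ (∈-complement⁻ t∈) in range-∈⁺ 1 n l u) ]′ (∈-++⁻ C p))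
        λ {t} p → let l , u = range-∈⁻ 1 n p in case t ∈? C of λ
          { (yes t∈) → ∈-++⁺ˡ t∈ ; (no t∉) → ∈-++⁺ʳ C (∈-complement⁺ l u t∉) })

  -- Krylov spaces of diagonal matrices

  krylov : List Carrier → List Vec → ℕ → List Vec
  krylov δ M j = concatMap (λ i → map (iter i (applyDiag δ)) M) (upTo j)

  ∈-krylov⁺ : ∀ {δ M i j r} → i < j → r ∈ M → iter i (applyDiag δ) r ∈ krylov δ M j
  ∈-krylov⁺ {δ} {M} {i} i< r∈ = ∈-concatMap⁺′ (λ i → map (iter i (applyDiag δ)) M) (∈-upTo⁺ i<) (∈-map⁺ (iter i (applyDiag δ)) r∈)

  ∈-krylov⁻ : ∀ δ M j {v} → v ∈ krylov δ M j → ∃₂ λ i r → i < j × r ∈ M × v ≡ iter i (applyDiag δ) r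
  ∈-krylov⁻ δ M j p with ∈-concatMap⁻′ (λ i → map (iter i (applyDiag δ)) M) (upTo j) p
  ... | i , i∈ , p′ with ∈-map⁻ (iter i (applyDiag δ)) p′
  ... | r , r∈ , e = i , r , ∈-upTo⁻ i∈ , r∈ , e

  iter-suc : ∀ {A : Set} i (f : A → A) x → iter (suc i) f x ≡ iter i f (f x)
  iter-suc zero f x = refl
  iter-suc (suc i) f x = cong f (iter-suc i f x)

  module Diagonal {n : ℕ} (δ : List Carrier) (lδ : length δ ≡ n) where

    Δ : Vec → Vec
    Δ = applyDiag δ

    length-Δ : ∀ v → length v ≡ n → length (Δ v) ≡ n
    length-Δ v l = trans (length-zipWith _*F_ δ v) (trans (cong₂ _⊓_ lδ l) (⊓-idem n))

    !-Δ : ∀ v i → length v ≡ n → Δ v ! i ≡ δ ! i *F v ! i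
    !-Δ v i l = go δ v i (trans lδ (sym l))
      where
      go : ∀ δ v i → length δ ≡ length v → zipWith _*F_ δ v ! i ≡ δ ! i *F v ! i
      go [] [] i e = sym (R.zeroʳ 0F)
      go (x ∷ δ) (y ∷ v) zero e = refl
      go (x ∷ δ) (y ∷ v) (suc i) e = go δ v i (suc-injective e)

    Δ-⊕ : ∀ v w → length v ≡ n → length w ≡ n → Δ (v ⊕ w) ≡ Δ v ⊕ Δ w
    Δ-⊕ v w lv lw = vec-ext (trans (length-Δ (v ⊕ w) lvw) (sym (length-⊕ (Δ v) (Δ w) (length-Δ v lv) (length-Δ w lw)))) λ i →
      trans (!-Δ (v ⊕ w) i lvw) (trans (cong (δ ! i *F_) (!-⊕ v w i (trans lv (sym lw))))
      (trans (R.distribˡ _ _ _) (trans (cong₂ _+F_ (sym (!-Δ v i lv)) (sym (!-Δ w i lw)))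
      (sym (!-⊕ (Δ v) (Δ w) i (trans (length-Δ v lv) (sym (length-Δ w lw))))))))
      where
      lvw : length (v ⊕ w) ≡ n
      lvw = length-⊕ v w lv lw

    Δ-· : ∀ c v → length v ≡ n → Δ (c · v) ≡ c · Δ v
    Δ-· c v lv = vec-ext (trans (length-Δ (c · v) lcv) (sym (trans (length-map _ (Δ v)) (length-Δ v lv)))) λ i →
      trans (!-Δ (c · v) i lcv) (trans (cong (δ ! i *F_) (!-· c v i)) (trans (x∙yz≈y∙xz (δ ! i) c (v ! i))
      (trans (cong (c *F_) (sym (!-Δ v i lv))) (sym (!-· c (Δ v) i)))))
      where
      open CommProps (CommutativeRing.*-commutativeSemigroup commutativeRing) using (x∙yz≈y∙xz)
      lcv : length (c · v) ≡ n
      lcv = trans (length-map _ v) lv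

    length-iter : ∀ i v → length v ≡ n → length (iter i Δ v) ≡ n
    length-iter zero v l = l
    length-iter (suc i) v l = length-Δ (iter i Δ v) (length-iter i v l)

    iter-⊕ : ∀ i v w → length v ≡ n → length w ≡ n → iter i Δ (v ⊕ w) ≡ iter i Δ v ⊕ iter i Δ w
    iter-⊕ zero v w _ _ = refl
    iter-⊕ (suc i) v w lv lw = trans (cong Δ (iter-⊕ i v w lv lw)) (Δ-⊕ (iter i Δ v) (iter i Δ w) (length-iter i v lv) (length-iter i w lw))

    iter-· : ∀ i c v → length v ≡ n → iter i Δ (c · v) ≡ c · iter i Δ v
    iter-· zero c v _ = refl
    iter-· (suc i) c v lv = trans (cong Δ (iter-· i c v lv)) (Δ-· c (iter i Δ v) (length-iter i v lv))

    iter-𝟎 : ∀ i → iter i Δ (𝟎 n) ≡ 𝟎 n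
    iter-𝟎 zero = refl
    iter-𝟎 (suc i) = trans (cong Δ (iter-𝟎 i)) (vec-ext (trans (length-Δ (𝟎 n) l) (sym l)) λ k →
      trans (!-Δ (𝟎 n) k l) (trans (cong (δ ! k *F_) (!-𝟎 n k)) (trans (R.zeroʳ _) (sym (!-𝟎 n k)))))
      where
      l : length (𝟎 n) ≡ n
      l = length-replicate n

    V-krylov : ∀ {M} → V n M → ∀ j → V n (krylov δ M j)
    V-krylov {M} h j = All.tabulate λ p → case ∈-krylov⁻ δ M j p of λ
      { (i , r , _ , r∈ , refl) → length-iter i r (All.lookup h r∈) }

    iter-preimage : ∀ {P} → IsSubspace n P → ∀ i → IsSubspace n (P ∘ iter i Δ)
    iter-preimage {P} S i .IsSubspace.𝟎-closed = subst P (sym (iter-𝟎 i)) (IsSubspace.𝟎-closed S)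
    iter-preimage {P} S i .IsSubspace.⊕-closed {v} {w} lv lw p q =
      subst P (sym (iter-⊕ i v w lv lw)) (IsSubspace.⊕-closed S (length-iter i v lv) (length-iter i w lw) p q)
    iter-preimage {P} S i .IsSubspace.·-closed c {v} lv p =
      subst P (sym (iter-· i c v lv)) (IsSubspace.·-closed S c (length-iter i v lv) p)

    krylov-mono : ∀ {M M′} → V n M → All (Span n M) M′ → ∀ j → All (Span n (krylov δ M j)) (krylov δ M′ j)
    krylov-mono {M} {M′} h s j = All.tabulate λ p → case ∈-krylov⁻ δ M′ j p of λ
      { (i , r , i< , r∈ , refl) → span-min h (iter-preimage (Span-IsSubspace (V-krylov h j)) i)
          (All.tabulate λ m∈ → span-∈ (V-krylov h j) (∈-krylov⁺ i< m∈)) (All.lookup s r∈) }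

    krylovDim-cong : ∀ {M M′} → V n M → V n M′ → All (Span n M) M′ → All (Span n M′) M → ∀ j →
      krylovDim n δ M j ≡ krylovDim n δ M′ j
    krylovDim-cong h h′ s s′ j = dimSpan-cong (V-krylov h j) (V-krylov h′ j) (krylov-mono h s j) (krylov-mono h′ s′ j)

    krylovDim-1 : ∀ {M bs} → V n M → Basis n M bs → krylovDim n δ M 1 ≡ length bs
    krylovDim-1 {M} h B = dimSpan-basis (V-krylov h 1) (subst (λ L → Basis n L _) (sym (trans (++-identityʳ _) (map-id M))) B)

    hasProfile-cong : ∀ {M M′} → V n M → V n M′ → All (Span n M) M′ → All (Span n M′) M → ∀ μ →
      hasProfile n δ M μ ≡ hasProfile n δ M′ μ
    hasProfile-cong h h′ s s′ μ = cong₂ _∧_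
      (cong and (map-cong (λ j → cong (_≡ᵇ sum (take j μ)) (krylovDim-cong h h′ s s′ j)) (range 1 (length μ))))
      (cong₂ _≡ᵇ_ (krylovDim-cong h h′ s s′ (length μ)) (krylovDim-cong h h′ s s′ (suc (length μ))))

  krylovDim-0 : ∀ n δ M → krylovDim n δ M 0 ≡ 0
  krylovDim-0 n δ M = dimSpan-basis {n} {[]} {[]} [] record { indep = indep-[] ; spans = [] ; spanned = [] }

  -- For empty ν the only remaining condition equates the Krylov dimensions of orders 0 and 1, which
  -- forces the zero subspace; this matches μ₂ = 0.
  hasProfile-rank : ∀ {n δ M} ν → T (hasProfile n δ M ν) → krylovDim n δ M 1 ≡ headOr0 ν
  hasProfile-rank {n} {δ} {M} [] t = sym (trans (sym (krylovDim-0 n δ M)) (≡ᵇ⇒≡ _ _ t))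
  hasProfile-rank {n} {δ} {M} (a ∷ ν) t =
    trans (≡ᵇ⇒≡ _ _ (All.head (AllP.all⁺ dim≡ (range 1 (suc (length ν))) (proj₁ (T-∧⁻ {all dim≡ (range 1 (suc (length ν)))} t))))) (+-identityʳ a)
    where
    dim≡ : ℕ → Bool
    dim≡ j = krylovDim n δ M j ≡ᵇ sum (take j (a ∷ ν))

  -- Deleting the pivot columns

  module Reduction (n : ℕ) (δ : List Carrier) (lδ : length δ ≡ n) (Uδ : Unique δ) {C : List ℕ} (sub : Subset[ n ] C) where

    open Diagonal {n} δ lδ public

    E : List ℕ
    E = complementIn n C

    p : ℕ
    p = n ∸ length C

    lE : length E ≡ p
    lE = length-complement n sub

    δ′ : List Carrier
    δ′ = restrictDiag n δ C

    lδ′ : length δ′ ≡ p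
    lδ′ = trans (length-map _ E) lE

    UC : Unique C
    UC = Increasing⇒Unique (proj₁ sub)

    π : Vec → Vec
    π v = map (entry v) E

    length-π : ∀ v → length (π v) ≡ p
    length-π v = trans (length-map _ E) lE

    π-Δ : ∀ v → length v ≡ n → π (Δ v) ≡ applyDiag δ′ (π v)
    π-Δ v l = go E
      where
      go : ∀ D → map (entry (Δ v)) D ≡ zipWith _*F_ (map (entry δ) D) (map (entry v) D)
      go [] = refl
      go (d ∷ D) = cong₂ _∷_ (!-Δ v (d ∸ 1) l) (go D)

    π-iter : ∀ i v → length v ≡ n → π (iter i Δ v) ≡ iter i (applyDiag δ′) (π v)
    π-iter zero v l = refl
    π-iter (suc i) v l = trans (π-Δ (iter i Δ v) (length-iter i v l)) (cong (applyDiag δ′) (π-iter i v l))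

    π-lincomb : ∀ cs {vs} → V n vs → π (lincomb n cs vs) ≡ lincomb p cs (map π vs)
    π-lincomb [] h = trans (entries-𝟎 n E) (cong 𝟎 lE)
    π-lincomb (c ∷ cs) [] = trans (entries-𝟎 n E) (cong 𝟎 lE)
    π-lincomb (c ∷ cs) {v ∷ vs} (l ∷ h) = trans (entries-⊕ (c · v) (lincomb n cs vs) E (trans (length-map _ v) l) (length-lincomb cs h))
      (cong₂ _⊕_ (entries-· c v E) (π-lincomb cs h))

    π-span : ∀ {vs v} → V n vs → Span n vs v → Span p (map π vs) (π v)
    π-span {vs} h (cs , l , refl) = cs , trans l (sym (length-map π vs)) , sym (π-lincomb cs h)

    Vanishes : Vec → Set
    Vanishes v = All (λ c → entry v c ≡ 0F) C

    zero-at-IsSubspace : ∀ c → IsSubspace n (λ v → entry v c ≡ 0F)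
    zero-at-IsSubspace c .IsSubspace.𝟎-closed = !-𝟎 n (c ∸ 1)
    zero-at-IsSubspace c .IsSubspace.⊕-closed {v} {w} lv lw z z′ =
      trans (entry-⊕ v w c lv lw) (trans (cong₂ _+F_ z z′) (R.+-identityˡ 0F))
    zero-at-IsSubspace c .IsSubspace.·-closed a {v} _ z = trans (!-· a v (c ∸ 1)) (trans (cong (a *F_) z) (R.zeroʳ a))

    vanishes-span : ∀ {vs v} → V n vs → All Vanishes vs → Span n vs v → Vanishes v
    vanishes-span h z s = All.tabulate λ {c} c∈ → span-min h (zero-at-IsSubspace c) (All.map (λ a → All.lookup a c∈) z) s

    vec-ext-range : ∀ {v w} → length v ≡ n → length w ≡ n → (∀ {t} → 1 ≤ t → t ≤ n → entry v t ≡ entry w t) → v ≡ w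
    vec-ext-range lv lw h = nthD-ext 0F (trans lv (sym lw)) λ i i< → h {suc i} (s≤s z≤n) (subst (i <_) lv i<)

    π-injective : ∀ {v} → length v ≡ n → Vanishes v → π v ≡ 𝟎 p → v ≡ 𝟎 n
    π-injective {v} lv z e = vec-ext-range lv (length-replicate n) λ {t} l u → trans (vanish t l u) (sym (!-𝟎 n (t ∸ 1)))
      where
      vanish : ∀ t → 1 ≤ t → t ≤ n → entry v t ≡ 0F
      vanish t l u with t ∈? C
      ... | yes t∈ = All.lookup z t∈
      ... | no t∉ = All.lookup (AllP.map⁻ (subst (All (_≡ 0F)) (sym e) (All-𝟎 p))) (∈-complement⁺ n sub l u t∉)

    -- Deleting the columns of C loses nothing on vectors that vanish there, so dimensions survive
    -- the deletion.
    π-basis : ∀ {vs bs} → V n vs → V n bs → All Vanishes bs → Basis n vs bs → Basis p (map π vs) (map π bs)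
    π-basis {vs} {bs} h hb z B = record
      { indep = λ cs l e → Basis.indep B cs (trans l (length-map π bs)) (π-injective (length-lincomb cs hb)
          (vanishes-span hb z (lincomb-closed hb (Span-IsSubspace hb) (All-span hb) cs)) (trans (π-lincomb cs hb) e))
      ; spans = AllP.map⁺ (All.map (π-span hb) (Basis.spans B))
      ; spanned = AllP.map⁺ (All.map (π-span h) (Basis.spanned B)) }

    shear : ℕ → Vec → Vec
    shear c v = Δ v ⊕ (-F entry δ c) · v

    length-shear : ∀ c v → length v ≡ n → length (shear c v) ≡ n
    length-shear c v l = length-⊕ (Δ v) _ (length-Δ v l) (trans (length-map _ v) l)

    entry-shear : ∀ c v t → length v ≡ n → entry (shear c v) t ≡ (entry δ t +F (-F entry δ c)) *F entry v t
    entry-shear c v t l = trans (entry-⊕ (Δ v) _ t (length-Δ v l) (trans (length-map _ v) l))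
      (trans (cong₂ _+F_ (!-Δ v (t ∸ 1) l) (!-· _ v (t ∸ 1))) (sym (R.distribʳ _ _ _)))

    Δ-shear : ∀ c v → length v ≡ n → Δ v ≡ entry δ c · v ⊕ shear c v
    Δ-shear c v l = sym (·⊕-cancel (entry δ c) v (Δ v) l (length-Δ v l))

    shears : List Vec → List Vec
    shears M = zipWith shear C M

    reduce : List Vec → List Vec
    reduce M = map π (shears M)

    module _ {M : List Vec} (r : RREF n C M) where

      private
        hM : V n M
        hM = RREF-V r
        row-of : ∀ {c v} → (c , v) ∈ zip C M → PivotRow n C (c , v)
        row-of q = All.lookup (RREF⇒PivotRows r) q
        hS : V n (shears M)
        hS = All.tabulate λ q → case ∈-zipWith⁻ shear C M q of λ { (c , v , q′ , refl) → length-shear c v (proj₁ (row-of q′)) }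

      -- At its own pivot c the factor δ_c - δ_c is zero; at every other pivot the row of M is.
      shears-vanish : All Vanishes (shears M)
      shears-vanish = All.tabulate λ q → case ∈-zipWith⁻ shear C M q of λ { (c , v , q′ , refl) → All.tabulate (at c v (row-of q′)) }
        where
        at : ∀ c v → PivotRow n C (c , v) → ∀ {c′} → c′ ∈ C → entry (shear c v) c′ ≡ 0F
        at c v (lv , _ , _ , z) {c′} c′∈ with c′ ≟ c
        ... | yes refl = trans (entry-shear c v c lv) (trans (cong (_*F entry v c) (R.-‿inverseʳ _)) (R.zeroˡ _))
        ... | no ne = trans (entry-shear c v c′ lv) (trans (cong (_ *F_) (z c′∈ ne)) (R.zeroʳ _))

      krylov-vanish : ∀ j → All Vanishes (krylov δ (shears M) j)
      krylov-vanish j = All.tabulate λ q → case ∈-krylov⁻ δ (shears M) j q of λ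
        { (i , v , _ , v∈ , refl) → All.tabulate λ {c} c∈ → at c i v (All.lookup hS v∈) (All.lookup (All.lookup shears-vanish v∈) c∈) }
        where
        at : ∀ c i v → length v ≡ n → entry v c ≡ 0F → entry (iter i Δ v) c ≡ 0F
        at c zero v l z = z
        at c (suc i) v l z = trans (!-Δ (iter i Δ v) (c ∸ 1) (length-iter i v l)) (trans (cong (_ *F_) (at c i v l z)) (R.zeroʳ _))

      -- Modulo the row space of M, the Krylov space of M is that of the sheared rows.
      module _ (j : ℕ) where
        private
          K = krylov δ M (suc j)
          K′ = krylov δ (shears M) j
          hK : V n K
          hK = V-krylov hM (suc j)
          hK′ : V n K′
          hK′ = V-krylov hS j
          hMK′ : V n (M ++ K′)
          hMK′ = AllP.++⁺ hM hK′

        -- For a row v with pivot c, applying Δ^i to Δ v = δ_c v + `shear c v` writes Δ^(i+1) v as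
        -- δ_c Δ^i v plus an element of `K′`, and the first term is covered by induction.
        krylov-⊆ : All (Span n (M ++ K′)) K
        krylov-⊆ = All.tabulate λ q → case ∈-krylov⁻ δ M (suc j) q of λ
          { (i , v , i< , v∈ , refl) → let c , q′ = ∈⇒∈-zip (RREF-length r) v∈ in go i i< q′ }
          where
          S = Span-IsSubspace hMK′
          go : ∀ i → i < suc j → ∀ {c v} → (c , v) ∈ zip C M → Span n (M ++ K′) (iter i Δ v)
          go zero _ q = span-∈ hMK′ (∈-++⁺ˡ (∈-zip⇒∈ʳ q))
          go (suc i) (s≤s i<) {c} {v} q = subst (Span n (M ++ K′))
            (sym (trans (iter-suc i Δ v) (trans (cong (iter i Δ) (Δ-shear c v lv))
              (trans (iter-⊕ i (entry δ c · v) (shear c v) (trans (length-map _ v) lv) ls) (cong (_⊕ iter i Δ (shear c v)) (iter-· i (entry δ c) v lv))))))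
            (IsSubspace.⊕-closed S (trans (length-map _ (iter i Δ v)) (length-iter i v lv)) (length-iter i _ ls)
               (IsSubspace.·-closed S _ (length-iter i v lv) (go i (m≤n⇒m≤1+n i<) q))
               (span-∈ hMK′ (∈-++⁺ʳ M (∈-krylov⁺ i< (∈-zipWith⁺ shear q)))))
            where
            lv = proj₁ (row-of q)
            ls = length-shear c v lv

        krylov-⊇ : All (Span n K) (M ++ K′)
        krylov-⊇ = AllP.++⁺ (All.tabulate λ v∈ → span-∈ hK (∈-krylov⁺ {δ} {M} {0} {suc j} (s≤s z≤n) v∈))
          (All.tabulate λ q → case ∈-krylov⁻ δ (shears M) j q of λ
            { (i , s , i< , s∈ , refl) → case ∈-zipWith⁻ shear C M s∈ of λ { (c , v , q′ , refl) → go i i< c v (proj₁ (row-of q′)) (∈-zip⇒∈ʳ q′) } })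
          where
          S = Span-IsSubspace hK
          go : ∀ i → i < j → ∀ c v → length v ≡ n → v ∈ M → Span n K (iter i Δ (shear c v))
          go i i< c v lv v∈ = subst (Span n K)
            (sym (trans (iter-⊕ i (Δ v) _ (length-Δ v lv) (trans (length-map _ v) lv))
               (cong₂ _⊕_ (sym (iter-suc i Δ v)) (iter-· i (-F entry δ c) v lv))))
            (IsSubspace.⊕-closed S (length-iter (suc i) v lv) (trans (length-map _ (iter i Δ v)) (length-iter i v lv))
               (span-∈ hK (∈-krylov⁺ {i = suc i} (s≤s i<) v∈))
               (IsSubspace.·-closed S _ (length-iter i v lv) (span-∈ hK (∈-krylov⁺ {i = i} (m≤n⇒m≤1+n i<) v∈))))

      krylov-reduced : ∀ j → krylov δ′ (reduce M) j ≡ map π (krylov δ (shears M) j)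
      krylov-reduced j = sym (trans (map-concatMap π _ (upTo j)) (concatMap-cong (λ i →
        trans (sym (map-∘ (shears M))) (trans (map-cong-∈ (shears M) λ {v} v∈ → π-iter i v (All.lookup hS v∈)) (map-∘ (shears M)))) (upTo j)))

      -- At the pivot of the first row all other vectors of the family are zero, hence so is their
      -- span, while the row itself is 1. This is the directness of the sum of W and the sheared
      -- Krylov space.
      indep-rref-++ : ∀ {D N bs} → RREF n D N → V n bs → Indep n bs → All (λ b → All (λ c → entry b c ≡ 0F) D) bs → Indep n (N ++ bs)
      indep-rref-++ [] hb ind z = ind
      indep-rref-++ {d ∷ D} {row ∷ N} (pivot lr one _ _ zc r) hb ind z =
        indep-∷ lr h (indep-rref-++ r hb ind (All.map All.tail z)) λ s →
          1F≢0F (trans (sym one) (span-min h (zero-at-IsSubspace d) (AllP.++⁺ zc (All.map All.head z)) s))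
        where
        h = AllP.++⁺ (RREF-V r) hb

      krylovDim-reduced : ∀ j → krylovDim n δ M (suc j) ≡ length C + krylovDim p δ′ (reduce M) j
      krylovDim-reduced j with subbasis (V-krylov hS j)
      ... | bs , bs∈ , hb , B =
        trans (dimSpan-basis {bs = M ++ bs} (V-krylov hM (suc j)) record
          { indep = indep-rref-++ r hb (Basis.indep B) zb
          ; spans = All.map (span-trans hMb (AllP.++⁺ (All.tabulate λ v∈ → span-∈ hMb (∈-++⁺ˡ v∈))
                      (All.map (span-trans hMb (All.tabulate λ v∈ → span-∈ hMb (∈-++⁺ʳ M v∈))) (Basis.spans B)))) (krylov-⊆ j)
          ; spanned = AllP.++⁺ (AllP.++⁻ˡ M (krylov-⊇ j))
                        (All.map (span-trans (V-krylov hM (suc j)) (AllP.++⁻ʳ M (krylov-⊇ j))) (Basis.spanned B)) })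
        (trans (length-++ M) (cong₂ _+_ (RREF-length r) (sym
          (trans (cong (dimSpan p) (krylov-reduced j))
          (trans (dimSpan-basis (AllP.map⁺ (All.tabulate λ {v} _ → length-π v)) (π-basis (V-krylov hS j) hb zb B)) (length-map π bs))))))
        where
        zb : All Vanishes bs
        zb = All.tabulate λ b∈ → All.lookup (krylov-vanish j) (∈-sublists⇒⊆ (krylov δ (shears M) j) bs∈ b∈)
        hMb : V n (M ++ bs)
        hMb = AllP.++⁺ hM hb

      +-cancel-≡ᵇ : ∀ m {a b} → (m + a ≡ᵇ m + b) ≡ (a ≡ᵇ b)
      +-cancel-≡ᵇ zero = refl
      +-cancel-≡ᵇ (suc m) = +-cancel-≡ᵇ m

      -- Subtracting |C| from both sides turns the condition of index j + 1 for M into that of index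
      -- j for B. The condition of index 1 becomes one about the Krylov space of order 0 and is
      -- always true.
      hasProfile-reduced : ∀ ν → hasProfile n δ M (length C ∷ ν) ≡ hasProfile p δ′ (reduce M) ν
      hasProfile-reduced ν = cong₂ _∧_ (cong₂ _∧_ first (cong and rest)) last
        where
        m = length C
        step : ∀ j s → (krylovDim n δ M (suc j) ≡ᵇ m + s) ≡ (krylovDim p δ′ (reduce M) j ≡ᵇ s)
        step j s = trans (cong (_≡ᵇ m + s) (krylovDim-reduced j)) (+-cancel-≡ᵇ m)
        first : (krylovDim n δ M 1 ≡ᵇ m + 0) ≡ true
        first = trans (step 0 0) (cong (_≡ᵇ 0) (krylovDim-0 p δ′ (reduce M)))
        rest : map (λ j → krylovDim n δ M j ≡ᵇ sum (take j (m ∷ ν))) (applyUpTo (λ i → suc (suc i)) (length ν))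
             ≡ map (λ j → krylovDim p δ′ (reduce M) j ≡ᵇ sum (take j ν)) (applyUpTo suc (length ν))
        rest = trans (map-applyUpTo _ _ (length ν)) (trans (applyUpTo-cong (length ν) λ i _ → step (suc i) (sum (take (suc i) ν)))
          (sym (map-applyUpTo _ _ (length ν))))
        last : (krylovDim n δ M (suc (length ν)) ≡ᵇ krylovDim n δ M (suc (suc (length ν)))) ≡ (krylovDim p δ′ (reduce M) (length ν) ≡ᵇ krylovDim p δ′ (reduce M) (suc (length ν)))
        last = trans (cong₂ _≡ᵇ_ (krylovDim-reduced (length ν)) (krylovDim-reduced (suc (length ν)))) (+-cancel-≡ᵇ m)

  -- The inverse of the reduction

  inv : Carrier → Carrier
  inv x with x ≟F 0F
  ... | yes _ = 0F
  ... | no x≢ = proj₁ (inverse x x≢)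

  inv-spec : ∀ {x} → x ≢ 0F → x *F inv x ≡ 1F
  inv-spec {x} x≢ with x ≟F 0F
  ... | yes e = ⊥-elim (x≢ e)
  ... | no x≢′ = proj₂ (inverse x x≢′)

  x-y≡0⇒x≡y : ∀ {x y} → x +F (-F y) ≡ 0F → x ≡ y
  x-y≡0⇒x≡y {x} {y} e = trans (sym (R.+-identityʳ x)) (trans (cong (x +F_) (sym (R.-‿inverseˡ y)))
    (trans (sym (R.+-assoc x _ y)) (trans (cong (_+F y) e) (R.+-identityˡ y))))

  if-≡ : ∀ {A : Set} {t c : ℕ} {x y : A} → t ≡ c → (if t ≡ᵇ c then x else y) ≡ x
  if-≡ {t = t} {c} e with t ≡ᵇ c | ≡⇒≡ᵇ t c e
  ... | true | _ = refl

  if-≢ : ∀ {A : Set} {t c : ℕ} {x y : A} → t ≢ c → (if t ≡ᵇ c then x else y) ≡ y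
  if-≢ {t = t} {c} ne with t ≡ᵇ c | ≡ᵇ⇒≡ t c
  ... | true | h = ⊥-elim (ne (h _))
  ... | false | _ = refl

  -- The zero outside E is what makes the lifted rows vanish on the other pivot columns.
  locate : List ℕ → Vec → ℕ → Carrier
  locate [] _ t = 0F
  locate (e ∷ E) [] t = 0F
  locate (e ∷ E) (x ∷ b) t = if t ≡ᵇ e then x else locate E b t

  locate-∉ : ∀ E b {t} → t ∉ E → locate E b t ≡ 0F
  locate-∉ [] b t∉ = refl
  locate-∉ (e ∷ E) [] t∉ = refl
  locate-∉ (e ∷ E) (x ∷ b) t∉ = trans (if-≢ (t∉ ∘ here)) (locate-∉ E b (t∉ ∘ there))

  locate-supported : ∀ {c t E b} → Pointwise (λ e a → c < e ⊎ a ≡ 0F) E b → ¬ c < t → locate E b t ≡ 0F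
  locate-supported [] c≮ = refl
  locate-supported {t = t} {e ∷ E} (s ∷ ss) c≮ with t ≟ e
  ... | no ne = trans (if-≢ ne) (locate-supported ss c≮)
  ... | yes refl with s
  ... | inj₁ c< = ⊥-elim (c≮ c<)
  ... | inj₂ z = trans (if-≡ {t = t} {t} refl) z

  map-locate : ∀ {E b} → Unique E → length b ≡ length E → map (locate E b) E ≡ b
  map-locate {[]} {[]} u l = refl
  map-locate {e ∷ E} {x ∷ b} (e∉ ∷ u) l = cong₂ _∷_ (if-≡ {t = e} refl)
    (trans (map-cong-∈ E λ t∈ → if-≢ λ t≡e → All.lookup e∉ t∈ (sym t≡e)) (map-locate u (suc-injective l)))

  locate-map : ∀ f E {t} → t ∈ E → locate E (map f E) t ≡ f t
  locate-map f (e ∷ E) {t} t∈ with t ≟ e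
  ... | yes refl = if-≡ {t = t} refl
  ... | no ne with t∈
  ... | here t≡ = ⊥-elim (ne t≡)
  ... | there q = trans (if-≢ ne) (locate-map f E q)

  module Lifting (n : ℕ) (δ : List Carrier) (lδ : length δ ≡ n) (Uδ : Unique δ) {C : List ℕ} (sub : Subset[ n ] C) where

    open Reduction n δ lδ Uδ sub public

    -- Solves (δ_t - δ_c) v_t = b_t for t outside C and sets the pivot to 1. With a total `inv` no
    -- case distinction on t in C is needed: there `locate` already gives 0.
    liftEntry : ℕ → Vec → ℕ → Carrier
    liftEntry c b t = if t ≡ᵇ c then 1F else inv (entry δ t +F (-F entry δ c)) *F locate E b t

    liftRow : ℕ → Vec → Vec
    liftRow c b = applyUpTo (λ i → liftEntry c b (suc i)) n

    lift : List Vec → List Vec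
    lift B = zipWith liftRow C B

    length-liftRow : ∀ c b → length (liftRow c b) ≡ n
    length-liftRow c b = length-applyUpTo (λ i → liftEntry c b (suc i)) n

    entry-liftRow : ∀ c b {t} → 1 ≤ t → t ≤ n → entry (liftRow c b) t ≡ liftEntry c b t
    entry-liftRow c b {suc t} _ u = nthD-applyUpTo 0F (λ i → liftEntry c b (suc i)) u

    δ-distinct : ∀ {t c} → 1 ≤ t → t ≤ n → 1 ≤ c → c ≤ n → t ≢ c → entry δ t +F (-F entry δ c) ≢ 0F
    δ-distinct {suc t} {suc c} _ ut _ uc ne e = ne (cong suc (nthD-injective 0F Uδ
      (subst (t <_) (sym lδ) ut) (subst (c <_) (sym lδ) uc) (x-y≡0⇒x≡y e)))

    C-bounds : ∀ {c} → c ∈ C → 1 ≤ c × c ≤ n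
    C-bounds = All.lookup (proj₂ sub)

    E-bounds : ∀ {t} → t ∈ E → 1 ≤ t × t ≤ n
    E-bounds t∈ = proj₁ (∈-complement⁻ n sub t∈)

    E≢C : ∀ {t c} → t ∈ E → c ∈ C → t ≢ c
    E≢C t∈ c∈ refl = proj₂ (∈-complement⁻ n sub t∈) c∈

    C∉E : ∀ {c} → c ∈ C → c ∉ E
    C∉E c∈ t∈ = E≢C t∈ c∈ refl

    δ-unit : ∀ {t c} → t ∈ E → c ∈ C → (entry δ t +F (-F entry δ c)) *F inv (entry δ t +F (-F entry δ c)) ≡ 1F
    δ-unit t∈ c∈ = let l , u = E-bounds t∈ ; l′ , u′ = C-bounds c∈ in inv-spec (δ-distinct l u l′ u′ (E≢C t∈ c∈))

    liftEntry-pivot : ∀ c b {t} → t ≡ c → liftEntry c b t ≡ 1F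
    liftEntry-pivot c b e = if-≡ e

    liftEntry-zero : ∀ c b {t} → t ≢ c → locate E b t ≡ 0F → liftEntry c b t ≡ 0F
    liftEntry-zero c b ne z = trans (if-≢ ne) (trans (cong (_ *F_) z) (R.zeroʳ _))

    liftRow-pivot : ∀ {c b} → c ∈ C → Pointwise (λ e a → c < e ⊎ a ≡ 0F) E b → PivotRow n C (c , liftRow c b)
    liftRow-pivot {c} {b} c∈ s = length-liftRow c b , trans (entry-liftRow c b (proj₁ (C-bounds c∈)) (proj₂ (C-bounds c∈))) (liftEntry-pivot c b refl) ,
      (λ t l t<c → trans (entry-liftRow c b l (≤-trans (<⇒≤ t<c) (proj₂ (C-bounds c∈)))) (liftEntry-zero c b (<⇒≢ t<c) (locate-supported s (<-asym t<c)))) ,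
      λ c′∈ ne → trans (entry-liftRow c b (proj₁ (C-bounds c′∈)) (proj₂ (C-bounds c′∈))) (liftEntry-zero c b ne (locate-∉ E b (C∉E c′∈)))

    lift-RREF : ∀ {B} → SupportedRows C E B → RREF n C (lift B)
    lift-RREF {B} s = PivotRows⇒RREF UC (trans (length-zipWith liftRow C B) (trans (cong (length C ⊓_) (sym (PW.Pointwise-length s))) (⊓-idem _))) (go id s)
      where
      go : ∀ {C′ B′} → C′ ⊆ C → SupportedRows C′ E B′ → All (PivotRow n C) (zip C′ (zipWith liftRow C′ B′))
      go sub [] = []
      go sub (s ∷ ss) = liftRow-pivot (sub (here refl)) s ∷ go (sub ∘ there) ss

    reduce-lift : ∀ {B} → length B ≡ length C → V p B → reduce (lift B) ≡ B
    reduce-lift = go id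
      where
      row : ∀ {c b} → c ∈ C → length b ≡ p → π (shear c (liftRow c b)) ≡ b
      row {c} {b} c∈ lb = trans (map-cong-∈ E λ {t} t∈ →
          let l , u = E-bounds t∈ in
          trans (entry-shear c (liftRow c b) t (length-liftRow c b))
          (trans (cong (_ *F_) (trans (entry-liftRow c b l u) (if-≢ (E≢C t∈ c∈))))
          (trans (sym (R.*-assoc _ _ _)) (trans (cong (_*F locate E b t) (δ-unit t∈ c∈)) (R.*-identityˡ _)))))
        (map-locate (Increasing⇒Unique (complement-Increasing n sub)) (trans lb (sym lE)))
      go : ∀ {C′ B′} → C′ ⊆ C → length B′ ≡ length C′ → V p B′ → map π (zipWith shear C′ (zipWith liftRow C′ B′)) ≡ B′
      go {[]} {[]} _ _ _ = refl
      go {c ∷ C′} {b ∷ B′} sub l (lb ∷ h) = cong₂ _∷_ (row (sub (here refl)) lb) (go (sub ∘ there) (suc-injective l) h)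

    lift-reduce : ∀ {M} → RREF n C M → lift (reduce M) ≡ M
    lift-reduce r = go id (RREF-length r) (RREF⇒PivotRows r)
      where
      row : ∀ {c v} → c ∈ C → PivotRow n C (c , v) → liftRow c (π (shear c v)) ≡ v
      row {c} {v} c∈ (lv , one , lead , z) = vec-ext-range (length-liftRow c _) lv λ {t} l u →
        trans (entry-liftRow c _ l u) (at t l u)
        where
        at : ∀ t → 1 ≤ t → t ≤ n → liftEntry c (π (shear c v)) t ≡ entry v t
        at t l u with t ≟ c
        ... | yes refl = trans (liftEntry-pivot c _ refl) (sym one)
        ... | no ne with t ∈? C
        ... | yes t∈ = trans (liftEntry-zero c _ ne (locate-∉ E _ (C∉E t∈))) (sym (z t∈ ne))
        ... | no t∉ = trans (if-≢ ne) (trans (cong (_ *F_) (trans (locate-map (entry (shear c v)) E t∈) (entry-shear c v t lv)))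
                (trans (sym (R.*-assoc _ _ _)) (trans (cong (_*F entry v t) (trans (R.*-comm _ _) (δ-unit t∈ c∈))) (R.*-identityˡ _))))
          where
          t∈ : t ∈ E
          t∈ = ∈-complement⁺ n sub l u t∉
      go : ∀ {C′ M′} → C′ ⊆ C → length M′ ≡ length C′ → All (PivotRow n C) (zip C′ M′) → zipWith liftRow C′ (map π (zipWith shear C′ M′)) ≡ M′
      go {[]} {[]} _ _ _ = refl
      go {c ∷ C′} {v ∷ M′} sub l (q ∷ qs) = cong₂ _∷_ (row (sub (here refl)) q) (go (sub ∘ there) (suc-injective l) qs)

    -- Left of the pivot the row is zero and shearing only rescales entries; equality of t and c is
    -- impossible since t is outside C.
    reduce-supported : ∀ {M} → RREF n C M → SupportedRows C E (reduce M)
    reduce-supported r = go id (RREF-length r) (RREF⇒PivotRows r)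
      where
      row : ∀ {c v} → c ∈ C → PivotRow n C (c , v) → ∀ {E′} → E′ ⊆ E → Pointwise (λ e a → c < e ⊎ a ≡ 0F) E′ (map (entry (shear c v)) E′)
      row c∈ q {[]} _ = []
      row {c} {v} c∈ q@(lv , _ , lead , _) {t ∷ E′} sub = at (<-cmp c t) ∷ row c∈ q (sub ∘ there)
        where
        at : _ → c < t ⊎ entry (shear c v) t ≡ 0F
        at (tri< c<t _ _) = inj₁ c<t
        at (tri≈ _ refl _) = ⊥-elim (C∉E c∈ (sub (here refl)))
        at (tri> _ _ t<c) = inj₂ (trans (entry-shear c v t lv) (trans (cong (_ *F_) (lead t (proj₁ (E-bounds (sub (here refl)))) t<c)) (R.zeroʳ _)))
      go : ∀ {C′ M′} → C′ ⊆ C → length M′ ≡ length C′ → All (PivotRow n C) (zip C′ M′) → SupportedRows C′ E (map π (zipWith shear C′ M′))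
      go {[]} {[]} _ _ _ = []
      go {c ∷ C′} {v ∷ M′} sub l (q ∷ qs) = row (sub (here refl)) q id ∷ go (sub ∘ there) (suc-injective l) qs

    length-reduce : ∀ {M} → RREF n C M → length (reduce M) ≡ length C
    length-reduce r = sym (PW.Pointwise-length (reduce-supported r))

    V-reduce : ∀ M → V p (reduce M)
    V-reduce M = AllP.map⁺ (All.tabulate λ {v} _ → length-π v)

  -- Counting echelon bases through their factorisations

  echelonBases : ℕ → Vec → List ℕ → List ℕ → List (List Vec)
  echelonBases n δ C μ = filterᵇ (λ M → isRREFWithPivots n C M ∧ hasProfile n δ M μ) (listsOver (listsOver elements n) (length C))

  echelonBases-Unique : ∀ n δ C μ → Unique (echelonBases n δ C μ)
  echelonBases-Unique n δ C μ = filterᵇ-Unique _ (listsOver-Unique (length C) (listsOver-Unique n elements-unique))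

  ∈-echelonBases⁺ : ∀ {n δ C μ M} → RREF n C M → T (hasProfile n δ M μ) → M ∈ echelonBases n δ C μ
  ∈-echelonBases⁺ {n} {δ} {C} {μ} {M} r t = ∈-filterᵇ⁺ (λ M → isRREFWithPivots n C M ∧ hasProfile n δ M μ)
    (∈-listsOver⁺ (length C) (RREF-length r) (All.map (λ {v} → ∈-allVecs v) (RREF-V r)))
    (T-∧⁺ {isRREFWithPivots n C M} (isRREF⇐ r) t)

  ∈-echelonBases⁻ : ∀ {n δ C μ M} → Unique C → M ∈ echelonBases n δ C μ → RREF n C M × T (hasProfile n δ M μ)
  ∈-echelonBases⁻ {n} {δ} {C} {μ} {M} u M∈ with ∈-filterᵇ⁻ (λ M → isRREFWithPivots n C M ∧ hasProfile n δ M μ)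
      (listsOver (listsOver elements n) (length C)) M∈
  ... | _ , t with T-∧⁻ {isRREFWithPivots n C M} t
  ... | t₁ , t₂ = isRREF⇒ C M u t₁ , t₂

  module Counting (n : ℕ) (δ : List Carrier) (lδ : length δ ≡ n) (Uδ : Unique δ) {C : List ℕ} (sub : Subset[ n ] C) (ν : List ℕ) where

    open Lifting n δ lδ Uδ sub

    ℓ m : ℕ
    ℓ = headOr0 ν
    m = length C

    Factor : Set
    Factor = List ℕ × List Vec × List Vec

    factors : List ℕ → List Factor
    factors D = map (D ,_) (cartesianProduct (columns C [] (select E D)) (echelonBases p δ′ D ν))

    allFactors : List Factor
    allFactors = concatMap factors (subsetsOfSize p ℓ)

    assemble : Factor → List Vec
    assemble (D , X , N) = lift (product-rows m p X N)

    -- Membership in `allFactors` in terms of mathematical properties. The bijection is proved with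
    -- these, and the enumeration enters only through `valid⇒∈` and `∈⇒valid`.
    record Valid (D : List ℕ) (X N : List Vec) : Set where
      field
        subset : Subset[ p ] D
        size : length D ≡ ℓ
        support : Pointwise (Supported C) (select E D) X
        indep : Indep m X
        rref : RREF p D N
        profile : T (hasProfile p δ′ N ν)

      hX : V m X
      hX = Supported-V support

      length-X : length X ≡ length D
      length-X = trans (sym (PW.Pointwise-length support)) (length-map _ D)

      length-X′ : length X ≡ length N
      length-X′ = trans length-X (sym (RREF-length rref))

      supportedRows : SupportedRows C E (product-rows m p X N)
      supportedRows = supported-product rref (complement-Increasing n sub) lE (proj₂ subset) support

      reduce-assemble : reduce (assemble (D , X , N)) ≡ product-rows m p X N
      reduce-assemble = reduce-lift (length-product-rows m p X N) (V-product-rows m X (RREF-V rref))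

      row-space-⊆ : All (Span p N) (product-rows m p X N)
      row-space-⊆ = product-rows-span m X (RREF-V rref) length-X′

      row-space-⊇ : All (Span p (product-rows m p X N)) N
      row-space-⊇ = span-product-rows hX indep (RREF-V rref) length-X′

    open Valid

    valid⇒∈ : ∀ {D X N} → Valid D X N → (D , X , N) ∈ allFactors
    valid⇒∈ {D} {X} {N} v = ∈-concatMap⁺′ factors
      (subst (λ k → D ∈ subsetsOfSize p k) (size v) (∈-subsetsOfSize⁺ p (subset v)))
      (∈-map⁺ (D ,_) (∈-cartesianProduct⁺
        (columns⁺ [] (support v) (subst (Indep m) (sym (++-identityʳ X)) (indep v)))
        (∈-echelonBases⁺ {p} {δ′} {D} {ν} (rref v) (profile v))))

    ∈⇒valid : ∀ {D X N} → (D , X , N) ∈ allFactors → Valid D X N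
    ∈⇒valid {D} {X} {N} q with ∈-concatMap⁻′ factors (subsetsOfSize p ℓ) q
    ... | D′ , D∈ , q′ with ∈-map⁻ (D′ ,_) q′
    ... | _ , q″ , refl with ∈-cartesianProduct⁻ (columns C [] (select E D)) (echelonBases p δ′ D ν) q″ | ∈-subsetsOfSize⁻ p ℓ D∈
    ... | X∈ , N∈ | s , l with columns⁻ C [] (select E D) [] indep-[] X∈ | ∈-echelonBases⁻ {p} {δ′} {D} {ν} (Increasing⇒Unique (proj₁ s)) N∈
    ... | sup , ind | r , t = record { subset = s ; size = l ; support = sup ; indep = subst (Indep m) (++-identityʳ X) ind ; rref = r ; profile = t }

    allFactors-Unique : Unique allFactors
    allFactors-Unique = concatMap-Unique factors (subsetsOfSize-Unique p ℓ)
      (λ D → UP.map⁺ (λ { refl → refl }) (UP.cartesianProduct⁺ (columns-Unique C [] (select E D)) (echelonBases-Unique p δ′ D ν)))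
      λ {D} {D′} q q′ → trans (sym (cong proj₁ (proj₂ (proj₂ (∈-map⁻ (D ,_) q))))) (cong proj₁ (proj₂ (proj₂ (∈-map⁻ (D′ ,_) q′))))

    assemble-∈ : ∀ {D X N} → Valid D X N → assemble (D , X , N) ∈ echelonBases n δ C (m ∷ ν)
    assemble-∈ {D} {X} {N} v = ∈-echelonBases⁺ {n} {δ} {C} {m ∷ ν} r (subst T (sym same) (profile v))
      where
      r : RREF n C (assemble (D , X , N))
      r = lift-RREF (supportedRows v)
      same : hasProfile n δ (assemble (D , X , N)) (m ∷ ν) ≡ hasProfile p δ′ N ν
      same = trans (hasProfile-reduced r ν) (trans (cong (λ B → hasProfile p δ′ B ν) (reduce-assemble v))
        (Diagonal.hasProfile-cong {p} δ′ lδ′ (V-product-rows m X (RREF-V (rref v))) (RREF-V (rref v)) (row-space-⊇ v) (row-space-⊆ v) ν))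

    -- Reducing gives the same B = X N on both sides. Because X has full column rank, B has the row
    -- space of N, so D and N are determined as its echelon form; X is then read off from the pivot
    -- columns of B.
    assemble-injective : ∀ {D X N D′ X′ N′} → Valid D X N → Valid D′ X′ N′ →
      assemble (D , X , N) ≡ assemble (D′ , X′ , N′) → _≡_ {A = Factor} (D , X , N) (D′ , X′ , N′)
    assemble-injective {D} {X} {N} {D′} {X′} {N′} v v′ e = same (rref-unique (rref v) (rref v′) (subset v) (subset v′)
        (All.map (span-trans (RREF-V (rref v′)) (subst (All (Span p N′)) (sym B≡) (row-space-⊆ v′))) (row-space-⊇ v))
        (All.map (span-trans (RREF-V (rref v)) (subst (All (Span p N)) B≡ (row-space-⊆ v))) (row-space-⊇ v′)))
      where
      B≡ : product-rows m p X N ≡ product-rows m p X′ N′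
      B≡ = trans (sym (reduce-assemble v)) (trans (cong reduce e) (reduce-assemble v′))
      same : D ≡ D′ × N ≡ N′ → _≡_ {A = Factor} (D , X , N) (D′ , X′ , N′)
      same (refl , refl) = cong (λ Y → D , Y , N) (trans (sym (pivotColumns-product (rref v) (hX v) (length-X v)))
        (trans (cong (pivotColumns D) B≡) (pivotColumns-product (rref v′) (hX v′) (length-X v′))))

    assemble-surjective : ∀ {M} → M ∈ echelonBases n δ C (m ∷ ν) → ∃ λ f → f ∈ allFactors × assemble f ≡ M
    assemble-surjective {M} M∈ with ∈-echelonBases⁻ {n} {δ} {C} {m ∷ ν} UC M∈
    ... | r , t with echelon p (reduce M) (V-reduce M)
    ... | D , N , s , r′ , sp , sp′ = (D , X , N) , valid⇒∈ v , trans (cong lift B-eq) (lift-reduce r)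
      where
      B : List Vec
      B = reduce M
      X : List Vec
      X = pivotColumns D B
      lB : length B ≡ m
      lB = length-reduce r
      profile-B : T (hasProfile p δ′ B ν)
      profile-B = subst T (hasProfile-reduced r ν) t
      B-eq : product-rows m p X N ≡ B
      B-eq = subst (λ k → product-rows k p X N ≡ B) lB (product-pivotColumns r′ sp)
      v : Valid D X N
      v = record
        { subset = s
        -- The rows of `N` form a basis of the row space of B, whose dimension is the first part of
        -- the profile `ν`.
        ; size = trans (sym (RREF-length r′)) (trans (sym (Diagonal.krylovDim-1 {p} δ′ lδ′ (V-reduce M)
                   record { indep = rref-indep r′ ; spans = sp ; spanned = sp′ })) (hasProfile-rank {p} {δ′} {B} ν profile-B))
        ; support = supported-pivotColumns (reduce-supported r) (All.map (λ (l , u) → l , subst (_ ≤_) (sym lE) u) (proj₂ s))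
        ; indep = subst (λ k → Indep k X) lB (indep-pivotColumns r′ (V-reduce M) sp′)
        ; rref = r′
        ; profile = subst T (Diagonal.hasProfile-cong {p} δ′ lδ′ (V-reduce M) (RREF-V r′) sp′ sp ν) profile-B }

    sigma≡factors : sigma n δ C (m ∷ ν) ≡ length allFactors
    sigma≡factors = trans (Unique-≈⇒length≡ (echelonBases-Unique n δ C (m ∷ ν))
        (map-Unique assemble allFactors-Unique λ q q′ → assemble-injective (∈⇒valid q) (∈⇒valid q′))
        (λ M∈ → let f , f∈ , e = assemble-surjective M∈ in subst (_∈ map assemble allFactors) e (∈-map⁺ assemble f∈))
        (λ q → let f , f∈ , e = ∈-map⁻ assemble q in subst (_∈ echelonBases n δ C (m ∷ ν)) (sym e) (assemble-∈ (∈⇒valid f∈))))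
      (length-map assemble allFactors)

    select-Increasing : ∀ {D} → Subset[ p ] D → Increasing (select E D)
    select-Increasing ([] , []) = []
    select-Increasing {suc d ∷ D} (d< ∷ i , (_ , u) ∷ a) =
      AllP.map⁺ (All.zipWith (λ { {suc e} (s≤s d<e , _ , u′) → nthD-< (complement-Increasing n sub) d<e (subst (e <_) (sym lE) u′) }) (d< , a))
      ∷ select-Increasing (i , a)

    select-∈ : ∀ {D} → All (λ d → 1 ≤ d × d ≤ p) D → All (_∈ E) (select E D)
    select-∈ a = AllP.map⁺ (All.map (λ { {suc d} (_ , u) → nthD-∈ 0 E (subst (d <_) (sym lE) u) }) a)

    length-factors : ∀ {D} → Subset[ p ] D → length (factors D) ≡ columnCount q C 0 (select E D) * sigma p δ′ D ν
    length-factors {D} s = trans (length-map _ (cartesianProduct (columns C [] (select E D)) (echelonBases p δ′ D ν)))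
      (trans (length-cartesianProductWith _,_ (columns C [] (select E D)) (echelonBases p δ′ D ν))
        (cong (_* sigma p δ′ D ν) (length-columns [] (select E D) [] indep-[] (select-Increasing s) (All.tabulate λ _ → []))))

    weight : List ℕ → ℕ
    weight D = cq q (T[ C , D ]in n)

    constant : ℕ
    constant = (q ∸ 1) ^ ℓ * q ^ (ℓ choose 2)

    multilinear : List ℕ → Bool
    multilinear D = isMultilinear (T[ C , D ]in n)

    columnCount≡weight : ℓ ≤ m → ∀ {D} → D ∈ subsetsOfSize p ℓ →
      columnCount q C 0 (select E D) ≡ (if multilinear D then constant * weight D else 0)
    columnCount≡weight ℓ≤m {D} D∈ with ∈-subsetsOfSize⁻ p ℓ D∈
    ... | s , l = subst (λ k → columnCount q C 0 (select E D) ≡ (if multilinear D then (q ∸ 1) ^ k * q ^ (k choose 2) * weight D else 0)) length-select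
       (columnCount-weight q {{>-nonZero (<-trans (s≤s z≤n) q≥2)}} (proj₁ sub) (select-Increasing s) (All.map proj₁ (proj₂ sub))
        (All.map (λ t∈ → proj₁ (E-bounds t∈)) e∈) (λ c∈ t∈ → C∉E c∈ (All.lookup e∈ t∈)) (subst (_≤ m) (sym length-select) ℓ≤m))
      where
      e∈ : All (_∈ E) (select E D)
      e∈ = select-∈ (proj₂ s)
      length-select : length (select E D) ≡ ℓ
      length-select = trans (length-map _ D) l

    -- Passes from the sum over all D, where the count of matrices X may be zero, to the sum over
    -- multilinear tableaux, and extracts the factor common to all D.
    sum-filter : ∀ (k : ℕ) (P : List ℕ → Bool) (a c s : List ℕ → ℕ) Ds → (∀ {D} → D ∈ Ds → a D ≡ (if P D then k * c D else 0)) →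
      sum (map (λ D → a D * s D) Ds) ≡ k * sum (map (λ D → c D * s D) (filterᵇ P Ds))
    sum-filter k P a c s [] h = sym (*-zeroʳ k)
    sum-filter k P a c s (D ∷ Ds) h with P D | h (here refl)
    ... | true | e = trans (cong₂ _+_ (trans (cong (_* s D) e) (*-assoc k (c D) (s D))) (sum-filter k P a c s Ds (h ∘ there)))
                           (sym (*-distribˡ-+ k (c D * s D) _))
    ... | false | e = trans (cong (λ x → x * s D + sum (map (λ D → a D * s D) Ds)) e) (sum-filter k P a c s Ds (h ∘ there))

    sigma-recursion : ℓ ≤ m → sigma n δ C (m ∷ ν) ≡
      constant * sum (map (λ D → weight D * sigma p δ′ D ν) (filterᵇ multilinear (subsetsOfSize p ℓ)))
    sigma-recursion ℓ≤m = trans sigma≡factors (trans (length-concatMap factors (subsetsOfSize p ℓ))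
      (trans (cong sum (map-cong-∈ (subsetsOfSize p ℓ) λ D∈ → length-factors (proj₁ (∈-subsetsOfSize⁻ p ℓ D∈))))
        (sum-filter constant multilinear (λ D → columnCount q C 0 (select E D)) weight (λ D → sigma p δ′ D ν) (subsetsOfSize p ℓ) (columnCount≡weight ℓ≤m))))

open import Data.Nat.Combinatorics using (_C_)

theorem4p18 : (F : FiniteField) → let open LinAlg F in
    (n : ℕ) (δ : List Carrier) → length δ ≡ n → Unique δ →
    (μ₁ : ℕ) (ν : List ℕ) → All (λ p → 0 < p) (μ₁ ∷ ν) → Linked _≥_ (μ₁ ∷ ν) →
    (Cs : List ℕ) → length Cs ≡ μ₁ → Linked _<_ Cs → All (λ c → (1 ≤ c) × (c ≤ n)) Cs →
    sigma n δ Cs (μ₁ ∷ ν)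
    ≡ (q ∸ 1) ^ headOr0 ν * q ^ (headOr0 ν C 2)
    * sum (map (λ D → cq q (T[ Cs , D ]in n)
    * sigma (n ∸ μ₁) (restrictDiag n δ Cs) D ν)
    (filterᵇ (λ D → isMultilinear (T[ Cs , D ]in n))
    (subsetsOfSize (n ∸ μ₁) (headOr0 ν))))
theorem4p18 F n δ lδ Uδ μ₁ ν _ decreasing Cs refl increasing bounds =
  sigma-recursion (head≤ decreasing)
  where
  open Theory.Counting F n δ lδ Uδ (Linked⇒AllPairs <-trans increasing , bounds) ν
  -- The inequality μ₂ ≤ μ₁ gives T(C,D) a row for each entry of its second column.
  head≤ : ∀ {a ν} → Linked _≥_ (a ∷ ν) → headOr0 ν ≤ a
  head≤ [-] = z≤n
  head≤ (a≥b ∷ _) = a≥b
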